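{- For every $\eta>0$ there is $b_0$ such that for every integer constant $b\ge b_0$ there is a constant $C$ for which the following holds for every $k\ge 3$. If $k$ stations execute the protocol SublinearDecrease$(b)$, each station switching off as soon as it receives the acknowledgement of its own successful transmission, and are activated by any adaptive adversary, then with probability at least $1-1/k^{\eta}$ every station transmits successfully within $C k\frac{\ln^2 k}{\ln\ln k}$ rounds after its own activation.
   Context: Model. $k$ anonymous identical stations share a channel. Time is divided into discrete synchronous rounds; there is no global clock available to the stations and no collision detection. Initially all stations are asleep. Each station holds one packet and is activated once, at a time chosen by an adversary. The activation round is round $0$ of the station's local clock, and the station may transmit from its local round $1$ on. In each round every active station either transmits or listens. A transmission is successful if and only if exactly one active station transmits in that round; the transmitter then receives an acknowledgement and switches off permanently. In all other cases nothing is received. The stations do not know $k$. An adaptive adversary decides online which station to activate and when, knowing the algorithm's code and the history of the computation but not future randomness; in total it activates $k$ stations. Protocol SublinearDecrease$(b)$ (executed by each station from its activation until it switches off): for $j=3,4,5,\ldots$: for $b$ rounds, transmit in each round with probability $\frac{\ln j}{j}$, independently over rounds and stations. -}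

module Defs where

open import Algebra.Definitions.RawSemiring using () renaming (_^_ to pow)
open import Data.Bool using (Bool; true; false; if_then_else_; _∧_)
open import Data.Empty using (⊥-elim)
open import Data.Fin.Subset using (Subset; ∣_∣)
open import Data.Integer as ℤ using (+_; -[1+_])
import Data.Integer.Properties as ℤₚ
open import Data.List using (List; []; _∷_)
open import Data.Nat as ℕ using (ℕ; zero; suc; NonZero; _!)
import Data.Nat.Properties as ℕₚ
open import Data.Product using (_×_; _,_; proj₁; proj₂; ∃-syntax)
open import Data.Rational as ℚ using (ℚ; 0ℚ; 1ℚ; ½; _+_; _*_; _-_; -_; _/_; _≤_; _<_) renaming (∣_∣ to abs)
import Data.Rational.Properties as ℚₚ
import Data.Rational.Solver as ℚ-Solver
import Data.Rational.Unnormalised as ℚᵘ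
import Data.Rational.Unnormalised.Properties as ℚᵘₚ
open import Data.Sum using (_⊎_; inj₁; inj₂)
open import Data.Vec as Vec using (Vec; []; _∷_)
open import Relation.Binary.PropositionalEquality using (_≡_; refl; sym; trans; cong; cong₂; subst; subst₂)
open import Relation.Nullary using (yes; no)

infixr 8 _^_

_^_ : ℚ → ℕ → ℚ
_^_ = pow ℚ.+-*-rawSemiring

ofℕ : ℕ → ℚ
ofℕ n = + n / 1

-- Total reciprocal, with inv 0 = 0.
inv : ℚ → ℚ
inv q with q ℚₚ.≟ 0ℚ
... | yes _  = 0ℚ
... | no q≢0 = (ℚ.1/ q) {{ℚ.≢-nonZero q≢0}}

module RationalLemmas where

  open ℚ-Solver.+-*-Solver
  open ℚₚ.≤-Reasoning

  ≤-by : ∀ {p q} e → 0ℚ ≤ e → p + e ≡ q → p ≤ q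
  ≤-by {p} e 0≤e refl = subst (_≤ p + e) (ℚₚ.+-identityʳ p) (ℚₚ.+-monoʳ-≤ p 0≤e)

  diff≥0 : ∀ {p q} → p ≤ q → 0ℚ ≤ q - p
  diff≥0 {p} {q} p≤q = subst (_≤ q - p) (ℚₚ.+-inverseʳ p) (ℚₚ.+-monoˡ-≤ (- p) p≤q)

  +-nn : ∀ {p q} → 0ℚ ≤ p → 0ℚ ≤ q → 0ℚ ≤ p + q
  +-nn = ℚₚ.+-mono-≤

  *-nn : ∀ {p q} → 0ℚ ≤ p → 0ℚ ≤ q → 0ℚ ≤ p * q
  *-nn {p} {q} 0≤p 0≤q = subst (_≤ p * q) (ℚₚ.*-zeroʳ p) (ℚₚ.*-monoˡ-≤-nonNeg p {{ℚ.nonNegative 0≤p}} 0≤q)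

  *-pos : ∀ {p q} → 0ℚ < p → 0ℚ < q → 0ℚ < p * q
  *-pos {p} {q} 0<p 0<q = ℚₚ.positive⁻¹ (p * q) {{ℚₚ.pos*pos⇒pos p {{ℚ.positive 0<p}} q {{ℚ.positive 0<q}}}}

  *-mono : ∀ {p q r s} → 0ℚ ≤ p → 0ℚ ≤ s → p ≤ q → r ≤ s → p * r ≤ q * s
  *-mono {p} {q} {r} {s} 0≤p 0≤s p≤q r≤s = ℚₚ.≤-trans
    (ℚₚ.*-monoˡ-≤-nonNeg p {{ℚ.nonNegative 0≤p}} r≤s)
    (ℚₚ.*-monoʳ-≤-nonNeg s {{ℚ.nonNegative 0≤s}} p≤q)

  *-monoˡ : ∀ {r p q} → 0ℚ ≤ r → p ≤ q → r * p ≤ r * q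
  *-monoˡ {r} 0≤r = ℚₚ.*-monoˡ-≤-nonNeg r {{ℚ.nonNegative 0≤r}}

  *-monoʳ : ∀ {r p q} → 0ℚ ≤ r → p ≤ q → p * r ≤ q * r
  *-monoʳ {r} 0≤r = ℚₚ.*-monoʳ-≤-nonNeg r {{ℚ.nonNegative 0≤r}}

  *-cancel : ∀ {p q r} → 0ℚ < r → p * r ≤ q * r → p ≤ q
  *-cancel {r = r} 0<r = ℚₚ.*-cancelʳ-≤-pos r {{ℚ.positive 0<r}}

  0≤1 : 0ℚ ≤ 1ℚ
  0≤1 = ℚₚ.nonNegative⁻¹ 1ℚ

  0<1 : 0ℚ < 1ℚ
  0<1 = ℚₚ.positive⁻¹ 1ℚ

  0<½ : 0ℚ < ½
  0<½ = ℚₚ.positive⁻¹ ½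

  +1-pos : ∀ {p} → 0ℚ ≤ p → 0ℚ < p + 1ℚ
  +1-pos 0≤p = ℚₚ.+-mono-≤-< 0≤p 0<1

  0≤abs : ∀ p → 0ℚ ≤ abs p
  0≤abs = ℚₚ.0≤∣p∣

  ≤abs : ∀ p → p ≤ abs p
  ≤abs p with ℚₚ.≤-total 0ℚ p
  ... | inj₁ 0≤p = ℚₚ.≤-reflexive (sym (ℚₚ.0≤p⇒∣p∣≡p 0≤p))
  ... | inj₂ p≤0 = ℚₚ.≤-trans p≤0 (0≤abs p)

  abs≤ : ∀ {p b} → p ≤ b → - p ≤ b → abs p ≤ b
  abs≤ {p} p≤b -p≤b with ℚₚ.∣p∣≡p∨∣p∣≡-p p
  ... | inj₁ e = subst (_≤ _) (sym e) p≤b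
  ... | inj₂ e = subst (_≤ _) (sym e) -p≤b

  abs-flip : ∀ p q → abs (p - q) ≡ abs (q - p)
  abs-flip p q = trans (cong abs (solve 2 (λ a b → a :- b := :- (b :- a)) refl p q)) (ℚₚ.∣-p∣≡∣p∣ (q - p))

  abs-0 : ∀ p → abs (p - p) ≡ 0ℚ
  abs-0 p = cong abs (ℚₚ.+-inverseʳ p)

  abs-tri : ∀ p q r → abs (p - r) ≤ abs (p - q) + abs (q - r)
  abs-tri p q r = subst (λ z → abs z ≤ abs (p - q) + abs (q - r))
    (solve 3 (λ a b c → (a :- b) :+ (b :- c) := a :- c) refl p q r)
    (ℚₚ.∣p+q∣≤∣p∣+∣q∣ (p - q) (q - r))

  inv-*ʳ : ∀ {q} → 0ℚ < q → q * inv q ≡ 1ℚ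
  inv-*ʳ {q} 0<q with q ℚₚ.≟ 0ℚ
  ... | yes q≡0 = ⊥-elim (ℚₚ.<-irrefl (sym q≡0) 0<q)
  ... | no q≢0  = ℚₚ.*-inverseʳ q {{ℚ.≢-nonZero q≢0}}

  inv-pos : ∀ {q} → 0ℚ < q → 0ℚ < inv q
  inv-pos {q} 0<q with q ℚₚ.≟ 0ℚ
  ... | yes q≡0 = ⊥-elim (ℚₚ.<-irrefl (sym q≡0) 0<q)
  ... | no q≢0  = ℚₚ.positive⁻¹ _ {{ℚₚ.1/pos⇒pos q {{ℚ.positive 0<q}}}}

  inv-anti : ∀ {p q} → 0ℚ < p → p ≤ q → inv q ≤ inv p
  inv-anti {p} {q} 0<p p≤q = *-cancel 0<p (*-cancel 0<q (begin
    inv q * p * q    ≡⟨ solve 3 (λ i a b → i :* a :* b := b :* i :* a) refl (inv q) p q ⟩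
    q * inv q * p    ≡⟨ cong (_* p) (inv-*ʳ 0<q) ⟩
    1ℚ * p           ≤⟨ *-monoˡ 0≤1 p≤q ⟩
    1ℚ * q           ≡⟨ cong (_* q) (inv-*ʳ 0<p) ⟨
    p * inv p * q    ≡⟨ solve 3 (λ i a b → a :* i :* b := i :* a :* b) refl (inv p) p q ⟩
    inv p * p * q    ∎))
    where 0<q = ℚₚ.<-≤-trans 0<p p≤q

  ofℕ-+ : ∀ m n → ofℕ (m ℕ.+ n) ≡ ofℕ m + ofℕ n
  ofℕ-+ m n = ℚₚ.toℚᵘ-injective (ℚᵘₚ.≃-trans (to (m ℕ.+ n)) (ℚᵘₚ.≃-sym (ℚᵘₚ.≃-trans (ℚₚ.toℚᵘ-homo-+ (ofℕ m) (ofℕ n))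
    (ℚᵘₚ.≃-trans (ℚᵘₚ.+-cong (to m) (to n)) (ℚᵘ.*≡* (cong (ℤ._* + 1) (cong₂ ℤ._+_ (ℤₚ.*-identityʳ (+ m)) (ℤₚ.*-identityʳ (+ n)))))))))
    where
    to : ∀ n → ℚ.toℚᵘ (ofℕ n) ℚᵘ.≃ ℚᵘ.mkℚᵘ (+ n) 0
    to n = ℚₚ.toℚᵘ-fromℚᵘ (ℚᵘ.mkℚᵘ (+ n) 0)

  ofℕ-* : ∀ m n → ofℕ (m ℕ.* n) ≡ ofℕ m * ofℕ n
  ofℕ-* zero n = sym (ℚₚ.*-zeroˡ (ofℕ n))
  ofℕ-* (suc m) n = begin-equality
    ofℕ (n ℕ.+ m ℕ.* n)       ≡⟨ ofℕ-+ n (m ℕ.* n) ⟩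
    ofℕ n + ofℕ (m ℕ.* n)     ≡⟨ cong (λ z → ofℕ n + z) (ofℕ-* m n) ⟩
    ofℕ n + ofℕ m * ofℕ n     ≡⟨ solve 2 (λ a b → b :+ a :* b := (con 1ℚ :+ a) :* b) refl (ofℕ m) (ofℕ n) ⟩
    (1ℚ + ofℕ m) * ofℕ n      ≡⟨ cong (_* ofℕ n) (ofℕ-+ 1 m) ⟨
    ofℕ (suc m) * ofℕ n       ∎

  0≤ofℕ : ∀ n → 0ℚ ≤ ofℕ n
  0≤ofℕ n = ℚₚ.nonNegative⁻¹ _ {{ℚₚ.normalize-nonNeg n 1}}

  ofℕ-mono : ∀ {m n} → m ℕ.≤ n → ofℕ m ≤ ofℕ n
  ofℕ-mono {m} {n} m≤n = ≤-by (ofℕ (n ℕ.∸ m)) (0≤ofℕ (n ℕ.∸ m))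
    (trans (sym (ofℕ-+ m (n ℕ.∸ m))) (cong ofℕ (ℕₚ.m+[n∸m]≡n m≤n)))

  0<ofℕ : ∀ n .{{_ : NonZero n}} → 0ℚ < ofℕ n
  0<ofℕ (suc n) = ℚₚ.<-≤-trans 0<1 (ofℕ-mono {1} {suc n} (ℕ.s≤s ℕ.z≤n))

  archimedean : ∀ q → ∃[ n ] q ≤ ofℕ n
  archimedean q@(ℚ.mkℚ i d _) = ℤ.∣ i ∣ , ℚₚ.toℚᵘ-cancel-≤ (ℚᵘₚ.≤-trans (ℚᵘ.*≤* le) (ℚᵘₚ.≤-reflexive
      (ℚᵘₚ.≃-sym (ℚₚ.toℚᵘ-fromℚᵘ (ℚᵘ.mkℚᵘ (+ ℤ.∣ i ∣) 0)))))
    where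
    le : i ℤ.* + 1 ℤ.≤ + ℤ.∣ i ∣ ℤ.* + suc d
    le = ℤₚ.≤-trans (ℤₚ.≤-reflexive (ℤₚ.*-identityʳ i)) (ℤₚ.≤-trans (i≤∣i∣ i)
      (ℤₚ.≤-trans (ℤ.+≤+ (ℕₚ.m≤m*n ℤ.∣ i ∣ (suc d))) (ℤₚ.≤-reflexive (ℤₚ.pos-* ℤ.∣ i ∣ (suc d)))))
      where
      i≤∣i∣ : ∀ i → i ℤ.≤ + ℤ.∣ i ∣
      i≤∣i∣ (+ n)    = ℤₚ.≤-refl
      i≤∣i∣ -[1+ n ] = ℤ.-≤+

IsCauchy : (ℕ → ℚ) → Set
IsCauchy x = ∀ ε → 0ℚ < ε → ∃[ N ] (∀ m n → N ℕ.≤ m → N ℕ.≤ n → abs (x m - x n) ≤ ε)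

record ℝ : Set where
  constructor mkℝ
  field
    seq    : ℕ → ℚ
    cauchy : IsCauchy seq

open ℝ public

infix 4 _<ᴿ_ _≤ᴿ_

_<ᴿ_ : ℝ → ℝ → Set
x <ᴿ y = ∃[ ε ] (0ℚ < ε × ∃[ N ] (∀ n → N ℕ.≤ n → seq x n + ε ≤ seq y n))

_≤ᴿ_ : ℝ → ℝ → Set
x ≤ᴿ y = ∀ ε → 0ℚ < ε → ∃[ N ] (∀ n → N ℕ.≤ n → seq x n ≤ seq y n + ε)

partialSum : (ℕ → ℚ) → ℚ → ℕ → ℚ
partialSum a q zero    = 0ℚ
partialSum a q (suc n) = partialSum a q n + a n * q ^ n

module CauchyLemmas where

  open RationalLemmas
  open ℚ-Solver.+-*-Solver using (solve; con; _:=_; _:+_; _:*_; _:-_; :-_)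
  open ℚₚ.≤-Reasoning

  max³ : ∀ a b c {n} → a ℕ.⊔ (b ℕ.⊔ c) ℕ.≤ n → a ℕ.≤ n × b ℕ.≤ n × c ℕ.≤ n
  max³ a b c le = ℕₚ.m⊔n≤o⇒m≤o a (b ℕ.⊔ c) le , ℕₚ.m⊔n≤o⇒m≤o b c bc , ℕₚ.m⊔n≤o⇒n≤o b c bc
    where bc = ℕₚ.m⊔n≤o⇒n≤o a (b ℕ.⊔ c) le

  private
    scale : ∀ ε i K L → (K + L + 1ℚ) * i ≡ 1ℚ → 0ℚ ≤ ε * i → K * (ε * i) + L * (ε * i) ≤ ε
    scale ε i K L Mi≡1 0≤c = ≤-by {K * (ε * i) + L * (ε * i)} {ε} (ε * i) 0≤c (begin-equality
      K * (ε * i) + L * (ε * i) + ε * i   ≡⟨ solve 4 (λ k l e i → k :* (e :* i) :+ l :* (e :* i) :+ e :* i := e :* ((k :+ l :+ con 1ℚ) :* i)) refl K L ε i ⟩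
      ε * ((K + L + 1ℚ) * i)              ≡⟨ cong (λ z → ε * z) Mi≡1 ⟩
      ε * 1ℚ                              ≡⟨ ℚₚ.*-identityʳ ε ⟩
      ε                                   ∎)

    scale-≤ : ∀ K L c {a b ε} → 0ℚ ≤ K → 0ℚ ≤ L → K * c + L * c ≤ ε → a ≤ c → b ≤ c → K * a + L * b ≤ ε
    scale-≤ K L c {a} {b} 0≤K 0≤L h a≤c b≤c = ℚₚ.≤-trans
      (ℚₚ.+-mono-≤ {K * a} {K * c} {L * b} {L * c} (*-monoˡ {K} {a} {c} 0≤K a≤c) (*-monoˡ {L} {b} {c} 0≤L b≤c)) h

  lipschitz : ∀ {x y z} → IsCauchy x → IsCauchy y → ∀ K L → 0ℚ ≤ K → 0ℚ ≤ L → ∀ N →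
    (∀ m n → N ℕ.≤ m → N ℕ.≤ n → abs (z m - z n) ≤ K * abs (x m - x n) + L * abs (y m - y n)) → IsCauchy z
  lipschitz {x} {y} {z} cx cy K L 0≤K 0≤L N lip ε 0<ε =
    step (ε * i) 0<c (scale ε i K L (inv-*ʳ {K + L + 1ℚ} 0<M) (ℚₚ.<⇒≤ 0<c))
    where
    i = inv (K + L + 1ℚ)
    0<M : 0ℚ < K + L + 1ℚ
    0<M = +1-pos {K + L} (+-nn {K} {L} 0≤K 0≤L)
    0<c : 0ℚ < ε * i
    0<c = *-pos {ε} {i} 0<ε (inv-pos {K + L + 1ℚ} 0<M)
    step : ∀ c → 0ℚ < c → K * c + L * c ≤ ε → ∃[ N ] (∀ m n → N ℕ.≤ m → N ℕ.≤ n → abs (z m - z n) ≤ ε)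
    step c 0<c h = N ℕ.⊔ (Nx ℕ.⊔ Ny) , λ m n p q → ℚₚ.≤-trans
      (lip m n (proj₁ (max³ N Nx Ny p)) (proj₁ (max³ N Nx Ny q)))
      (scale-≤ K L c 0≤K 0≤L h
        (proj₂ (cx c 0<c) m n (proj₁ (proj₂ (max³ N Nx Ny p))) (proj₁ (proj₂ (max³ N Nx Ny q))))
        (proj₂ (cy c 0<c) m n (proj₂ (proj₂ (max³ N Nx Ny p))) (proj₂ (proj₂ (max³ N Nx Ny q)))))
      where
      Nx = proj₁ (cx c 0<c)
      Ny = proj₁ (cy c 0<c)

  eventually-bounded : ∀ {x} → IsCauchy x → ∃[ B ] (0ℚ ≤ B × ∃[ N ] (∀ n → N ℕ.≤ n → abs (x n) ≤ B))
  eventually-bounded {x} cx = B , +-nn {abs (x N)} {1ℚ} (0≤abs (x N)) 0≤1 , N , bound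
    where
    N = proj₁ (cx 1ℚ 0<1)
    B = abs (x N) + 1ℚ
    bound : ∀ n → N ℕ.≤ n → abs (x n) ≤ B
    bound n N≤n = begin
      abs (x n)                   ≡⟨ cong abs (solve 2 (λ a b → a := b :+ (a :- b)) refl (x n) (x N)) ⟩
      abs (x N + (x n - x N))     ≤⟨ ℚₚ.∣p+q∣≤∣p∣+∣q∣ (x N) (x n - x N) ⟩
      abs (x N) + abs (x n - x N) ≤⟨ ℚₚ.+-monoʳ-≤ (abs (x N)) (proj₂ (cx 1ℚ 0<1) n N N≤n ℕₚ.≤-refl) ⟩
      B                           ∎

  const-cauchy : ∀ q → IsCauchy (λ _ → q)
  const-cauchy q ε 0<ε = 0 , λ _ _ _ _ → ℚₚ.≤-trans (ℚₚ.≤-reflexive (abs-0 q)) (ℚₚ.<⇒≤ 0<ε)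

  +-cauchy : ∀ {x y} → IsCauchy x → IsCauchy y → IsCauchy (λ n → x n + y n)
  +-cauchy {x} {y} cx cy = lipschitz {x} {y} {λ n → x n + y n} cx cy 1ℚ 1ℚ 0≤1 0≤1 0 λ m n _ _ → begin
    abs (x m + y m - (x n + y n))
      ≡⟨ cong abs (solve 4 (λ a b c d → a :+ b :- (c :+ d) := (a :- c) :+ (b :- d)) refl (x m) (y m) (x n) (y n)) ⟩
    abs ((x m - x n) + (y m - y n))
      ≤⟨ ℚₚ.∣p+q∣≤∣p∣+∣q∣ (x m - x n) (y m - y n) ⟩
    abs (x m - x n) + abs (y m - y n)
      ≡⟨ cong₂ _+_ (ℚₚ.*-identityˡ (abs (x m - x n))) (ℚₚ.*-identityˡ (abs (y m - y n))) ⟨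
    1ℚ * abs (x m - x n) + 1ℚ * abs (y m - y n) ∎

  neg-cauchy : ∀ {x} → IsCauchy x → IsCauchy (λ n → - x n)
  neg-cauchy {x} cx ε 0<ε = proj₁ (cx ε 0<ε) , λ m n p q →
    subst (λ z → abs z ≤ ε) (solve 2 (λ a b → b :- a := :- a :- (:- b)) refl (x m) (x n)) (proj₂ (cx ε 0<ε) n m q p)

  *-cauchy : ∀ {x y} → IsCauchy x → IsCauchy y → IsCauchy (λ n → x n * y n)
  *-cauchy {x} {y} cx cy = lipschitz {x} {y} {λ n → x n * y n} cx cy B A 0≤B 0≤A (N₁ ℕ.⊔ N₂) bound
    where
    A = proj₁ (eventually-bounded {x} cx)
    0≤A = proj₁ (proj₂ (eventually-bounded {x} cx))
    N₁ = proj₁ (proj₂ (proj₂ (eventually-bounded {x} cx)))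
    B = proj₁ (eventually-bounded {y} cy)
    0≤B = proj₁ (proj₂ (eventually-bounded {y} cy))
    N₂ = proj₁ (proj₂ (proj₂ (eventually-bounded {y} cy)))
    bound : ∀ m n → N₁ ℕ.⊔ N₂ ℕ.≤ m → N₁ ℕ.⊔ N₂ ℕ.≤ n →
      abs (x m * y m - x n * y n) ≤ B * abs (x m - x n) + A * abs (y m - y n)
    bound m n p q = begin
      abs (x m * y m - x n * y n)
        ≡⟨ cong abs (solve 4 (λ a b c d → a :* b :- c :* d := d :* (a :- c) :+ a :* (b :- d)) refl (x m) (y m) (x n) (y n)) ⟩
      abs (y n * (x m - x n) + x m * (y m - y n))
        ≤⟨ ℚₚ.∣p+q∣≤∣p∣+∣q∣ (y n * (x m - x n)) (x m * (y m - y n)) ⟩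
      abs (y n * (x m - x n)) + abs (x m * (y m - y n))
        ≡⟨ cong₂ _+_ (ℚₚ.∣p*q∣≡∣p∣*∣q∣ (y n) (x m - x n)) (ℚₚ.∣p*q∣≡∣p∣*∣q∣ (x m) (y m - y n)) ⟩
      abs (y n) * abs (x m - x n) + abs (x m) * abs (y m - y n)
        ≤⟨ ℚₚ.+-mono-≤ {abs (y n) * abs (x m - x n)} {B * abs (x m - x n)} {abs (x m) * abs (y m - y n)} {A * abs (y m - y n)}
                       (*-monoʳ {abs (x m - x n)} {abs (y n)} {B} (0≤abs (x m - x n)) (proj₂ (proj₂ (proj₂ (eventually-bounded {y} cy))) n (ℕₚ.m⊔n≤o⇒n≤o N₁ N₂ q)))
                       (*-monoʳ {abs (y m - y n)} {abs (x m)} {A} (0≤abs (y m - y n)) (proj₂ (proj₂ (proj₂ (eventually-bounded {x} cx))) m (ℕₚ.m⊔n≤o⇒m≤o N₁ N₂ p))) ⟩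
      B * abs (x m - x n) + A * abs (y m - y n) ∎

  inv-cauchy : ∀ {x} → IsCauchy x → ∀ c → 0ℚ < c → ∀ N → (∀ n → N ℕ.≤ n → c ≤ x n) → IsCauchy (λ n → inv (x n))
  inv-cauchy {x} cx c 0<c N c≤ = lipschitz {x} {λ _ → 0ℚ} {λ n → inv (x n)} cx (const-cauchy 0ℚ) (inv c * inv c) 0ℚ (*-nn {inv c} {inv c} 0≤ic 0≤ic) ℚₚ.≤-refl N bound
    where
    0≤ic = ℚₚ.<⇒≤ (inv-pos 0<c)
    bound : ∀ m n → N ℕ.≤ m → N ℕ.≤ n → abs (inv (x m) - inv (x n)) ≤ inv c * inv c * abs (x m - x n) + 0ℚ * abs (0ℚ - 0ℚ)
    bound m n p q = begin
      abs (i - j)                        ≡⟨ cong abs i-j ⟩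
      abs (i * j * (x n - x m))          ≡⟨ ℚₚ.∣p*q∣≡∣p∣*∣q∣ (i * j) (x n - x m) ⟩
      abs (i * j) * abs (x n - x m)      ≡⟨ cong₂ _*_ (ℚₚ.0≤p⇒∣p∣≡p (*-nn {i} {j} 0≤i 0≤j)) (abs-flip (x n) (x m)) ⟩
      i * j * abs (x m - x n)            ≤⟨ *-monoʳ {abs (x m - x n)} {i * j} {inv c * inv c} (0≤abs (x m - x n)) (*-mono {i} {inv c} {j} {inv c} 0≤i 0≤ic (inv-anti 0<c (c≤ m p)) (inv-anti 0<c (c≤ n q))) ⟩
      inv c * inv c * abs (x m - x n)    ≡⟨ ℚₚ.+-identityʳ (inv c * inv c * abs (x m - x n)) ⟨
      inv c * inv c * abs (x m - x n) + 0ℚ  ≡⟨ cong (λ z → inv c * inv c * abs (x m - x n) + z) (ℚₚ.*-zeroˡ (abs (0ℚ - 0ℚ))) ⟨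
      inv c * inv c * abs (x m - x n) + 0ℚ * abs (0ℚ - 0ℚ) ∎
      where
      i = inv (x m)
      j = inv (x n)
      0<x : ∀ k → N ℕ.≤ k → 0ℚ < x k
      0<x k N≤k = ℚₚ.<-≤-trans 0<c (c≤ k N≤k)
      0≤i = ℚₚ.<⇒≤ (inv-pos (0<x m p))
      0≤j = ℚₚ.<⇒≤ (inv-pos (0<x n q))
      i-j : i - j ≡ i * j * (x n - x m)
      i-j = begin-equality
        i - j                              ≡⟨ solve 2 (λ a b → a :- b := a :* con 1ℚ :- b :* con 1ℚ) refl i j ⟩
        i * 1ℚ - j * 1ℚ                    ≡⟨ cong₂ (λ s t → i * s - j * t) (inv-*ʳ (0<x n q)) (inv-*ʳ (0<x m p)) ⟨
        i * (x n * j) - j * (x m * i)      ≡⟨ solve 4 (λ a b c d → a :* (d :* b) :- b :* (c :* a) := a :* b :* (d :- c)) refl i j (x m) (x n) ⟩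
        i * j * (x n - x m)                ∎

  module _ (f g : ℕ → ℚ) (h : ∀ i → abs (f (suc i) - f i) ≤ g i - g (suc i)) where

    private
      up : ∀ d n → abs (f (d ℕ.+ n) - f n) ≤ g n - g (d ℕ.+ n)
      up zero    n = ℚₚ.≤-reflexive (trans (abs-0 (f n)) (sym (ℚₚ.+-inverseʳ (g n))))
      up (suc d) n = begin
        abs (f (suc (d ℕ.+ n)) - f n)
          ≤⟨ abs-tri (f (suc (d ℕ.+ n))) (f (d ℕ.+ n)) (f n) ⟩
        abs (f (suc (d ℕ.+ n)) - f (d ℕ.+ n)) + abs (f (d ℕ.+ n) - f n)
          ≤⟨ ℚₚ.+-mono-≤ {abs (f (suc (d ℕ.+ n)) - f (d ℕ.+ n))} {g (d ℕ.+ n) - g (suc (d ℕ.+ n))} {abs (f (d ℕ.+ n) - f n)} {g n - g (d ℕ.+ n)} (h (d ℕ.+ n)) (up d n) ⟩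
        (g (d ℕ.+ n) - g (suc (d ℕ.+ n))) + (g n - g (d ℕ.+ n))
          ≡⟨ solve 3 (λ a b c → (a :- b) :+ (c :- a) := c :- b) refl (g (d ℕ.+ n)) (g (suc (d ℕ.+ n))) (g n) ⟩
        g n - g (suc (d ℕ.+ n)) ∎

      telescope-≥ : ∀ m n → n ℕ.≤ m → abs (f m - f n) ≤ abs (g m - g n)
      telescope-≥ m n n≤m = ℚₚ.≤-trans
        (subst (λ k → abs (f k - f n) ≤ g n - g k) (ℕₚ.m∸n+n≡m n≤m) (up (m ℕ.∸ n) n))
        (subst (λ z → g n - g m ≤ z) (abs-flip (g n) (g m)) (≤abs (g n - g m)))

    telescope : ∀ m n → abs (f m - f n) ≤ abs (g m - g n)
    telescope m n with ℕₚ.≤-total m n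
    ... | inj₁ m≤n = subst₂ _≤_ (abs-flip (f n) (f m)) (abs-flip (g n) (g m)) (telescope-≥ n m m≤n)
    ... | inj₂ n≤m = telescope-≥ m n n≤m

  ^-nn : ∀ {q} → 0ℚ ≤ q → ∀ n → 0ℚ ≤ q ^ n
  ^-nn     0≤q zero    = 0≤1
  ^-nn {q} 0≤q (suc n) = *-nn {q} {q ^ n} 0≤q (^-nn 0≤q n)

  module Geometric (r δ : ℚ) (0≤r : 0ℚ ≤ r) (0<δ : 0ℚ < δ) (r+δ≡1 : r + δ ≡ 1ℚ) where

    private
      0≤δ = ℚₚ.<⇒≤ 0<δ

      r≡ : r ≡ 1ℚ - δ
      r≡ = trans (solve 2 (λ r d → r := (r :+ d) :- d) refl r δ) (cong (λ z → z - δ) r+δ≡1)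

    r≤1 : r ≤ 1ℚ
    r≤1 = ≤-by {r} {1ℚ} δ 0≤δ r+δ≡1

    decreasing : ∀ d n → r ^ (d ℕ.+ n) ≤ r ^ n
    decreasing zero    n = ℚₚ.≤-refl
    decreasing (suc d) n = begin
      r * r ^ (d ℕ.+ n)   ≤⟨ *-monoʳ {r ^ (d ℕ.+ n)} {r} {1ℚ} (^-nn 0≤r (d ℕ.+ n)) r≤1 ⟩
      1ℚ * r ^ (d ℕ.+ n)  ≡⟨ ℚₚ.*-identityˡ (r ^ (d ℕ.+ n)) ⟩
      r ^ (d ℕ.+ n)       ≤⟨ decreasing d n ⟩
      r ^ n               ∎

    bernoulli : ∀ n → r ^ n * (1ℚ + ofℕ n * δ) ≤ 1ℚ
    bernoulli zero    = ℚₚ.≤-reflexive (solve 1 (λ d → con 1ℚ :* (con 1ℚ :+ con 0ℚ :* d) := con 1ℚ) refl δ)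
    bernoulli (suc n) = ℚₚ.≤-trans (≤-by {r * r ^ n * (1ℚ + ofℕ (suc n) * δ)} {r ^ n * (1ℚ + ofℕ n * δ)}
        (r ^ n * (ofℕ (suc n) * (δ * δ))) (*-nn {r ^ n} (^-nn 0≤r n) (*-nn {ofℕ (suc n)} {δ * δ} (0≤ofℕ (suc n)) (*-nn {δ} {δ} 0≤δ 0≤δ)))
        eq) (bernoulli n)
      where
      eq : r * r ^ n * (1ℚ + ofℕ (suc n) * δ) + r ^ n * (ofℕ (suc n) * (δ * δ)) ≡ r ^ n * (1ℚ + ofℕ n * δ)
      eq = trans (cong₂ (λ r k → r * R * (1ℚ + k * δ) + R * (k * (δ * δ))) r≡ (ofℕ-+ 1 n))
        (solve 3 (λ R k d → (con 1ℚ :- d) :* R :* (con 1ℚ :+ (con 1ℚ :+ k) :* d) :+ R :* ((con 1ℚ :+ k) :* (d :* d))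
                         := R :* (con 1ℚ :+ k :* d)) refl (r ^ n) (ofℕ n) δ)
        where R = r ^ n

    small : ∀ ε → 0ℚ < ε → ∃[ N ] (∀ n → N ℕ.≤ n → r ^ n ≤ ε)
    small ε 0<ε = N , λ n N≤n → ℚₚ.≤-trans
        (subst (λ k → r ^ k ≤ r ^ N) (ℕₚ.m∸n+n≡m N≤n) (decreasing (n ℕ.∸ N) N))
        (*-cancel {r ^ N} {ε} {1ℚ + ofℕ N * δ} 0<1+Nδ (ℚₚ.≤-trans (bernoulli N) 1≤))
      where
      0<εδ : 0ℚ < ε * δ
      0<εδ = *-pos {ε} {δ} 0<ε 0<δ
      N = proj₁ (archimedean (inv (ε * δ)))
      0<1+Nδ : 0ℚ < 1ℚ + ofℕ N * δ
      0<1+Nδ = ℚₚ.+-mono-<-≤ {0ℚ} {1ℚ} {0ℚ} {ofℕ N * δ} 0<1 (*-nn {ofℕ N} {δ} (0≤ofℕ N) 0≤δ)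
      1≤ : 1ℚ ≤ ε * (1ℚ + ofℕ N * δ)
      1≤ = begin
        1ℚ                        ≡⟨ inv-*ʳ {ε * δ} 0<εδ ⟨
        ε * δ * inv (ε * δ)       ≤⟨ *-monoˡ {ε * δ} {inv (ε * δ)} {ofℕ N} (ℚₚ.<⇒≤ 0<εδ) (proj₂ (archimedean (inv (ε * δ)))) ⟩
        ε * δ * ofℕ N             ≤⟨ ≤-by {ε * δ * ofℕ N} {ε * (1ℚ + ofℕ N * δ)} ε (ℚₚ.<⇒≤ 0<ε)
                                       (solve 3 (λ e d n → e :* d :* n :+ e := e :* (con 1ℚ :+ n :* d)) refl ε δ (ofℕ N)) ⟩
        ε * (1ℚ + ofℕ N * δ)      ∎

    cauchy-^ : IsCauchy (λ n → r ^ n)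
    cauchy-^ ε 0<ε = proj₁ (small ε 0<ε) , λ m n p q →
        abs≤ {r ^ m - r ^ n} {ε} (half m n p q)
          (subst (_≤ ε) (solve 2 (λ a b → b :- a := :- (a :- b)) refl (r ^ m) (r ^ n)) (half n m q p))
      where
      half : ∀ m n → _ → _ → r ^ m - r ^ n ≤ ε
      half m n p q = ℚₚ.≤-trans (≤-by {r ^ m - r ^ n} {r ^ m} (r ^ n) (^-nn 0≤r n)
        (solve 2 (λ a b → a :- b :+ b := a) refl (r ^ m) (r ^ n))) (proj₂ (small ε 0<ε) m p)

  abs-^ : ∀ x {B} → abs x ≤ B → ∀ n → abs (x ^ n) ≤ B ^ n
  abs-^ x     h zero    = ℚₚ.≤-refl
  abs-^ x {B} h (suc n) = begin
    abs (x * x ^ n)        ≡⟨ ℚₚ.∣p*q∣≡∣p∣*∣q∣ x (x ^ n) ⟩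
    abs x * abs (x ^ n)    ≤⟨ *-mono {abs x} {B} {abs (x ^ n)} {B ^ n} (0≤abs x) (^-nn 0≤B n) h (abs-^ x h n) ⟩
    B * B ^ n              ∎
    where
    0≤B : 0ℚ ≤ B
    0≤B = ℚₚ.≤-trans (0≤abs x) h

  ^-lipschitz : ∀ x y {B} → abs x ≤ B → abs y ≤ B → ∀ n →
    abs (x ^ suc n - y ^ suc n) ≤ ofℕ (suc n) * B ^ n * abs (x - y)
  ^-lipschitz x y {B} hx hy zero = ℚₚ.≤-reflexive (begin-equality
    abs (x * 1ℚ - y * 1ℚ)       ≡⟨ cong₂ (λ a b → abs (a - b)) (ℚₚ.*-identityʳ x) (ℚₚ.*-identityʳ y) ⟩
    abs (x - y)                 ≡⟨ solve 1 (λ a → a := con 1ℚ :* con 1ℚ :* a) refl (abs (x - y)) ⟩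
    ofℕ 1 * 1ℚ * abs (x - y)    ∎)
  ^-lipschitz x y {B} hx hy (suc n) = begin
    abs (x * X - y * Y)
      ≡⟨ cong abs (solve 4 (λ x y X Y → x :* X :- y :* Y := x :* (X :- Y) :+ Y :* (x :- y)) refl x y X Y) ⟩
    abs (x * (X - Y) + Y * (x - y))
      ≤⟨ ℚₚ.∣p+q∣≤∣p∣+∣q∣ (x * (X - Y)) (Y * (x - y)) ⟩
    abs (x * (X - Y)) + abs (Y * (x - y))
      ≡⟨ cong₂ _+_ (ℚₚ.∣p*q∣≡∣p∣*∣q∣ x (X - Y)) (ℚₚ.∣p*q∣≡∣p∣*∣q∣ Y (x - y)) ⟩
    abs x * abs (X - Y) + abs Y * d
      ≤⟨ ℚₚ.+-mono-≤ {abs x * abs (X - Y)} {B * (k * B ^ n * d)} {abs Y * d} {B ^ suc n * d}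
           (*-mono {abs x} {B} {abs (X - Y)} {k * B ^ n * d} (0≤abs x)
             (*-nn {k * B ^ n} {d} (*-nn {k} {B ^ n} (0≤ofℕ (suc n)) (^-nn 0≤B n)) (0≤abs (x - y))) hx (^-lipschitz x y hx hy n))
           (*-monoʳ {d} {abs Y} {B ^ suc n} (0≤abs (x - y)) (abs-^ y hy (suc n))) ⟩
    B * (k * B ^ n * d) + B * B ^ n * d
      ≡⟨ solve 4 (λ B k P d → B :* (k :* P :* d) :+ B :* P :* d := (con 1ℚ :+ k) :* (B :* P) :* d) refl B k (B ^ n) d ⟩
    (1ℚ + k) * B ^ suc n * d
      ≡⟨ cong (λ z → z * B ^ suc n * d) (ofℕ-+ 1 (suc n)) ⟨
    ofℕ (suc (suc n)) * B ^ suc n * d ∎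
    where
    X = x ^ suc n
    Y = y ^ suc n
    k = ofℕ (suc n)
    d = abs (x - y)
    0≤B : 0ℚ ≤ B
    0≤B = ℚₚ.≤-trans (0≤abs x) hx

  module PowerSeries
    (a : ℕ → ℚ) (B K r δ : ℚ) (0≤K : 0ℚ ≤ K) (0≤r : 0ℚ ≤ r) (0<δ : 0ℚ < δ) (r+δ≡1 : r + δ ≡ 1ℚ)
    (dom  : ∀ i → abs (a i) * B ^ i ≤ K * r ^ i)
    (dom′ : ∀ i → abs (a (suc i)) * (ofℕ (suc i) * B ^ i) ≤ K * r ^ i)
    where

    private
      S : ℚ → ℕ → ℚ
      S = partialSum a

      Ks = K * inv δ

      0≤Ks : 0ℚ ≤ Ks
      0≤Ks = *-nn {K} {inv δ} 0≤K (ℚₚ.<⇒≤ (inv-pos 0<δ))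

      gap : ∀ i → K * r ^ i ≡ Ks * r ^ i - Ks * r ^ suc i
      gap i = begin-equality
        K * r ^ i                                ≡⟨ solve 2 (λ K R → K :* R := K :* con 1ℚ :* R) refl K (r ^ i) ⟩
        K * 1ℚ * r ^ i                           ≡⟨ cong (λ z → K * z * r ^ i) (inv-*ʳ 0<δ) ⟨
        K * (δ * inv δ) * r ^ i                  ≡⟨ solve 5 (λ K d i R r → K :* (d :* i) :* R := K :* i :* R :* ((r :+ d) :- r)) refl K δ (inv δ) (r ^ i) r ⟩
        Ks * r ^ i * ((r + δ) - r)               ≡⟨ cong (λ z → Ks * r ^ i * (z - r)) r+δ≡1 ⟩
        Ks * r ^ i * (1ℚ - r)                    ≡⟨ solve 3 (λ k R r → k :* R :* (con 1ℚ :- r) := k :* R :- k :* (r :* R)) refl Ks (r ^ i) r ⟩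
        Ks * r ^ i - Ks * r ^ suc i              ∎

      tail-bound : ∀ x → abs x ≤ B → ∀ m n → abs (S x m - S x n) ≤ Ks * abs (r ^ m - r ^ n)
      tail-bound x hx m n = ℚₚ.≤-trans (telescope (S x) (λ i → Ks * r ^ i) step m n) (ℚₚ.≤-reflexive (begin-equality
          abs (Ks * r ^ m - Ks * r ^ n)   ≡⟨ cong abs (solve 3 (λ k a b → k :* a :- k :* b := k :* (a :- b)) refl Ks (r ^ m) (r ^ n)) ⟩
          abs (Ks * (r ^ m - r ^ n))      ≡⟨ ℚₚ.∣p*q∣≡∣p∣*∣q∣ Ks (r ^ m - r ^ n) ⟩
          abs Ks * abs (r ^ m - r ^ n)    ≡⟨ cong (λ z → z * abs (r ^ m - r ^ n)) (ℚₚ.0≤p⇒∣p∣≡p 0≤Ks) ⟩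
          Ks * abs (r ^ m - r ^ n)        ∎))
        where
        step : ∀ i → abs (S x (suc i) - S x i) ≤ Ks * r ^ i - Ks * r ^ suc i
        step i = begin
          abs (S x i + a i * x ^ i - S x i)   ≡⟨ cong abs (solve 2 (λ s t → s :+ t :- s := t) refl (S x i) (a i * x ^ i)) ⟩
          abs (a i * x ^ i)                   ≡⟨ ℚₚ.∣p*q∣≡∣p∣*∣q∣ (a i) (x ^ i) ⟩
          abs (a i) * abs (x ^ i)             ≤⟨ *-monoˡ {abs (a i)} {abs (x ^ i)} {B ^ i} (0≤abs (a i)) (abs-^ x hx i) ⟩
          abs (a i) * B ^ i                   ≤⟨ dom i ⟩
          K * r ^ i                           ≡⟨ gap i ⟩
          Ks * r ^ i - Ks * r ^ suc i         ∎

      sum-lipschitz : ∀ x y → abs x ≤ B → abs y ≤ B → ∀ n → abs (S x n - S y n) ≤ Ks * abs (x - y)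
      sum-lipschitz x y hx hy zero    = *-nn {Ks} {abs (x - y)} 0≤Ks (0≤abs (x - y))
      sum-lipschitz x y hx hy (suc n) = ℚₚ.≤-trans (go n)
          (*-monoʳ {abs (x - y)} {Ks - Ks * r ^ n} {Ks} (0≤abs (x - y))
            (≤-by {Ks - Ks * r ^ n} {Ks} (Ks * r ^ n) (*-nn {Ks} {r ^ n} 0≤Ks (^-nn 0≤r n))
              (solve 2 (λ k t → k :- t :+ t := k) refl Ks (Ks * r ^ n))))
        where
        d = abs (x - y)
        go : ∀ n → abs (S x (suc n) - S y (suc n)) ≤ (Ks - Ks * r ^ n) * d
        go zero    = ℚₚ.≤-reflexive (trans (abs-0 (0ℚ + a 0 * 1ℚ))
          (solve 2 (λ k d → con 0ℚ := (k :- k :* con 1ℚ) :* d) refl Ks d))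
        go (suc n) = begin
          abs (S x m + a m * x ^ m - (S y m + a m * y ^ m))
            ≡⟨ cong abs (solve 5 (λ s t a p q → s :+ a :* p :- (t :+ a :* q) := (s :- t) :+ a :* (p :- q)) refl (S x m) (S y m) (a m) (x ^ m) (y ^ m)) ⟩
          abs ((S x m - S y m) + a m * (x ^ m - y ^ m))
            ≤⟨ ℚₚ.∣p+q∣≤∣p∣+∣q∣ (S x m - S y m) (a m * (x ^ m - y ^ m)) ⟩
          abs (S x m - S y m) + abs (a m * (x ^ m - y ^ m))
            ≡⟨ cong (λ z → abs (S x m - S y m) + z) (ℚₚ.∣p*q∣≡∣p∣*∣q∣ (a m) (x ^ m - y ^ m)) ⟩
          abs (S x m - S y m) + abs (a m) * abs (x ^ m - y ^ m)
            ≤⟨ ℚₚ.+-mono-≤ {abs (S x m - S y m)} {(Ks - Ks * r ^ n) * d} {abs (a m) * abs (x ^ m - y ^ m)} {K * r ^ n * d} (go n) term ⟩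
          (Ks - Ks * r ^ n) * d + K * r ^ n * d
            ≡⟨ cong (λ z → (Ks - Ks * r ^ n) * d + z * d) (gap n) ⟩
          (Ks - Ks * r ^ n) * d + (Ks * r ^ n - Ks * r ^ m) * d
            ≡⟨ solve 4 (λ k p q d → (k :- p) :* d :+ (p :- q) :* d := (k :- q) :* d) refl Ks (Ks * r ^ n) (Ks * r ^ m) d ⟩
          (Ks - Ks * r ^ m) * d ∎
          where
          m = suc n
          term : abs (a m) * abs (x ^ m - y ^ m) ≤ K * r ^ n * d
          term = begin
            abs (a m) * abs (x ^ m - y ^ m)
              ≤⟨ *-monoˡ {abs (a m)} {abs (x ^ m - y ^ m)} {ofℕ m * B ^ n * d} (0≤abs (a m)) (^-lipschitz x y hx hy n) ⟩
            abs (a m) * (ofℕ m * B ^ n * d)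
              ≡⟨ ℚₚ.*-assoc (abs (a m)) (ofℕ m * B ^ n) d ⟨
            abs (a m) * (ofℕ m * B ^ n) * d
              ≤⟨ *-monoʳ {d} {abs (a m) * (ofℕ m * B ^ n)} {K * r ^ n} (0≤abs (x - y)) (dom′ n) ⟩
            K * r ^ n * d ∎

    diagonal-cauchy : ∀ {x} → IsCauchy x → ∀ N → (∀ n → N ℕ.≤ n → abs (x n) ≤ B) → IsCauchy (λ n → partialSum a (x n) n)
    diagonal-cauchy {x} cx N bx = lipschitz {λ n → r ^ n} {x} {λ n → S (x n) n}
      (Geometric.cauchy-^ r δ 0≤r 0<δ r+δ≡1) cx Ks Ks 0≤Ks 0≤Ks N λ m n p q → begin
        abs (S (x m) m - S (x n) n)
          ≤⟨ abs-tri (S (x m) m) (S (x m) n) (S (x n) n) ⟩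
        abs (S (x m) m - S (x m) n) + abs (S (x m) n - S (x n) n)
          ≤⟨ ℚₚ.+-mono-≤ {abs (S (x m) m - S (x m) n)} {Ks * abs (r ^ m - r ^ n)} {abs (S (x m) n - S (x n) n)} {Ks * abs (x m - x n)}
               (tail-bound (x m) (bx m p) m n) (sum-lipschitz (x m) (x n) (bx m p) (bx n q) n) ⟩
        Ks * abs (r ^ m - r ^ n) + Ks * abs (x m - x n) ∎

fromℕ : ℕ → ℝ
fromℕ n = mkℝ (λ _ → ofℕ n) (CauchyLemmas.const-cauchy (ofℕ n))

0ᴿ 1ᴿ : ℝ
0ᴿ = fromℕ 0
1ᴿ = fromℕ 1

fromℚ : ℚ → ℝ
fromℚ q = mkℝ (λ _ → q) (CauchyLemmas.const-cauchy q)

infixl 6 _+ᴿ_ _-ᴿ_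
infixl 7 _*ᴿ_
infix  8 -ᴿ_

_+ᴿ_ : ℝ → ℝ → ℝ
x +ᴿ y = mkℝ (λ n → seq x n + seq y n) (CauchyLemmas.+-cauchy {seq x} {seq y} (cauchy x) (cauchy y))

-ᴿ_ : ℝ → ℝ
-ᴿ x = mkℝ (λ n → - seq x n) (CauchyLemmas.neg-cauchy {seq x} (cauchy x))

_-ᴿ_ : ℝ → ℝ → ℝ
x -ᴿ y = x +ᴿ (-ᴿ y)

_*ᴿ_ : ℝ → ℝ → ℝ
x *ᴿ y = mkℝ (λ n → seq x n * seq y n) (CauchyLemmas.*-cauchy {seq x} {seq y} (cauchy x) (cauchy y))

recip : (x : ℝ) → 0ᴿ <ᴿ x → ℝ
recip x (c , 0<c , N , c≤) = mkℝ (λ n → inv (seq x n))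
  (CauchyLemmas.inv-cauchy {seq x} (cauchy x) c 0<c N (λ n p → subst (_≤ seq x n) (ℚₚ.+-identityˡ c) (c≤ n p)))

expTerm : ℕ → ℚ
expTerm m = inv (ofℕ (m !))

-- The n-th approximation sums n terms of the series at the n-th approximation of
-- the argument; convergence is uniform on bounded sets, so this diagonal suffices.
expSeq : (ℕ → ℚ) → ℕ → ℚ
expSeq x n = partialSum expTerm (x n) n

-- ln y = 2 artanh u = 2 (u + u³/3 + u⁵/5 + …) with u = (y - 1) / (y + 1), for every y > 0.
lnTerm : ℕ → ℚ
lnTerm m = inv (ofℕ (suc (2 ℕ.* m)))

möbius : ℚ → ℚ
möbius y = (y - 1ℚ) * inv (y + 1ℚ)

lnSeq : (ℕ → ℚ) → ℕ → ℚ
lnSeq x n = ofℕ 2 * (möbius (x n) * partialSum lnTerm (möbius (x n) * möbius (x n)) n)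

module ExpLnLemmas where

  open RationalLemmas
  open CauchyLemmas
  open ℚ-Solver.+-*-Solver using (solve; con; _:=_; _:+_; _:*_; _:-_; :-_)
  open ℚₚ.≤-Reasoning

  private
    ^≤! : ∀ M .{{_ : NonZero M}} m → M ℕ.^ m ℕ.≤ M ℕ.^ M ℕ.* m !
    ^≤! M zero    = ℕₚ.≤-trans (ℕₚ.m^n>0 M M) (ℕₚ.≤-reflexive (sym (ℕₚ.*-identityʳ (M ℕ.^ M))))
    ^≤! M (suc m) with ℕₚ.≤-total (suc m) M
    ... | inj₁ m<M = ℕₚ.≤-trans (ℕₚ.^-monoʳ-≤ M m<M) (ℕₚ.m≤m*n (M ℕ.^ M) (suc m !) {{suc m ℕₚ.!≢0}})
    ... | inj₂ M≤m = ℕₚ.≤-trans (ℕₚ.*-mono-≤ M≤m (^≤! M m)) (ℕₚ.≤-reflexive (trans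
      (sym (ℕₚ.*-assoc (suc m) (M ℕ.^ M) (m !))) (trans (cong (ℕ._* m !) (ℕₚ.*-comm (suc m) (M ℕ.^ M))) (ℕₚ.*-assoc (M ℕ.^ M) (suc m) (m !)))))

    0<! : ∀ m → 0ℚ < ofℕ (m !)
    0<! m = 0<ofℕ (m !) {{m ℕₚ.!≢0}}

    0≤expTerm : ∀ m → 0ℚ ≤ expTerm m
    0≤expTerm m = ℚₚ.<⇒≤ (inv-pos (0<! m))

    ofℕ-^ : ∀ M i → ofℕ (M ℕ.^ i) ≡ ofℕ M ^ i
    ofℕ-^ M zero    = refl
    ofℕ-^ M (suc i) = trans (ofℕ-* M (M ℕ.^ i)) (cong (λ z → ofℕ M * z) (ofℕ-^ M i))

    ^-½ : ∀ B i → B ^ i ≡ (ofℕ 2 * B) ^ i * ½ ^ i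
    ^-½ B zero    = refl
    ^-½ B (suc i) = trans (cong (λ z → B * z) (^-½ B i))
      (solve 3 (λ B P Q → B :* (P :* Q) := con (ofℕ 2) :* B :* P :* (con ½ :* Q)) refl B ((ofℕ 2 * B) ^ i) (½ ^ i))

    module _ (b : ℕ) where
      M₀ = 2 ℕ.* suc b
      K₀ = ofℕ (M₀ ℕ.^ M₀)

      expDom⁺ : ∀ i → expTerm i * ofℕ (suc b) ^ i ≤ K₀ * ½ ^ i
      expDom⁺ i = begin
        t * ofℕ (suc b) ^ i                    ≡⟨ cong (λ z → t * z) (^-½ (ofℕ (suc b)) i) ⟩
        t * ((ofℕ 2 * ofℕ (suc b)) ^ i * h)    ≡⟨ cong (λ z → t * (z ^ i * h)) (ofℕ-* 2 (suc b)) ⟨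
        t * (ofℕ M₀ ^ i * h)                    ≡⟨ cong (λ z → t * (z * h)) (ofℕ-^ M₀ i) ⟨
        t * (ofℕ (M₀ ℕ.^ i) * h)                ≤⟨ *-monoˡ {t} {ofℕ (M₀ ℕ.^ i) * h} {ofℕ (M₀ ℕ.^ M₀ ℕ.* i !) * h} (0≤expTerm i)
                                                    (*-monoʳ {h} {ofℕ (M₀ ℕ.^ i)} {ofℕ (M₀ ℕ.^ M₀ ℕ.* i !)} (^-nn (ℚₚ.<⇒≤ 0<½) i) (ofℕ-mono (^≤! M₀ i))) ⟩
        t * (ofℕ (M₀ ℕ.^ M₀ ℕ.* i !) * h)        ≡⟨ cong (λ z → t * (z * h)) (ofℕ-* (M₀ ℕ.^ M₀) (i !)) ⟩
        t * (K₀ * ofℕ (i !) * h)                ≡⟨ solve 4 (λ t k f h → t :* (k :* f :* h) := f :* t :* (k :* h)) refl t K₀ (ofℕ (i !)) h ⟩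
        ofℕ (i !) * t * (K₀ * h)                ≡⟨ cong (λ z → z * (K₀ * h)) (inv-*ʳ (0<! i)) ⟩
        1ℚ * (K₀ * h)                           ≡⟨ ℚₚ.*-identityˡ (K₀ * h) ⟩
        K₀ * h                                  ∎
        where
        t = expTerm i
        h = ½ ^ i

      expDom : ∀ i → abs (expTerm i) * ofℕ (suc b) ^ i ≤ K₀ * ½ ^ i
      expDom i = subst (λ z → z * ofℕ (suc b) ^ i ≤ K₀ * ½ ^ i) (sym (ℚₚ.0≤p⇒∣p∣≡p (0≤expTerm i))) (expDom⁺ i)

      expTerm-suc : ∀ i → expTerm (suc i) * ofℕ (suc i) ≡ expTerm i
      expTerm-suc i = begin-equality
        s * n                  ≡⟨ solve 2 (λ s n → s :* n := s :* n :* con 1ℚ) refl s n ⟩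
        s * n * 1ℚ             ≡⟨ cong (λ z → s * n * z) (inv-*ʳ (0<! i)) ⟨
        s * n * (f * t)        ≡⟨ solve 4 (λ s n f t → s :* n :* (f :* t) := (n :* f) :* s :* t) refl s n f t ⟩
        n * f * s * t          ≡⟨ cong (λ z → z * s * t) (ofℕ-* (suc i) (i !)) ⟨
        ofℕ (suc i !) * s * t  ≡⟨ cong (λ z → z * t) (inv-*ʳ (0<! (suc i))) ⟩
        1ℚ * t                 ≡⟨ ℚₚ.*-identityˡ t ⟩
        t                      ∎
        where
        s = expTerm (suc i)
        t = expTerm i
        n = ofℕ (suc i)
        f = ofℕ (i !)

      expDom′ : ∀ i → abs (expTerm (suc i)) * (ofℕ (suc i) * ofℕ (suc b) ^ i) ≤ K₀ * ½ ^ i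
      expDom′ i = begin
        abs (expTerm (suc i)) * (ofℕ (suc i) * P)   ≡⟨ cong (λ z → z * (ofℕ (suc i) * P)) (ℚₚ.0≤p⇒∣p∣≡p (0≤expTerm (suc i))) ⟩
        expTerm (suc i) * (ofℕ (suc i) * P)         ≡⟨ ℚₚ.*-assoc (expTerm (suc i)) (ofℕ (suc i)) P ⟨
        expTerm (suc i) * ofℕ (suc i) * P           ≡⟨ cong (λ z → z * P) (expTerm-suc i) ⟩
        expTerm i * P                               ≤⟨ expDom⁺ i ⟩
        K₀ * ½ ^ i                                   ∎
        where P = ofℕ (suc b) ^ i

  exp-cauchy : ∀ {x} → IsCauchy x → IsCauchy (expSeq x)
  exp-cauchy {x} cx = PowerSeries.diagonal-cauchy expTerm (ofℕ (suc b)) (K₀ b) ½ ½ (0≤ofℕ (M₀ b ℕ.^ M₀ b)) (ℚₚ.<⇒≤ 0<½) 0<½ refl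
      (expDom b) (expDom′ b) {x} cx N
      (λ n p → ℚₚ.≤-trans (bx n p) (ℚₚ.≤-trans (proj₂ (archimedean B)) (ofℕ-mono (ℕₚ.n≤1+n b))))
    where
    B = proj₁ (eventually-bounded {x} cx)
    N = proj₁ (proj₂ (proj₂ (eventually-bounded {x} cx)))
    bx : ∀ n → N ℕ.≤ n → abs (x n) ≤ B
    bx = proj₂ (proj₂ (proj₂ (eventually-bounded {x} cx)))
    b = proj₁ (archimedean B)

  0≤lnTerm : ∀ m → 0ℚ ≤ lnTerm m
  0≤lnTerm m = ℚₚ.<⇒≤ (inv-pos (0<ofℕ (suc (2 ℕ.* m))))

  private
    lnTerm-* : ∀ m k → k ℕ.≤ suc (2 ℕ.* m) → lnTerm m * ofℕ k ≤ 1ℚ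
    lnTerm-* m k k≤ = begin
      lnTerm m * ofℕ k                 ≤⟨ *-monoˡ {lnTerm m} {ofℕ k} {ofℕ (suc (2 ℕ.* m))} (0≤lnTerm m) (ofℕ-mono k≤) ⟩
      lnTerm m * ofℕ (suc (2 ℕ.* m))   ≡⟨ ℚₚ.*-comm (lnTerm m) (ofℕ (suc (2 ℕ.* m))) ⟩
      ofℕ (suc (2 ℕ.* m)) * lnTerm m   ≡⟨ inv-*ʳ (0<ofℕ (suc (2 ℕ.* m))) ⟩
      1ℚ                               ∎

    module _ (r : ℚ) (0≤r : 0ℚ ≤ r) where
      lnDom : ∀ i → abs (lnTerm i) * r ^ i ≤ 1ℚ * r ^ i
      lnDom i = *-monoʳ {r ^ i} {abs (lnTerm i)} {1ℚ} (^-nn 0≤r i)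
        (subst (_≤ 1ℚ) (trans (ℚₚ.*-identityʳ (lnTerm i)) (sym (ℚₚ.0≤p⇒∣p∣≡p (0≤lnTerm i)))) (lnTerm-* i 1 (ℕ.s≤s ℕ.z≤n)))

      lnDom′ : ∀ i → abs (lnTerm (suc i)) * (ofℕ (suc i) * r ^ i) ≤ 1ℚ * r ^ i
      lnDom′ i = begin
        abs (lnTerm (suc i)) * (ofℕ (suc i) * r ^ i)   ≡⟨ cong (λ z → z * (ofℕ (suc i) * r ^ i)) (ℚₚ.0≤p⇒∣p∣≡p (0≤lnTerm (suc i))) ⟩
        lnTerm (suc i) * (ofℕ (suc i) * r ^ i)         ≡⟨ ℚₚ.*-assoc (lnTerm (suc i)) (ofℕ (suc i)) (r ^ i) ⟨
        lnTerm (suc i) * ofℕ (suc i) * r ^ i           ≤⟨ *-monoʳ {r ^ i} {lnTerm (suc i) * ofℕ (suc i)} {1ℚ} (^-nn 0≤r i)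
                                                            (lnTerm-* (suc i) (suc i) (ℕₚ.≤-trans (ℕₚ.m≤m+n (suc i) (suc i ℕ.+ 0)) (ℕₚ.n≤1+n (2 ℕ.* suc i)))) ⟩
        1ℚ * r ^ i                                     ∎

  -- 1 - u² = 4 y / (y + 1)² ≥ 4 c / (M + 1)²  when  c ≤ y ≤ M  and  u = möbius y.
  möbius² : ∀ y c M → 0ℚ < c → c ≤ y → y ≤ M →
    möbius y * möbius y ≤ 1ℚ - ofℕ 4 * c * (inv (M + 1ℚ) * inv (M + 1ℚ))
  möbius² y c M 0<c c≤y y≤M = ≤-by {u * u} {1ℚ - δ} (ofℕ 4 * y * (i * i) - δ) (diff≥0 {δ} {ofℕ 4 * y * (i * i)} δ≤) eq
    where
    0<y = ℚₚ.<-≤-trans 0<c c≤y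
    i = inv (y + 1ℚ)
    e = inv (M + 1ℚ)
    u = möbius y
    δ = ofℕ 4 * c * (e * e)
    0<y+1 : 0ℚ < y + 1ℚ
    0<y+1 = +1-pos {y} (ℚₚ.<⇒≤ 0<y)
    0<M+1 : 0ℚ < M + 1ℚ
    0<M+1 = +1-pos {M} (ℚₚ.≤-trans (ℚₚ.<⇒≤ 0<y) y≤M)
    0≤i : 0ℚ ≤ i
    0≤i = ℚₚ.<⇒≤ (inv-pos 0<y+1)
    0≤e : 0ℚ ≤ e
    0≤e = ℚₚ.<⇒≤ (inv-pos 0<M+1)
    e≤i : e ≤ i
    e≤i = inv-anti {y + 1ℚ} {M + 1ℚ} 0<y+1 (ℚₚ.+-monoˡ-≤ 1ℚ {y} {M} y≤M)
    0≤4 : 0ℚ ≤ ofℕ 4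
    0≤4 = 0≤ofℕ 4
    δ≤ : δ ≤ ofℕ 4 * y * (i * i)
    δ≤ = *-mono {ofℕ 4 * c} {ofℕ 4 * y} {e * e} {i * i} (*-nn {ofℕ 4} {c} 0≤4 (ℚₚ.<⇒≤ 0<c)) (*-nn {i} {i} 0≤i 0≤i)
           (*-monoˡ {ofℕ 4} {c} {y} 0≤4 c≤y) (*-mono {e} {i} {e} {i} 0≤e 0≤i e≤i e≤i)
    eq : u * u + (ofℕ 4 * y * (i * i) - δ) ≡ 1ℚ - δ
    eq = begin-equality
      u * u + (ofℕ 4 * y * (i * i) - δ)
        ≡⟨ solve 3 (λ y i d → (y :- con 1ℚ) :* i :* ((y :- con 1ℚ) :* i) :+ (con (ofℕ 4) :* y :* (i :* i) :- d)
                          := (y :+ con 1ℚ) :* i :* ((y :+ con 1ℚ) :* i) :- d) refl y i δ ⟩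
      (y + 1ℚ) * i * ((y + 1ℚ) * i) - δ
        ≡⟨ cong (λ z → z * z - δ) (inv-*ʳ 0<y+1) ⟩
      1ℚ * 1ℚ - δ ∎

  square-nn : ∀ u → 0ℚ ≤ u * u
  square-nn u with ℚₚ.≤-total 0ℚ u
  ... | inj₁ 0≤u = *-nn {u} {u} 0≤u 0≤u
  ... | inj₂ u≤0 = subst (0ℚ ≤_) (solve 1 (λ u → (:- u) :* (:- u) := u :* u) refl u)
    (*-nn { - u} { - u} (ℚₚ.neg-antimono-≤ u≤0) (ℚₚ.neg-antimono-≤ u≤0))

  ln-cauchy : ∀ {x} → IsCauchy x → ∀ c → 0ℚ < c → ∀ N → (∀ n → N ℕ.≤ n → c ≤ x n) → IsCauchy (lnSeq x)
  ln-cauchy {x} cx c 0<c N c≤ = *-cauchy {λ _ → ofℕ 2} {λ n → u n * F n} (const-cauchy (ofℕ 2)) (*-cauchy {u} {F} cu cF)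
    where
    u : ℕ → ℚ
    u n = möbius (x n)
    F : ℕ → ℚ
    F n = partialSum lnTerm (u n * u n) n
    cu : IsCauchy u
    cu = *-cauchy {λ n → x n - 1ℚ} {λ n → inv (x n + 1ℚ)} (+-cauchy {x} {λ _ → - 1ℚ} cx (const-cauchy (- 1ℚ)))
      (inv-cauchy {λ n → x n + 1ℚ} (+-cauchy {x} {λ _ → 1ℚ} cx (const-cauchy 1ℚ)) 1ℚ 0<1 N
        (λ n p → ≤-by {1ℚ} {x n + 1ℚ} (x n) (ℚₚ.≤-trans (ℚₚ.<⇒≤ 0<c) (c≤ n p)) (ℚₚ.+-comm 1ℚ (x n))))
    M = proj₁ (eventually-bounded {x} cx)
    0≤M : 0ℚ ≤ M
    0≤M = proj₁ (proj₂ (eventually-bounded {x} cx))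
    N′ = proj₁ (proj₂ (proj₂ (eventually-bounded {x} cx)))
    bx : ∀ n → N′ ℕ.≤ n → abs (x n) ≤ M
    bx = proj₂ (proj₂ (proj₂ (eventually-bounded {x} cx)))
    e = inv (M + 1ℚ)
    0<e : 0ℚ < e
    0<e = inv-pos (+1-pos {M} 0≤M)
    δ = ofℕ 4 * c * (e * e)
    0<δ : 0ℚ < δ
    0<δ = *-pos {ofℕ 4 * c} {e * e} (*-pos {ofℕ 4} {c} (0<ofℕ 4) 0<c) (*-pos {e} {e} 0<e 0<e)
    u²≤ : ∀ n → N ℕ.⊔ N′ ℕ.≤ n → u n * u n ≤ 1ℚ - δ
    u²≤ n p = möbius² (x n) c M 0<c (c≤ n (ℕₚ.m⊔n≤o⇒m≤o N N′ p)) (ℚₚ.≤-trans (≤abs (x n)) (bx n (ℕₚ.m⊔n≤o⇒n≤o N N′ p)))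
    0≤r : 0ℚ ≤ 1ℚ - δ
    0≤r = ℚₚ.≤-trans (square-nn (u (N ℕ.⊔ N′))) (u²≤ (N ℕ.⊔ N′) ℕₚ.≤-refl)
    cF : IsCauchy F
    cF = PowerSeries.diagonal-cauchy lnTerm (1ℚ - δ) 1ℚ (1ℚ - δ) δ 0≤1 0≤r 0<δ
      (solve 1 (λ d → con 1ℚ :- d :+ d := con 1ℚ) refl δ) (lnDom (1ℚ - δ) 0≤r) (lnDom′ (1ℚ - δ) 0≤r)
      {λ n → u n * u n} (*-cauchy {u} {u} cu cu) (N ℕ.⊔ N′)
      (λ n p → subst (_≤ 1ℚ - δ) (sym (ℚₚ.0≤p⇒∣p∣≡p (square-nn (u n)))) (u²≤ n p))

exp : ℝ → ℝ
exp x = mkℝ (expSeq (seq x)) (ExpLnLemmas.exp-cauchy {seq x} (cauchy x))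

ln : (x : ℝ) → 0ᴿ <ᴿ x → ℝ
ln x (c , 0<c , N , c≤) = mkℝ (lnSeq (seq x))
  (ExpLnLemmas.ln-cauchy {seq x} (cauchy x) c 0<c N (λ n p → subst (_≤ seq x n) (ℚₚ.+-identityˡ c) (c≤ n p)))

module Positivity where

  open RationalLemmas
  open CauchyLemmas
  open ExpLnLemmas
  open ℚ-Solver.+-*-Solver using (solve; con; _:=_; _:+_; _:*_; _:-_; :-_)
  open ℚₚ.≤-Reasoning

  fromℕ-pos : ∀ {k} → 1 ℕ.≤ k → 0ᴿ <ᴿ fromℕ k
  fromℕ-pos {k} 1≤k = ofℕ k , 0<ofℕ k {{ℕ.>-nonZero 1≤k}} , 0 , λ _ _ → ℚₚ.≤-reflexive (ℚₚ.+-identityˡ (ofℕ k))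

  private
    partialSum-mono : ∀ w → 0ℚ ≤ w → ∀ d n → partialSum lnTerm w n ≤ partialSum lnTerm w (d ℕ.+ n)
    partialSum-mono w 0≤w zero    n = ℚₚ.≤-refl
    partialSum-mono w 0≤w (suc d) n = ℚₚ.≤-trans (partialSum-mono w 0≤w d n)
      (≤-by {partialSum lnTerm w (d ℕ.+ n)} (lnTerm (d ℕ.+ n) * w ^ (d ℕ.+ n))
        (*-nn {lnTerm (d ℕ.+ n)} {w ^ (d ℕ.+ n)} (0≤lnTerm (d ℕ.+ n)) (^-nn 0≤w (d ℕ.+ n))) refl)

    partialSum-≥ : ∀ w e N → 0ℚ ≤ w → e ≤ partialSum lnTerm w N → ∀ n → N ℕ.≤ n → e ≤ partialSum lnTerm w n
    partialSum-≥ w e N 0≤w e≤ n N≤n = ℚₚ.≤-trans e≤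
      (subst (λ k → partialSum lnTerm w N ≤ partialSum lnTerm w k) (ℕₚ.m∸n+n≡m N≤n) (partialSum-mono w 0≤w (n ℕ.∸ N) N))

    lnSeq-≥ : ∀ x n d e → 0ℚ ≤ d → 0ℚ ≤ e → d ≤ möbius (x n) →
      e ≤ partialSum lnTerm (möbius (x n) * möbius (x n)) n → ofℕ 2 * (d * e) ≤ lnSeq x n
    lnSeq-≥ x n d e 0≤d 0≤e d≤ e≤ = *-monoˡ {ofℕ 2} {d * e} {u * F} (0≤ofℕ 2)
      (*-mono {d} {u} {e} {F} 0≤d (ℚₚ.≤-trans 0≤e e≤) d≤ e≤)
      where
      u = möbius (x n)
      F = partialSum lnTerm (möbius (x n) * möbius (x n)) n

  ln-pos : ∀ {x} (x>0 : 0ᴿ <ᴿ x) → 1ᴿ <ᴿ x → 0ᴿ <ᴿ ln x x>0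
  ln-pos {x} (_ , _ , _ , _) (ε , 0<ε , N , 1+ε≤) =
    ofℕ 2 * (d * 1ℚ) , *-pos {ofℕ 2} {d * 1ℚ} (0<ofℕ 2) (*-pos {d} {1ℚ} 0<d 0<1) , 1 ℕ.⊔ (N ℕ.⊔ N′) , λ n p →
      ℚₚ.≤-trans (ℚₚ.≤-reflexive (ℚₚ.+-identityˡ (ofℕ 2 * (d * 1ℚ))))
        (lnSeq-≥ (seq x) n d 1ℚ (ℚₚ.<⇒≤ 0<d) 0≤1 (d≤ n (proj₁ (proj₂ (max³ 1 N N′ p))) (proj₂ (proj₂ (max³ 1 N N′ p))))
          (partialSum-≥ (u n * u n) 1ℚ 1 (square-nn (u n)) ℚₚ.≤-refl n (proj₁ (max³ 1 N N′ p))))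
    where
    u : ℕ → ℚ
    u n = möbius (seq x n)
    B = proj₁ (eventually-bounded {seq x} (cauchy x))
    0≤B : 0ℚ ≤ B
    0≤B = proj₁ (proj₂ (eventually-bounded {seq x} (cauchy x)))
    N′ = proj₁ (proj₂ (proj₂ (eventually-bounded {seq x} (cauchy x))))
    bx : ∀ n → N′ ℕ.≤ n → abs (seq x n) ≤ B
    bx = proj₂ (proj₂ (proj₂ (eventually-bounded {seq x} (cauchy x))))
    e = inv (B + 1ℚ)
    0<e : 0ℚ < e
    0<e = inv-pos (+1-pos {B} 0≤B)
    d = ε * e
    0<d : 0ℚ < d
    0<d = *-pos {ε} {e} 0<ε 0<e
    d≤ : ∀ n → N ℕ.≤ n → N′ ℕ.≤ n → d ≤ u n
    d≤ n p q = *-mono {ε} {y - 1ℚ} {e} {inv (y + 1ℚ)} (ℚₚ.<⇒≤ 0<ε) (ℚₚ.<⇒≤ (inv-pos 0<y+1)) ε≤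
        (inv-anti {y + 1ℚ} {B + 1ℚ} 0<y+1 (ℚₚ.+-monoˡ-≤ 1ℚ {y} {B} (ℚₚ.≤-trans (≤abs y) (bx n q))))
      where
      y = seq x n
      ε≤ : ε ≤ y - 1ℚ
      ε≤ = subst (_≤ y - 1ℚ) (solve 1 (λ e → con 1ℚ :+ e :- con 1ℚ := e) refl ε) (ℚₚ.+-monoˡ-≤ (- 1ℚ) {1ℚ + ε} {y} (1+ε≤ n p))
      0<y+1 : 0ℚ < y + 1ℚ
      0<y+1 = +1-pos {y} (ℚₚ.≤-trans (ℚₚ.<⇒≤ 0<ε) (ℚₚ.≤-trans ε≤ (≤-by {y - 1ℚ} {y} 1ℚ 0≤1 (solve 1 (λ y → y :- con 1ℚ :+ con 1ℚ := y) refl y))))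

  -- ln k ≥ 2 · ½ · (1 + (½)²/3) = 1 + 1/12
  1<ln : ∀ {k} → 3 ℕ.≤ k → (k>0 : 0ᴿ <ᴿ fromℕ k) → 1ᴿ <ᴿ ln (fromℕ k) k>0
  1<ln {k} 3≤k (_ , _ , _ , _) = (+ 1 / 12) , ℚₚ.positive⁻¹ (+ 1 / 12) , 2 , λ n 2≤n →
      lnSeq-≥ (λ _ → q) n ½ (+ 13 / 12) (ℚₚ.<⇒≤ 0<½) (ℚₚ.nonNegative⁻¹ (+ 13 / 12)) ½≤u
        (partialSum-≥ (u * u) (+ 13 / 12) 2 (square-nn u) F₂ n 2≤n)
    where
    q = ofℕ k
    u = möbius q
    i = inv (q + 1ℚ)
    0<q+1 : 0ℚ < q + 1ℚ
    0<q+1 = +1-pos {q} (0≤ofℕ k)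
    ½≤u : ½ ≤ u
    ½≤u = ≤-by {½} {u} (½ * (q - ofℕ 3) * i) (*-nn {½ * (q - ofℕ 3)} {i} (*-nn {½} {q - ofℕ 3} (ℚₚ.<⇒≤ 0<½) (diff≥0 {ofℕ 3} {q} (ofℕ-mono 3≤k))) (ℚₚ.<⇒≤ (inv-pos 0<q+1)))
      (begin-equality
        ½ + ½ * (q - ofℕ 3) * i                          ≡⟨ solve 2 (λ q i → con ½ :+ con ½ :* (q :- con (ofℕ 3)) :* i := con ½ :* con 1ℚ :+ con ½ :* (q :- con (ofℕ 3)) :* i) refl q i ⟩
        ½ * 1ℚ + ½ * (q - ofℕ 3) * i                     ≡⟨ cong (λ z → ½ * z + ½ * (q - ofℕ 3) * i) (inv-*ʳ 0<q+1) ⟨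
        ½ * ((q + 1ℚ) * i) + ½ * (q - ofℕ 3) * i         ≡⟨ solve 2 (λ q i → con ½ :* ((q :+ con 1ℚ) :* i) :+ con ½ :* (q :- con (ofℕ 3)) :* i := (q :- con 1ℚ) :* i) refl q i ⟩
        (q - 1ℚ) * i ∎)
    F₂ : + 13 / 12 ≤ partialSum lnTerm (u * u) 2
    F₂ = begin
      + 13 / 12                                        ≤⟨ ℚₚ.+-monoʳ-≤ 1ℚ {+ 1 / 3 * (½ * ½)} {+ 1 / 3 * (u * u)} (*-monoˡ {+ 1 / 3} {½ * ½} {u * u} (ℚₚ.nonNegative⁻¹ (+ 1 / 3))
                                                             (*-mono {½} {u} {½} {u} (ℚₚ.<⇒≤ 0<½) (ℚₚ.≤-trans (ℚₚ.<⇒≤ 0<½) ½≤u) ½≤u ½≤u)) ⟩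
      1ℚ + + 1 / 3 * (u * u)                           ≡⟨ cong (λ z → 1ℚ + + 1 / 3 * z) (ℚₚ.*-identityʳ (u * u)) ⟨
      partialSum lnTerm (u * u) 2                      ∎

open Positivity using (fromℕ-pos; ln-pos; 1<ln)

lnℕ : (k : ℕ) → 1 ℕ.≤ k → ℝ
lnℕ k 1≤k = ln (fromℕ k) (fromℕ-pos 1≤k)

-- k ^ y for a real exponent y
powℕ : (k : ℕ) → 1 ℕ.≤ k → ℝ → ℝ
powℕ k 1≤k y = exp (y *ᴿ lnℕ k 1≤k)

3≤⇒1≤ : ∀ {k} → 3 ℕ.≤ k → 1 ℕ.≤ k
3≤⇒1≤ = ℕₚ.≤-trans (ℕ.s≤s ℕ.z≤n)

latencyBound : ℝ → (k : ℕ) → 3 ℕ.≤ k → ℝ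
latencyBound C k 3≤k = C *ᴿ fromℕ k *ᴿ (ln-k *ᴿ ln-k) *ᴿ recip (ln ln-k 0<ln-k) 0<ln-ln-k
  where
  0<k : 0ᴿ <ᴿ fromℕ k
  0<k = fromℕ-pos (3≤⇒1≤ 3≤k)
  ln-k = ln (fromℕ k) 0<k
  0<ln-k : 0ᴿ <ᴿ ln-k
  0<ln-k = ln-pos {fromℕ k} 0<k (1<fromℕ 3≤k)
    where
    1<fromℕ : ∀ {k} → 3 ℕ.≤ k → 1ᴿ <ᴿ fromℕ k
    1<fromℕ {k} 3≤k = 1ℚ , RationalLemmas.0<1 , 0 , λ _ _ → RationalLemmas.ofℕ-mono {2} {k} (ℕₚ.≤-trans (ℕₚ.n≤1+n 2) 3≤k)
  0<ln-ln-k : 0ᴿ <ᴿ ln ln-k 0<ln-k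
  0<ln-ln-k = ln-pos {ln-k} 0<ln-k (1<ln 3≤k 0<k)

-- `active r` is a station in round r of its local clock; `off r` has switched
-- off after a successful transmission in its local round r.
data Status : Set where
  asleep : Status
  active : ℕ → Status
  off    : ℕ → Status

-- The sets of stations that transmitted in the past rounds, latest first.
-- An adversary is deterministic, so this fixes every other part of the past.
History : ℕ → Set
History k = List (Subset k)

-- The stations to activate in the coming round; stations that have already
-- been activated are unaffected by being chosen again.
Adversary : ℕ → Set
Adversary k = History k → Subset k

nextRound : Bool → Status → Status
nextRound true  asleep     = active 0
nextRound false asleep     = asleep
nextRound _     (active r) = active (suc r)
nextRound _     (off r)    = off r

acknowledge : Bool → Status → Status
acknowledge true (active r) = off r
acknowledge _    s          = s

resolve : ∀ {k} → Subset k → Vec Status k → Vec Status k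
resolve c s = if ∣ c ∣ ℕ.≡ᵇ 1 then Vec.zipWith acknowledge c s else s

-- Local round 1 + r falls in the block of b rounds with index j = 3 + ⌊r / b⌋.
transmitProb : (b : ℕ) .{{_ : NonZero b}} → Status → ℝ
transmitProb b (active (suc r)) = lnℕ j 1≤j *ᴿ recip (fromℕ j) (fromℕ-pos 1≤j)
  where
  j = 3 ℕ.+ r ℕ./ b
  1≤j : 1 ℕ.≤ j
  1≤j = ℕ.s≤s ℕ.z≤n
transmitProb b _ = 0ᴿ

-- Expectation of f over independent coins with the given success probabilities.
expectation : ∀ {k} → Vec ℝ k → (Subset k → ℝ) → ℝ
expectation []       f = f []
expectation (p ∷ ps) f =
  p *ᴿ expectation ps (λ c → f (true ∷ c)) +ᴿ (1ᴿ -ᴿ p) *ᴿ expectation ps (λ c → f (false ∷ c))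

Event : ℕ → Set
Event k = Vec Status k → Bool

probFrom : (b : ℕ) .{{_ : NonZero b}} → ∀ {k} → Adversary k → ℕ → History k → Vec Status k → Event k → ℝ
probFrom b A zero    h s E = if E s then 1ᴿ else 0ᴿ
probFrom b A (suc n) h s E =
  expectation (Vec.map (transmitProb b) s′) (λ c → probFrom b A n (c ∷ h) (resolve c s′) E)
  where s′ = Vec.zipWith nextRound (A h) s

probAfter : (b : ℕ) .{{_ : NonZero b}} → ∀ {k} → Adversary k → ℕ → Event k → ℝ
probAfter b {k} A n E = probFrom b A n [] (Vec.replicate k asleep) E

-- For an event that persists once it holds, probAfter is nondecreasing in the
-- number of rounds, and the probability that the event ever holds in the
-- infinite execution is its supremum; this says that the supremum is at least p.
ProbAtLeast : (b : ℕ) .{{_ : NonZero b}} → ∀ {k} → Adversary k → Event k → ℝ → Set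
ProbAtLeast b A E p = ∀ ε → 0ℚ < ε → ∃[ n ] (p ≤ᴿ probAfter b A n E +ᴿ fromℚ ε)

-- An integer latency is at most the real T iff it is at most ⌊ T ⌋, and ⌊ T ⌋ is the
-- least natural L with T < L + 1 (for T ≥ 0).  The floor of a real is not computable,
-- so it enters only through this relation.
infix 4 ⌊_⌋≤_

⌊_⌋≤_ : ℝ → ℕ → Set
⌊ T ⌋≤ L = T <ᴿ fromℕ (suc L)

every : ∀ {k} → (Status → Bool) → Event k
every P = Vec.foldr′ (λ s t → P s ∧ t) true

activated : Status → Bool
activated asleep = false
activated _      = true

succeededWithin : ℕ → Status → Bool
succeededWithin L (off r) = r ℕ.≤ᵇ L
succeededWithin L _       = false

-- Every station is activated with probability 1.
ActivatesAll : (b : ℕ) .{{_ : NonZero b}} → ∀ {k} → Adversary k → Set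
ActivatesAll b A = ProbAtLeast b A (every activated) 1ᴿ

{-# OPTIONS --safe #-}
-- At a fixed precision n every real in the statement is a rational, so the proof works with the
-- rational process whose transmission probabilities are the n-th approximations of ln j / j.
--
-- Let ℓ ≈ log k, μ ≈ log ℓ, and let σ be the sum of the transmission probabilities in a round.
-- Over its first T = b 2ᴱ ≈ C k ℓ² / μ rounds a station spends probability mass O(b ℓ²), so only
-- O(b k ℓ² / μ) rounds are crowded (σ > μ / 2).  In a round with ½ ≤ σ ≤ μ / 2 some station
-- succeeds with probability at least ½ 8^(-μ), which is of order 1 / ℓ, and only k successes are
-- possible.  In a round with σ ≤ ½ a given station succeeds with probability at least
-- q = E / (16 · 2ᴱ).  The three cases are balanced in one supermartingale per station of age r
-- that has not yet succeeded,
--   (1 - q)^(T - r - H),   H = ⌊ remaining mass of all stations / crowded threshold ⌋ + g · (stations not yet off),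
-- with g = 4 · 8^μ, which is at least 1 if the station fails and starts at most at (1 - q)^(T / 2) ≤ 2^(-b ℓ / 32).
module Submission where

open import Defs
open import Algebra.Bundles using (CommutativeRing)
import Algebra.Properties.CommutativeSemiring.Exp as Exp
open import Data.Bool using (Bool; true; false; if_then_else_; _∧_; T)
import Data.Bool.Properties as Boolₚ
open import Data.Empty using (⊥; ⊥-elim)
open import Data.Fin using (Fin; zero; suc)
open import Data.Fin.Subset using (Subset; ∣_∣)
open import Data.List using ([]; _∷_)
open import Data.Nat as ℕ using (ℕ; zero; suc; _≤_; NonZero; _!)
import Data.Nat.DivMod as ℕ÷
import Data.Nat.Properties as ℕₚ
import Data.Nat.Solver as ℕ-Solver
open import Data.Product using (_×_; _,_; proj₁; proj₂; ∃-syntax)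
open import Data.Rational as ℚ using (ℚ; 0ℚ; 1ℚ; ½; _+_; _*_; _-_; -_; _<_) renaming (_≤_ to _≤ℚ_; ∣_∣ to abs)
import Data.Rational.Properties as ℚₚ
import Data.Rational.Solver as ℚ-Solver
open import Data.Sum using (_⊎_; inj₁; inj₂)
open import Data.Unit using (tt)
open import Data.Vec as Vec using (Vec; []; _∷_)
import Data.Vec.Properties as Vecₚ
open import Data.Vec.Relation.Unary.All as All using (All; []; _∷_)
import Data.Vec.Relation.Unary.All.Properties as Allₚ
open import Relation.Binary.PropositionalEquality using (_≡_; refl; sym; trans; cong; cong₂; subst; subst₂)
open RationalLemmas
open ℚ-Solver.+-*-Solver using (solve; con; _:=_; _:+_; _:*_; _:-_; :-_)
open Exp (CommutativeRing.commutativeSemiring ℚₚ.+-*-commutativeRing) using (^-homo-*; ^-assocʳ; ^-distrib-*)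

-- Against an adaptive adversary rounds are not independent. A potential that does not grow in
-- conditional mean, whichever stations are activated, makes the strategy irrelevant; summing it
-- over the stations replaces a union bound. Let w = 1 - q. Ageing by one round multiplies a
-- station's potential by 1 / w, so every round must win back a factor w. A crowded round does so by
-- lowering H by 1, a calm one through the station's own success. In between, any success frees g
-- units of H, a relative gain of 1 - w^g ≥ g q / 2 with probability at least ½ 8^(-μ), and g = 4 ·
-- 8^μ turns the product of these two bounds into exactly q. The obstacle at fixed precision is that
-- truncated series lack the functional equations of exp and ln. Upper bounds on ln hold at every
-- precision, but lower bounds only from a threshold on that grows with the range of arguments; the
-- range here ends with the horizon b 2ᴱ, so this threshold depends on E alone. The target k^(-η) is
-- a truncated series at a negative argument, and is bounded below through an approximate form of eʸ
-- e⁻ʸ = 1.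

module S = ℕ-Solver.+-*-Solver

-- Powers of rationals: monotonicity, Bernoulli's inequality, mean value estimates.

module Powers where

  open CauchyLemmas using (^-nn)
  open ℚₚ.≤-Reasoning

  1^ : ∀ n → 1ℚ ^ n ≡ 1ℚ
  1^ zero    = refl
  1^ (suc n) = trans (ℚₚ.*-identityˡ (1ℚ ^ n)) (1^ n)

  ofℕ-^ : ∀ m n → ofℕ (m ℕ.^ n) ≡ ofℕ m ^ n
  ofℕ-^ m zero    = refl
  ofℕ-^ m (suc n) = trans (ofℕ-* m (m ℕ.^ n)) (cong (λ z → ofℕ m * z) (ofℕ-^ m n))

  ofℕ-suc : ∀ n → ofℕ (suc n) ≡ 1ℚ + ofℕ n
  ofℕ-suc = ofℕ-+ 1

  ^-monoˡ : ∀ {a b} → 0ℚ ≤ℚ a → a ≤ℚ b → ∀ n → a ^ n ≤ℚ b ^ n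
  ^-monoˡ         0≤a a≤b zero    = ℚₚ.≤-refl
  ^-monoˡ {a} {b} 0≤a a≤b (suc n) =
    *-mono {a} {b} {a ^ n} {b ^ n} 0≤a (^-nn (ℚₚ.≤-trans 0≤a a≤b) n) a≤b (^-monoˡ 0≤a a≤b n)

  1≤^ : ∀ {a} → 1ℚ ≤ℚ a → ∀ n → 1ℚ ≤ℚ a ^ n
  1≤^ {a} 1≤a n = subst (_≤ℚ a ^ n) (1^ n) (^-monoˡ 0≤1 1≤a n)

  ^≤1 : ∀ {a} → 0ℚ ≤ℚ a → a ≤ℚ 1ℚ → ∀ n → a ^ n ≤ℚ 1ℚ
  ^≤1 {a} 0≤a a≤1 n = subst (a ^ n ≤ℚ_) (1^ n) (^-monoˡ 0≤a a≤1 n)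

  ^-monoʳ : ∀ {a} → 1ℚ ≤ℚ a → ∀ {m n} → m ≤ n → a ^ m ≤ℚ a ^ n
  ^-monoʳ {a} 1≤a {m} {n} m≤n = begin
    a ^ m                     ≡⟨ ℚₚ.*-identityʳ (a ^ m) ⟨
    a ^ m * 1ℚ                ≤⟨ *-monoˡ {a ^ m} {1ℚ} {a ^ (n ℕ.∸ m)} (^-nn (ℚₚ.≤-trans 0≤1 1≤a) m) (1≤^ 1≤a (n ℕ.∸ m)) ⟩
    a ^ m * a ^ (n ℕ.∸ m)     ≡⟨ ^-homo-* a m (n ℕ.∸ m) ⟨
    a ^ (m ℕ.+ (n ℕ.∸ m))     ≡⟨ cong (a ^_) (ℕₚ.m+[n∸m]≡n m≤n) ⟩
    a ^ n                     ∎

  ^-antiʳ : ∀ {a} → 0ℚ ≤ℚ a → a ≤ℚ 1ℚ → ∀ {m n} → m ≤ n → a ^ n ≤ℚ a ^ m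
  ^-antiʳ {a} 0≤a a≤1 {m} {n} m≤n = begin
    a ^ n                     ≡⟨ cong (a ^_) (ℕₚ.m+[n∸m]≡n m≤n) ⟨
    a ^ (m ℕ.+ (n ℕ.∸ m))     ≡⟨ ^-homo-* a m (n ℕ.∸ m) ⟩
    a ^ m * a ^ (n ℕ.∸ m)     ≤⟨ *-monoˡ {a ^ m} {a ^ (n ℕ.∸ m)} {1ℚ} (^-nn 0≤a m) (^≤1 0≤a a≤1 (n ℕ.∸ m)) ⟩
    a ^ m * 1ℚ                ≡⟨ ℚₚ.*-identityʳ (a ^ m) ⟩
    a ^ m                     ∎

  ^-inverse : ∀ {a b} → a * b ≡ 1ℚ → ∀ n → a ^ n * b ^ n ≡ 1ℚ
  ^-inverse {a} {b} ab≡1 n = trans (sym (^-distrib-* a b n)) (trans (cong (_^ n) ab≡1) (1^ n))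

  -- The identity (1 - q) (1 + (n + 1) q) = 1 + n q - (n + 1) q² keeps the product from growing. The
  -- multiplicative form bounds powers of `w` from above without a division.
  bernoulli⁻ : ∀ {w q} → 0ℚ ≤ℚ w → 0ℚ ≤ℚ q → w + q ≡ 1ℚ → ∀ n → w ^ n * (1ℚ + ofℕ n * q) ≤ℚ 1ℚ
  bernoulli⁻ {w} {q} 0≤w 0≤q w+q≡1 zero    = ℚₚ.≤-reflexive (solve 1 (λ q → con 1ℚ :* (con 1ℚ :+ con 0ℚ :* q) := con 1ℚ) refl q)
  bernoulli⁻ {w} {q} 0≤w 0≤q w+q≡1 (suc n) = ℚₚ.≤-trans
      (≤-by {w * W * (1ℚ + ofℕ (suc n) * q)} {W * (1ℚ + ofℕ n * q)} (W * ((1ℚ + ofℕ n) * (q * q)))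
        (*-nn {W} (^-nn 0≤w n) (*-nn {1ℚ + ofℕ n} (+-nn {1ℚ} {ofℕ n} 0≤1 (0≤ofℕ n)) (*-nn {q} {q} 0≤q 0≤q))) eq)
      (bernoulli⁻ 0≤w 0≤q w+q≡1 n)
    where
    W = w ^ n
    w≡ : w ≡ 1ℚ - q
    w≡ = trans (solve 2 (λ w q → w := w :+ q :- q) refl w q) (cong (_- q) w+q≡1)
    eq : w * W * (1ℚ + ofℕ (suc n) * q) + W * ((1ℚ + ofℕ n) * (q * q)) ≡ W * (1ℚ + ofℕ n * q)
    eq = trans (cong₂ (λ w m → w * W * (1ℚ + m * q) + W * ((1ℚ + ofℕ n) * (q * q))) w≡ (ofℕ-suc n))
      (solve 3 (λ W m q → (con 1ℚ :- q) :* W :* (con 1ℚ :+ (con 1ℚ :+ m) :* q) :+ W :* ((con 1ℚ :+ m) :* (q :* q))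
                       := W :* (con 1ℚ :+ m :* q)) refl W (ofℕ n) q)

  bernoulli⁺ : ∀ {w q} → 0ℚ ≤ℚ w → 0ℚ ≤ℚ q → w + q ≡ 1ℚ → ∀ n → 1ℚ - ofℕ n * q ≤ℚ w ^ n
  bernoulli⁺ {w} {q} 0≤w 0≤q w+q≡1 zero    = ℚₚ.≤-reflexive (solve 1 (λ q → con 1ℚ :- con 0ℚ :* q := con 1ℚ) refl q)
  bernoulli⁺ {w} {q} 0≤w 0≤q w+q≡1 (suc n) = begin
    1ℚ - ofℕ (suc n) * q                     ≤⟨ ≤-by (ofℕ n * (q * q)) (*-nn (0≤ofℕ n) (*-nn 0≤q 0≤q)) eq ⟩
    w * (1ℚ - ofℕ n * q)                     ≤⟨ *-monoˡ {w} {1ℚ - ofℕ n * q} {w ^ n} 0≤w (bernoulli⁺ 0≤w 0≤q w+q≡1 n) ⟩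
    w * w ^ n                                ∎
    where
    w≡ : w ≡ 1ℚ - q
    w≡ = trans (solve 2 (λ w q → w := w :+ q :- q) refl w q) (cong (_- q) w+q≡1)
    eq : 1ℚ - ofℕ (suc n) * q + ofℕ n * (q * q) ≡ w * (1ℚ - ofℕ n * q)
    eq = trans (cong (λ m → 1ℚ - m * q + ofℕ n * (q * q)) (ofℕ-suc n)) (trans
      (solve 2 (λ m q → con 1ℚ :- (con 1ℚ :+ m) :* q :+ m :* (q :* q) := (con 1ℚ :- q) :* (con 1ℚ :- m :* q)) refl (ofℕ n) q)
      (cong (_* (1ℚ - ofℕ n * q)) (sym w≡)))

  module _ {a b} (0≤b : 0ℚ ≤ℚ b) (b≤a : b ≤ℚ a) where

    private
      0≤a = ℚₚ.≤-trans 0≤b b≤a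
      0≤d = diff≥0 b≤a

      split : ∀ n → a ^ suc (suc n) - b ^ suc (suc n) ≡ a * (a ^ suc n - b ^ suc n) + b ^ suc n * (a - b)
      split n = solve 4 (λ a b A B → a :* A :- b :* B := a :* (A :- B) :+ B :* (a :- b)) refl a b (a ^ suc n) (b ^ suc n)

      split′ : ∀ n → a ^ suc (suc n) - b ^ suc (suc n) ≡ b * (a ^ suc n - b ^ suc n) + a ^ suc n * (a - b)
      split′ n = solve 4 (λ a b A B → a :* A :- b :* B := b :* (A :- B) :+ A :* (a :- b)) refl a b (a ^ suc n) (b ^ suc n)

      collect : ∀ x n → x * (ofℕ (suc n) * (a - b) * x ^ n) + x ^ suc n * (a - b) ≡ ofℕ (suc (suc n)) * (a - b) * x ^ suc n
      collect x n = trans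
        (solve 4 (λ x m d X → x :* (m :* d :* X) :+ x :* X :* d := (con 1ℚ :+ m) :* d :* (x :* X)) refl x (ofℕ (suc n)) (a - b) (x ^ n))
        (cong (λ m → m * (a - b) * x ^ suc n) (sym (ofℕ-suc (suc n))))

      base : ∀ x → a ^ 1 - b ^ 1 ≡ ofℕ 1 * (a - b) * x ^ 0
      base x = solve 2 (λ a b → a :* con 1ℚ :- b :* con 1ℚ := con 1ℚ :* (a :- b) :* con 1ℚ) refl a b

    -- A mean value estimate with the derivative at the larger end; its companion takes the smaller
    -- end. Summed with coefficients they control the increments of truncated power series.
    ^-diff-≤ : ∀ n → a ^ suc n - b ^ suc n ≤ℚ ofℕ (suc n) * (a - b) * a ^ n
    ^-diff-≤ zero    = ℚₚ.≤-reflexive (base a)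
    ^-diff-≤ (suc n) = begin
      a ^ suc (suc n) - b ^ suc (suc n)                          ≡⟨ split n ⟩
      a * (a ^ suc n - b ^ suc n) + b ^ suc n * (a - b)          ≤⟨ ℚₚ.+-mono-≤ (*-monoˡ {a} 0≤a (^-diff-≤ n)) (*-monoʳ {a - b} 0≤d (^-monoˡ 0≤b b≤a (suc n))) ⟩
      a * (ofℕ (suc n) * (a - b) * a ^ n) + a ^ suc n * (a - b)  ≡⟨ collect a n ⟩
      ofℕ (suc (suc n)) * (a - b) * a ^ suc n                    ∎

    ^-diff-≥ : ∀ n → ofℕ (suc n) * (a - b) * b ^ n ≤ℚ a ^ suc n - b ^ suc n
    ^-diff-≥ zero    = ℚₚ.≤-reflexive (sym (base b))
    ^-diff-≥ (suc n) = begin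
      ofℕ (suc (suc n)) * (a - b) * b ^ suc n                    ≡⟨ collect b n ⟨
      b * (ofℕ (suc n) * (a - b) * b ^ n) + b ^ suc n * (a - b)  ≤⟨ ℚₚ.+-mono-≤ (*-monoˡ {b} 0≤b (^-diff-≥ n)) (*-monoʳ {a - b} 0≤d (^-monoˡ 0≤b b≤a (suc n))) ⟩
      b * (a ^ suc n - b ^ suc n) + a ^ suc n * (a - b)          ≡⟨ split′ n ⟨
      a ^ suc (suc n) - b ^ suc (suc n)                          ∎

-- The truncated exponential series and a lower bound for it at negative arguments.

module Exponential where

  open CauchyLemmas using (^-nn; telescope)
  open Powers
  open ℚₚ.≤-Reasoning

  -- Sums of arbitrary terms, because the terms of a Cauchy product do not come as a coefficient
  -- times a power as in `partialSum`.
  Σ< : ℕ → (ℕ → ℚ) → ℚ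
  Σ< zero    a = 0ℚ
  Σ< (suc n) a = Σ< n a + a n

  partialSum≡Σ : ∀ a x n → partialSum a x n ≡ Σ< n (λ i → a i * x ^ i)
  partialSum≡Σ a x zero    = refl
  partialSum≡Σ a x (suc n) = cong (_+ a n * x ^ n) (partialSum≡Σ a x n)

  Σ-shift : ∀ n a → Σ< (suc n) a ≡ a 0 + Σ< n (λ i → a (suc i))
  Σ-shift zero    a = ℚₚ.+-comm 0ℚ (a 0)
  Σ-shift (suc n) a = trans (cong (_+ a (suc n)) (Σ-shift n a)) (ℚₚ.+-assoc (a 0) (Σ< n (λ i → a (suc i))) (a (suc n)))

  expTerm-pos : ∀ n → 0ℚ < expTerm n
  expTerm-pos n = inv-pos (0<ofℕ (n !) {{n ℕₚ.!≢0}})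

  expTerm-suc : ∀ n → expTerm (suc n) * ofℕ (suc n) ≡ expTerm n
  expTerm-suc n = begin-equality
    s * m                  ≡⟨ ℚₚ.*-identityʳ (s * m) ⟨
    s * m * 1ℚ             ≡⟨ cong (λ z → s * m * z) (inv-*ʳ (0<ofℕ (n !) {{n ℕₚ.!≢0}})) ⟨
    s * m * (f * t)        ≡⟨ solve 4 (λ s m f t → s :* m :* (f :* t) := (m :* f) :* s :* t) refl s m f t ⟩
    m * f * s * t          ≡⟨ cong (λ z → z * s * t) (ofℕ-* (suc n) (n !)) ⟨
    ofℕ (suc n !) * s * t  ≡⟨ cong (λ z → z * t) (inv-*ʳ (0<ofℕ (suc n !) {{suc n ℕₚ.!≢0}})) ⟩
    1ℚ * t                 ≡⟨ ℚₚ.*-identityˡ t ⟩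
    t                      ∎
    where
    s = expTerm (suc n)
    t = expTerm n
    m = ofℕ (suc n)
    f = ofℕ (n !)

  term : ℚ → ℕ → ℚ
  term x n = expTerm n * x ^ n

  expSum : ℕ → ℚ → ℚ
  expSum n x = Σ< n (term x)

  term-nn : ∀ {x} → 0ℚ ≤ℚ x → ∀ n → 0ℚ ≤ℚ term x n
  term-nn {x} 0≤x n = *-nn {expTerm n} {x ^ n} (ℚₚ.<⇒≤ (expTerm-pos n)) (^-nn 0≤x n)

  expSum-nn : ∀ {x} → 0ℚ ≤ℚ x → ∀ n → 0ℚ ≤ℚ expSum n x
  expSum-nn     0≤x zero    = ℚₚ.≤-refl
  expSum-nn {x} 0≤x (suc n) = +-nn (expSum-nn 0≤x n) (term-nn 0≤x n)

  term≤expSum : ∀ {x} → 0ℚ ≤ℚ x → ∀ n → term x n ≤ℚ expSum (suc n) x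
  term≤expSum {x} 0≤x n = ≤-by (expSum n x) (expSum-nn 0≤x n) (ℚₚ.+-comm (term x n) (expSum n x))

  term-mono : ∀ {x y} → 0ℚ ≤ℚ x → x ≤ℚ y → ∀ n → term x n ≤ℚ term y n
  term-mono {x} {y} 0≤x x≤y n = *-monoˡ {expTerm n} {x ^ n} {y ^ n} (ℚₚ.<⇒≤ (expTerm-pos n)) (^-monoˡ 0≤x x≤y n)

  expSum-mono : ∀ {x y} → 0ℚ ≤ℚ x → x ≤ℚ y → ∀ n → expSum n x ≤ℚ expSum n y
  expSum-mono 0≤x x≤y zero    = ℚₚ.≤-refl
  expSum-mono 0≤x x≤y (suc n) = ℚₚ.+-mono-≤ (expSum-mono 0≤x x≤y n) (term-mono 0≤x x≤y n)

  -- The derivative of the sum of `n + 1` terms is the sum of `n` terms, as `expTerm-suc` cancels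
  -- the exponent, and it is largest at `y`.
  expSum-diff : ∀ {x y} → 0ℚ ≤ℚ x → x ≤ℚ y → ∀ n → expSum (suc n) y - expSum (suc n) x ≤ℚ (y - x) * expSum n y
  expSum-diff {x} {y} 0≤x x≤y zero    = ℚₚ.≤-reflexive (solve 2 (λ x y → con 0ℚ := (y :- x) :* con 0ℚ) refl x y)
  expSum-diff {x} {y} 0≤x x≤y (suc n) = begin
    Y + t * y ^ suc n - (X + t * x ^ suc n)
      ≡⟨ solve 5 (λ X Y t u v → Y :+ t :* u :- (X :+ t :* v) := (Y :- X) :+ t :* (u :- v)) refl X Y t (y ^ suc n) (x ^ suc n) ⟩
    (Y - X) + t * (y ^ suc n - x ^ suc n)
      ≤⟨ ℚₚ.+-mono-≤ (expSum-diff 0≤x x≤y n) (*-monoˡ {t} (ℚₚ.<⇒≤ (expTerm-pos (suc n))) (^-diff-≤ 0≤x x≤y n)) ⟩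
    (y - x) * expSum n y + t * (ofℕ (suc n) * (y - x) * y ^ n)
      ≡⟨ solve 5 (λ d S t m P → d :* S :+ t :* (m :* d :* P) := d :* (S :+ t :* m :* P)) refl (y - x) (expSum n y) t (ofℕ (suc n)) (y ^ n) ⟩
    (y - x) * (expSum n y + t * ofℕ (suc n) * y ^ n)
      ≡⟨ cong (λ z → (y - x) * (expSum n y + z * y ^ n)) (expTerm-suc n) ⟩
    (y - x) * expSum (suc n) y ∎
    where
    X = expSum (suc n) x
    Y = expSum (suc n) y
    t = expTerm (suc n)

  -- Over a step of ½ the increment is at most half of the new value, so the value at most doubles.
  -- A step below 1 is what allows solving for the new value.
  expSum-+½ : ∀ {x} → 0ℚ ≤ℚ x → ∀ n → expSum n (x + ½) ≤ℚ ofℕ 2 * expSum n x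
  expSum-+½     0≤x zero    = ℚₚ.≤-refl
  expSum-+½ {x} 0≤x (suc n) = ≤-by (ofℕ 2 * (½ * expSum n y - (Y - X)) + t)
      (+-nn (*-nn (0≤ofℕ 2) (diff≥0 (subst (λ d → Y - X ≤ℚ d * expSum n y) y-x≡½ (expSum-diff 0≤x x≤y n)))) (term-nn 0≤y n))
      (solve 3 (λ S t X → S :+ t :+ (con (ofℕ 2) :* (con ½ :* S :- (S :+ t :- X)) :+ t) := con (ofℕ 2) :* X) refl (expSum n y) t X)
    where
    y = x + ½
    x≤y = ≤-by {x} {y} ½ (ℚₚ.<⇒≤ 0<½) refl
    0≤y = ℚₚ.≤-trans 0≤x x≤y
    X = expSum (suc n) x
    Y = expSum (suc n) y
    t = term y n
    y-x≡½ : y - x ≡ ½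
    y-x≡½ = solve 1 (λ x → x :+ con ½ :- x := con ½) refl x

  expSum-0 : ∀ n → expSum n 0ℚ ≤ℚ 1ℚ
  expSum-0 zero          = 0≤1
  expSum-0 (suc zero)    = ℚₚ.≤-refl
  expSum-0 (suc (suc n)) = subst (_≤ℚ 1ℚ)
    (solve 3 (λ S t z → S := S :+ t :* (con 0ℚ :* z)) refl (expSum (suc n) 0ℚ) (expTerm (suc n)) (0ℚ ^ n))
    (expSum-0 (suc n))

  expSum-≤4^ : ∀ B n → expSum n (ofℕ B) ≤ℚ ofℕ 4 ^ B
  expSum-≤4^ zero    n = expSum-0 n
  expSum-≤4^ (suc B) n = begin
    expSum n (ofℕ (suc B))          ≡⟨ cong (expSum n) (trans (ofℕ-suc B) (solve 1 (λ b → con 1ℚ :+ b := b :+ con ½ :+ con ½) refl (ofℕ B))) ⟩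
    expSum n (ofℕ B + ½ + ½)        ≤⟨ expSum-+½ (+-nn (0≤ofℕ B) (ℚₚ.<⇒≤ 0<½)) n ⟩
    ofℕ 2 * expSum n (ofℕ B + ½)    ≤⟨ *-monoˡ {ofℕ 2} (0≤ofℕ 2) (expSum-+½ (0≤ofℕ B) n) ⟩
    ofℕ 2 * (ofℕ 2 * expSum n (ofℕ B)) ≡⟨ solve 1 (λ s → con (ofℕ 2) :* (con (ofℕ 2) :* s) := con (ofℕ 4) :* s) refl (expSum n (ofℕ B)) ⟩
    ofℕ 4 * expSum n (ofℕ B)        ≤⟨ *-monoˡ {ofℕ 4} (0≤ofℕ 4) (expSum-≤4^ B n) ⟩
    ofℕ 4 * ofℕ 4 ^ B               ∎

  -- Coefficients of the Cauchy product, recursing on the head of `a` so that no index `n - i`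
  -- appears.
  conv : (ℕ → ℚ) → (ℕ → ℚ) → ℕ → ℚ
  conv a b zero    = a 0 * b 0
  conv a b (suc n) = a 0 * b (suc n) + conv (λ i → a (suc i)) b n

  conv-sucʳ : ∀ a b n → conv a b (suc n) ≡ conv a (λ i → b (suc i)) n + a (suc n) * b 0
  conv-sucʳ a b zero    = refl
  conv-sucʳ a b (suc n) = trans (cong (λ z → a 0 * b (suc (suc n)) + z) (conv-sucʳ (λ i → a (suc i)) b n))
    (sym (ℚₚ.+-assoc (a 0 * b (suc (suc n))) (conv (λ i → a (suc i)) (λ i → b (suc i)) n) (a (suc (suc n)) * b 0)))

  conv-cong : ∀ {a a′ b b′} → (∀ i → a i ≡ a′ i) → (∀ i → b i ≡ b′ i) → ∀ n → conv a b n ≡ conv a′ b′ n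
  conv-cong p q zero    = cong₂ _*_ (p 0) (q 0)
  conv-cong p q (suc n) = cong₂ _+_ (cong₂ _*_ (p 0) (q (suc n))) (conv-cong (λ i → p (suc i)) q n)

  conv-scaleˡ : ∀ x a b n → conv (λ i → x * a i) b n ≡ x * conv a b n
  conv-scaleˡ x a b zero    = ℚₚ.*-assoc x (a 0) (b 0)
  conv-scaleˡ x a b (suc n) = trans (cong (λ z → x * a 0 * b (suc n) + z) (conv-scaleˡ x (λ i → a (suc i)) b n))
    (solve 4 (λ x p q r → x :* p :* q :+ x :* r := x :* (p :* q :+ r)) refl x (a 0) (b (suc n)) (conv (λ i → a (suc i)) b n))

  conv-scaleʳ : ∀ x a b n → conv a (λ i → x * b i) n ≡ x * conv a b n
  conv-scaleʳ x a b zero    = solve 3 (λ x p q → p :* (x :* q) := x :* (p :* q)) refl x (a 0) (b 0)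
  conv-scaleʳ x a b (suc n) = trans (cong (λ z → a 0 * (x * b (suc n)) + z) (conv-scaleʳ x (λ i → a (suc i)) b n))
    (solve 4 (λ x p q r → p :* (x :* q) :+ x :* r := x :* (p :* q :+ r)) refl x (a 0) (b (suc n)) (conv (λ i → a (suc i)) b n))

  -- Stated with an arbitrary index offset c so that the recursion on a goes through.
  conv-leibniz : ∀ c a b n → conv (λ i → (c + ofℕ i) * a i) b n + conv a (λ i → ofℕ i * b i) n ≡ (c + ofℕ n) * conv a b n
  conv-leibniz c a b zero    = solve 3 (λ c p q → (c :+ con 0ℚ) :* p :* q :+ p :* (con 0ℚ :* q) := (c :+ con 0ℚ) :* (p :* q)) refl c (a 0) (b 0)
  conv-leibniz c a b (suc n) = begin-equality
    (c + 0ℚ) * p * q + conv (λ i → (c + ofℕ (suc i)) * a (suc i)) b n + (p * (m * q) + R)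
      ≡⟨ cong (λ z → (c + 0ℚ) * p * q + z + (p * (m * q) + R)) (conv-cong {b = b} (λ i → cong (_* a (suc i)) (offset i)) (λ _ → refl) n) ⟩
    (c + 0ℚ) * p * q + Q + (p * (m * q) + R)
      ≡⟨ solve 6 (λ c p q m Q R → (c :+ con 0ℚ) :* p :* q :+ Q :+ (p :* (m :* q) :+ R) := (c :+ m) :* (p :* q) :+ (Q :+ R)) refl c p q m Q R ⟩
    (c + m) * (p * q) + (Q + R)
      ≡⟨ cong (λ z → (c + m) * (p * q) + z) (conv-leibniz (c + 1ℚ) (λ i → a (suc i)) b n) ⟩
    (c + m) * (p * q) + (c + 1ℚ + ofℕ n) * X
      ≡⟨ cong (λ z → (c + m) * (p * q) + z * X) (offset n) ⟨
    (c + m) * (p * q) + (c + m) * X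
      ≡⟨ ℚₚ.*-distribˡ-+ (c + m) (p * q) X ⟨
    (c + m) * (p * q + X) ∎
    where
    p = a 0
    q = b (suc n)
    m = ofℕ (suc n)
    Q = conv (λ i → (c + 1ℚ + ofℕ i) * a (suc i)) b n
    R = conv (λ i → a (suc i)) (λ i → ofℕ i * b i) n
    X = conv (λ i → a (suc i)) b n
    offset : ∀ i → c + ofℕ (suc i) ≡ c + 1ℚ + ofℕ i
    offset i = trans (cong (λ z → c + z) (ofℕ-suc i)) (sym (ℚₚ.+-assoc c 1ℚ (ofℕ i)))

  -- The differential equation of s ↦ e^(x s) in coefficients, where s d/ds acts as multiplication
  -- by the index.
  term-derivative : ∀ x n → ofℕ (suc n) * term x (suc n) ≡ x * term x n
  term-derivative x n = trans
    (solve 4 (λ m t x X → m :* (t :* (x :* X)) := x :* (t :* m :* X)) refl (ofℕ (suc n)) (expTerm (suc n)) x (x ^ n))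
    (cong (λ z → x * (z * x ^ n)) (expTerm-suc n))

  -- n times the n-th coefficient of eʸ e⁻ʸ is (y - y) times the previous one.
  conv-vanish : ∀ y n → conv (term y) (term (- y)) (suc n) ≡ 0ℚ
  conv-vanish y n = ℚₚ.≤-antisym (*-cancel 0<m (ℚₚ.≤-reflexive eq)) (*-cancel 0<m (ℚₚ.≤-reflexive (sym eq)))
    where
    a = term y
    b = term (- y)
    0<m : 0ℚ < ofℕ (suc n)
    0<m = 0<ofℕ (suc n)
    θ : (ℕ → ℚ) → ℕ → ℚ
    θ s i = ofℕ i * s i
    left : conv (λ i → (0ℚ + ofℕ i) * a i) b (suc n) ≡ y * conv a b n
    left = begin-equality
      (0ℚ + 0ℚ) * a 0 * b (suc n) + conv (λ i → (0ℚ + ofℕ (suc i)) * a (suc i)) b n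
        ≡⟨ solve 3 (λ p q r → (con 0ℚ :+ con 0ℚ) :* p :* q :+ r := r) refl (a 0) (b (suc n)) (conv (λ i → (0ℚ + ofℕ (suc i)) * a (suc i)) b n) ⟩
      conv (λ i → (0ℚ + ofℕ (suc i)) * a (suc i)) b n
        ≡⟨ conv-cong {b = b} (λ i → trans (cong (_* a (suc i)) (ℚₚ.+-identityˡ (ofℕ (suc i)))) (term-derivative y i)) (λ _ → refl) n ⟩
      conv (λ i → y * a i) b n
        ≡⟨ conv-scaleˡ y a b n ⟩
      y * conv a b n ∎
    right : conv a (θ b) (suc n) ≡ - y * conv a b n
    right = begin-equality
      conv a (θ b) (suc n)                                   ≡⟨ conv-sucʳ a (θ b) n ⟩
      conv a (λ i → θ b (suc i)) n + a (suc n) * (0ℚ * b 0)  ≡⟨ solve 3 (λ r p q → r :+ p :* (con 0ℚ :* q) := r) refl (conv a (λ i → θ b (suc i)) n) (a (suc n)) (b 0) ⟩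
      conv a (λ i → θ b (suc i)) n                           ≡⟨ conv-cong {a = a} (λ _ → refl) (term-derivative (- y)) n ⟩
      conv a (λ i → - y * b i) n                             ≡⟨ conv-scaleʳ (- y) a b n ⟩
      - y * conv a b n                                       ∎
    eq : conv a b (suc n) * ofℕ (suc n) ≡ 0ℚ * ofℕ (suc n)
    eq = begin-equality
      conv a b (suc n) * ofℕ (suc n)                           ≡⟨ ℚₚ.*-comm (conv a b (suc n)) (ofℕ (suc n)) ⟩
      ofℕ (suc n) * conv a b (suc n)                           ≡⟨ cong (_* conv a b (suc n)) (ℚₚ.+-identityˡ (ofℕ (suc n))) ⟨
      (0ℚ + ofℕ (suc n)) * conv a b (suc n)                    ≡⟨ conv-leibniz 0ℚ a b (suc n) ⟨
      conv (λ i → (0ℚ + ofℕ i) * a i) b (suc n) + conv a (θ b) (suc n) ≡⟨ cong₂ _+_ left right ⟩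
      y * conv a b n + - y * conv a b n                        ≡⟨ solve 3 (λ y c m → y :* c :+ :- y :* c := con 0ℚ :* m) refl y (conv a b n) (ofℕ (suc n)) ⟩
      0ℚ * ofℕ (suc n)                                         ∎

  Σ-conv-term : ∀ y n → Σ< (suc n) (conv (term y) (term (- y))) ≡ 1ℚ
  Σ-conv-term y zero    = refl
  Σ-conv-term y (suc n) = trans (cong₂ _+_ (Σ-conv-term y n) (conv-vanish y n)) (ℚₚ.+-identityʳ 1ℚ)

  Σ-conv-shift : ∀ a b n → Σ< (suc n) (conv a b) ≡ a 0 * Σ< (suc n) b + Σ< n (conv (λ i → a (suc i)) b)
  Σ-conv-shift a b zero    = solve 2 (λ p q → con 0ℚ :+ p :* q := p :* (con 0ℚ :+ q) :+ con 0ℚ) refl (a 0) (b 0)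
  Σ-conv-shift a b (suc n) = trans (cong (_+ conv a b (suc n)) (Σ-conv-shift a b n))
    (solve 5 (λ p S q T c → p :* S :+ T :+ (p :* q :+ c) := p :* (S :+ q) :+ (T :+ c)) refl
      (a 0) (Σ< (suc n) b) (b (suc n)) (Σ< n (conv (λ i → a (suc i)) b)) (conv (λ i → a (suc i)) b n))

  module Cauchy-product (b : ℕ → ℚ) (ρ K : ℚ) (0≤ρ : 0ℚ ≤ℚ ρ) (ρ≤½ : ρ ≤ℚ ½) (0≤K : 0ℚ ≤ℚ K)
    (b≤ : ∀ i → abs (b i) ≤ℚ K * ρ ^ i) where

    private
      0≤2K = *-nn {ofℕ 2} {K} (0≤ofℕ 2) 0≤K

      tail : ∀ m n → n ≤ m → abs (Σ< m b - Σ< n b) ≤ℚ ofℕ 2 * K * ρ ^ n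
      tail m n n≤m = begin
        abs (Σ< m b - Σ< n b)        ≤⟨ telescope (λ i → Σ< i b) (λ i → 2K * ρ ^ i) step m n ⟩
        abs (2K * ρ ^ m - 2K * ρ ^ n) ≤⟨ abs≤ lower upper ⟩
        2K * ρ ^ n                   ∎
        where
        2K = ofℕ 2 * K
        0≤M = *-nn {2K} {ρ ^ m} 0≤2K (^-nn 0≤ρ m)
        ρ≤1 = ℚₚ.≤-trans ρ≤½ (≤-by {½} {1ℚ} ½ (ℚₚ.<⇒≤ 0<½) refl)
        M≤N : 2K * ρ ^ m ≤ℚ 2K * ρ ^ n
        M≤N = *-monoˡ {2K} 0≤2K (^-antiʳ 0≤ρ ρ≤1 n≤m)
        lower : 2K * ρ ^ m - 2K * ρ ^ n ≤ℚ 2K * ρ ^ n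
        lower = ≤-by (2K * ρ ^ n - 2K * ρ ^ m + 2K * ρ ^ n) (+-nn (diff≥0 M≤N) (*-nn {2K} 0≤2K (^-nn 0≤ρ n)))
          (solve 2 (λ p q → p :- q :+ (q :- p :+ q) := q) refl (2K * ρ ^ m) (2K * ρ ^ n))
        upper : - (2K * ρ ^ m - 2K * ρ ^ n) ≤ℚ 2K * ρ ^ n
        upper = ≤-by (2K * ρ ^ m) 0≤M (solve 2 (λ p q → :- (p :- q) :+ p := q) refl (2K * ρ ^ m) (2K * ρ ^ n))
        -- As `ρ ≤ ½`, a term is at most the drop of twice its geometric majorant, so the tail
        -- telescopes.
        step : ∀ i → abs (Σ< i b + b i - Σ< i b) ≤ℚ 2K * ρ ^ i - 2K * ρ ^ suc i
        step i = begin
          abs (Σ< i b + b i - Σ< i b)   ≡⟨ cong abs (solve 2 (λ s t → s :+ t :- s := t) refl (Σ< i b) (b i)) ⟩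
          abs (b i)                     ≤⟨ b≤ i ⟩
          K * ρ ^ i                     ≤⟨ ≤-by (ofℕ 2 * (½ - ρ) * (K * ρ ^ i)) (*-nn (*-nn (0≤ofℕ 2) (diff≥0 ρ≤½)) (*-nn 0≤K (^-nn 0≤ρ i)))
                                             (solve 3 (λ K ρ R → K :* R :+ con (ofℕ 2) :* (con ½ :- ρ) :* (K :* R) := con (ofℕ 2) :* K :* R :- con (ofℕ 2) :* K :* (ρ :* R)) refl K ρ (ρ ^ i)) ⟩
          2K * ρ ^ i - 2K * ρ ^ suc i   ∎

    -- The product of two partial sums runs over a rectangle, the sum of convolutions over a
    -- triangle. Stripping the first row leaves the tail of `b` beyond the triangle and a shifted
    -- `a` of amplitude `A * ρ`; each row then costs the same, whence the factor `n`. The width `m`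
    -- is separate because stripping a row does not change it.
    square-triangle : ∀ n m → n ≤ m → ∀ (a : ℕ → ℚ) A → 0ℚ ≤ℚ A → (∀ i → abs (a i) ≤ℚ A * ρ ^ i) →
      abs (Σ< n a * Σ< m b - Σ< n (conv a b)) ≤ℚ ofℕ n * (ofℕ 2 * K * A * ρ ^ n)
    square-triangle zero m n≤m a A 0≤A a≤ = ℚₚ.≤-reflexive (trans
      (cong abs (solve 1 (λ s → con 0ℚ :* s :- con 0ℚ := con 0ℚ) refl (Σ< m b)))
      (sym (ℚₚ.*-zeroˡ (ofℕ 2 * K * A * ρ ^ 0))))
    square-triangle (suc n) m n<m a A 0≤A a≤ = begin
      abs (Σ< (suc n) a * Σ< m b - Σ< (suc n) (conv a b))
        ≡⟨ cong₂ (λ s t → abs (s * Σ< m b - t)) (Σ-shift n a) (Σ-conv-shift a b n) ⟩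
      abs ((a 0 + Σ< n a⁺) * Σ< m b - (a 0 * Σ< (suc n) b + Σ< n (conv a⁺ b)))
        ≡⟨ cong abs (solve 5 (λ p s B B′ t → (p :+ s) :* B :- (p :* B′ :+ t) := p :* (B :- B′) :+ (s :* B :- t)) refl
             (a 0) (Σ< n a⁺) (Σ< m b) (Σ< (suc n) b) (Σ< n (conv a⁺ b))) ⟩
      abs (a 0 * (Σ< m b - Σ< (suc n) b) + (Σ< n a⁺ * Σ< m b - Σ< n (conv a⁺ b)))
        ≤⟨ ℚₚ.∣p+q∣≤∣p∣+∣q∣ (a 0 * (Σ< m b - Σ< (suc n) b)) (Σ< n a⁺ * Σ< m b - Σ< n (conv a⁺ b)) ⟩
      abs (a 0 * (Σ< m b - Σ< (suc n) b)) + abs (Σ< n a⁺ * Σ< m b - Σ< n (conv a⁺ b))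
        ≡⟨ cong (_+ abs (Σ< n a⁺ * Σ< m b - Σ< n (conv a⁺ b))) (ℚₚ.∣p*q∣≡∣p∣*∣q∣ (a 0) (Σ< m b - Σ< (suc n) b)) ⟩
      abs (a 0) * abs (Σ< m b - Σ< (suc n) b) + abs (Σ< n a⁺ * Σ< m b - Σ< n (conv a⁺ b))
        ≤⟨ ℚₚ.+-mono-≤
             (*-mono {abs (a 0)} {A * 1ℚ} (0≤abs (a 0)) (*-nn 0≤2K (^-nn 0≤ρ (suc n))) (a≤ 0) (tail m (suc n) n<m))
             (square-triangle n m (ℕₚ.<⇒≤ n<m) a⁺ (A * ρ) (*-nn 0≤A 0≤ρ)
               (λ i → subst (abs (a (suc i)) ≤ℚ_) (sym (ℚₚ.*-assoc A ρ (ρ ^ i))) (a≤ (suc i)))) ⟩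
      A * 1ℚ * (ofℕ 2 * K * ρ ^ suc n) + ofℕ n * (ofℕ 2 * K * (A * ρ) * ρ ^ n)
        ≡⟨ solve 5 (λ A K ρ R n → A :* con 1ℚ :* (con (ofℕ 2) :* K :* (ρ :* R)) :+ n :* (con (ofℕ 2) :* K :* (A :* ρ) :* R)
                               := (con 1ℚ :+ n) :* (con (ofℕ 2) :* K :* A :* (ρ :* R))) refl A K ρ (ρ ^ n) (ofℕ n) ⟩
      (1ℚ + ofℕ n) * (ofℕ 2 * K * A * ρ ^ suc n)
        ≡⟨ cong (_* (ofℕ 2 * K * A * ρ ^ suc n)) (ofℕ-suc n) ⟨
      ofℕ (suc n) * (ofℕ 2 * K * A * ρ ^ suc n) ∎
      where
      a⁺ : ℕ → ℚ
      a⁺ i = a (suc i)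

  n≤2^n : ∀ n → n ≤ 2 ℕ.^ n
  n≤2^n zero    = ℕ.z≤n
  n≤2^n (suc n) = ℕₚ.≤-trans (ℕₚ.+-mono-≤ (ℕₚ.m^n>0 2 n) (n≤2^n n)) (ℕₚ.≤-reflexive (cong (2 ℕ.^ n ℕ.+_) (sym (ℕₚ.+-identityʳ (2 ℕ.^ n)))))

  module _ (B : ℕ) where

    private
      ¼ = ½ * ½
      K = ofℕ 4 ^ (4 ℕ.* B)
      0≤¼ = *-nn {½} {½} (ℚₚ.<⇒≤ 0<½) (ℚₚ.<⇒≤ 0<½)

      0≤K : 0ℚ ≤ℚ K
      0≤K = ^-nn (0≤ofℕ 4) (4 ℕ.* B)

      ^-neg : ∀ y i → abs ((- y) ^ i) ≡ abs (y ^ i)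
      ^-neg y zero    = refl
      ^-neg y (suc i) = trans (ℚₚ.∣p*q∣≡∣p∣*∣q∣ (- y) ((- y) ^ i))
        (trans (cong₂ _*_ (ℚₚ.∣-p∣≡∣p∣ y) (^-neg y i)) (sym (ℚₚ.∣p*q∣≡∣p∣*∣q∣ y (y ^ i))))

      abs-term-neg : ∀ y i → abs (term (- y) i) ≡ abs (term y i)
      abs-term-neg y i = trans (ℚₚ.∣p*q∣≡∣p∣*∣q∣ (expTerm i) ((- y) ^ i))
        (trans (cong (λ z → abs (expTerm i) * z) (^-neg y i)) (sym (ℚₚ.∣p*q∣≡∣p∣*∣q∣ (expTerm i) (y ^ i))))

      -- A term at `y` is ¼^i times a term at 4 y, and the latter is at most the bound 4^(4 B) for
      -- the whole series at 4 B. The ratio ¼ still leaves ½^n once a factor n ≤ 2^n has been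
      -- absorbed.
      term≤ : ∀ {y} → 0ℚ ≤ℚ y → y ≤ℚ ofℕ B → ∀ i → abs (term y i) ≤ℚ K * ¼ ^ i
      term≤ {y} 0≤y y≤B i = begin
        abs (term y i)                      ≡⟨ ℚₚ.0≤p⇒∣p∣≡p (term-nn 0≤y i) ⟩
        term y i                            ≤⟨ term-mono 0≤y y≤B i ⟩
        expTerm i * ofℕ B ^ i               ≡⟨ cong (λ z → expTerm i * z ^ i) (trans (solve 1 (λ b → b := con (ofℕ 4) :* b :* con ¼) refl (ofℕ B)) (cong (_* ¼) (sym (ofℕ-* 4 B)))) ⟩
        expTerm i * (ofℕ (4 ℕ.* B) * ¼) ^ i ≡⟨ cong (λ z → expTerm i * z) (^-distrib-* (ofℕ (4 ℕ.* B)) ¼ i) ⟩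
        expTerm i * (ofℕ (4 ℕ.* B) ^ i * ¼ ^ i) ≡⟨ ℚₚ.*-assoc (expTerm i) (ofℕ (4 ℕ.* B) ^ i) (¼ ^ i) ⟨
        term (ofℕ (4 ℕ.* B)) i * ¼ ^ i      ≤⟨ *-monoʳ {¼ ^ i} (^-nn 0≤¼ i) (ℚₚ.≤-trans (term≤expSum (0≤ofℕ (4 ℕ.* B)) i) (expSum-≤4^ (4 ℕ.* B) (suc i))) ⟩
        K * ¼ ^ i                           ∎

    -- The triangle sums to exactly 1 by `Σ-conv-term`, so only the rest of the square matters. It
    -- is at most n · 2 K² ¼^n ≤ 2 · 2^(16 B) ½^n, as K² = 2^(16 B), and the threshold 16 B + 2
    -- brings this down to ½.
    expSum-product : ∀ {y} → 0ℚ ≤ℚ y → y ≤ℚ ofℕ B → ∀ n → 16 ℕ.* B ℕ.+ 2 ≤ n →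
      ½ ≤ℚ expSum n y * expSum n (- y)
    expSum-product {y} 0≤y y≤B zero    N≤n with () ← ℕₚ.m+n≤o⇒n≤o (16 ℕ.* B) N≤n
    expSum-product {y} 0≤y y≤B n@(suc n-1) N≤n = ≤-by ((½ - abs (P - 1ℚ)) + (abs (P - 1ℚ) + (P - 1ℚ)))
        (+-nn (diff≥0 err≤½) neg-part) (solve 2 (λ P a → con ½ :+ (con ½ :- a :+ (a :+ (P :- con 1ℚ))) := P) refl P (abs (P - 1ℚ)))
      where
      P = expSum n y * expSum n (- y)
      neg-part : 0ℚ ≤ℚ abs (P - 1ℚ) + (P - 1ℚ)
      neg-part = subst (λ z → 0ℚ ≤ℚ z + (P - 1ℚ)) (ℚₚ.∣-p∣≡∣p∣ (P - 1ℚ))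
        (subst (_≤ℚ abs (- (P - 1ℚ)) + (P - 1ℚ)) (ℚₚ.+-inverseˡ (P - 1ℚ)) (ℚₚ.+-monoˡ-≤ (P - 1ℚ) (≤abs (- (P - 1ℚ)))))
      open Cauchy-product (term (- y)) ¼ K 0≤¼ (≤-by {¼} {½} ¼ 0≤¼ refl) 0≤K
        (λ i → subst (_≤ℚ K * ¼ ^ i) (sym (abs-term-neg y i)) (term≤ 0≤y y≤B i))
      4^≡ : ∀ m → ofℕ 4 ^ m ≡ ofℕ 2 ^ (2 ℕ.* m)
      4^≡ m = ^-assocʳ (ofℕ 2) 2 m
      K*K : K * K ≡ ofℕ 2 ^ (16 ℕ.* B)
      K*K = begin-equality
        K * K                              ≡⟨ ^-homo-* (ofℕ 4) (4 ℕ.* B) (4 ℕ.* B) ⟨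
        ofℕ 4 ^ (4 ℕ.* B ℕ.+ 4 ℕ.* B)       ≡⟨ 4^≡ (4 ℕ.* B ℕ.+ 4 ℕ.* B) ⟩
        ofℕ 2 ^ (2 ℕ.* (4 ℕ.* B ℕ.+ 4 ℕ.* B)) ≡⟨ cong (ofℕ 2 ^_) (S.solve 1 (λ B → S.con 2 S.:* (S.con 4 S.:* B S.:+ S.con 4 S.:* B) S.:= S.con 16 S.:* B) refl B) ⟩
        ofℕ 2 ^ (16 ℕ.* B)                 ∎
      err≤½ : abs (P - 1ℚ) ≤ℚ ½
      err≤½ = begin
        abs (P - 1ℚ)
          ≡⟨ cong (λ z → abs (P - z)) (Σ-conv-term y n-1) ⟨
        abs (P - Σ< n (conv (term y) (term (- y))))
          ≤⟨ square-triangle n n ℕₚ.≤-refl (term y) K 0≤K (term≤ 0≤y y≤B) ⟩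
        ofℕ n * (ofℕ 2 * K * K * ¼ ^ n)
          ≤⟨ *-monoʳ {ofℕ 2 * K * K * ¼ ^ n} (*-nn (*-nn (*-nn (0≤ofℕ 2) 0≤K) 0≤K) (^-nn 0≤¼ n)) (ofℕ-mono (n≤2^n n)) ⟩
        ofℕ (2 ℕ.^ n) * (ofℕ 2 * K * K * ¼ ^ n)
          ≡⟨ cong₂ (λ s t → s * (ofℕ 2 * K * K * t)) (ofℕ-^ 2 n) (^-distrib-* ½ ½ n) ⟩
        ofℕ 2 ^ n * (ofℕ 2 * K * K * (½ ^ n * ½ ^ n))
          ≡⟨ solve 3 (λ T H k → T :* (con (ofℕ 2) :* k :* k :* (H :* H)) := con (ofℕ 2) :* (T :* H) :* (k :* k) :* H) refl (ofℕ 2 ^ n) (½ ^ n) K ⟩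
        ofℕ 2 * (ofℕ 2 ^ n * ½ ^ n) * (K * K) * ½ ^ n
          ≡⟨ cong₂ (λ s t → ofℕ 2 * s * t * ½ ^ n) (^-inverse {ofℕ 2} {½} refl n) K*K ⟩
        ofℕ 2 * 1ℚ * ofℕ 2 ^ (16 ℕ.* B) * ½ ^ n
          ≤⟨ *-monoˡ {ofℕ 2 * 1ℚ * ofℕ 2 ^ (16 ℕ.* B)} (*-nn (*-nn (0≤ofℕ 2) 0≤1) (^-nn (0≤ofℕ 2) (16 ℕ.* B)))
               (^-antiʳ (ℚₚ.<⇒≤ 0<½) (≤-by {½} {1ℚ} ½ (ℚₚ.<⇒≤ 0<½) refl) N≤n) ⟩
        ofℕ 2 * 1ℚ * ofℕ 2 ^ (16 ℕ.* B) * ½ ^ (16 ℕ.* B ℕ.+ 2)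
          ≡⟨ cong (λ z → ofℕ 2 * 1ℚ * ofℕ 2 ^ (16 ℕ.* B) * z) (^-homo-* ½ (16 ℕ.* B) 2) ⟩
        ofℕ 2 * 1ℚ * ofℕ 2 ^ (16 ℕ.* B) * (½ ^ (16 ℕ.* B) * ½ ^ 2)
          ≡⟨ solve 2 (λ T H → con (ofℕ 2) :* con 1ℚ :* T :* (H :* con (½ ^ 2)) := T :* H :* con ½) refl (ofℕ 2 ^ (16 ℕ.* B)) (½ ^ (16 ℕ.* B)) ⟩
        ofℕ 2 ^ (16 ℕ.* B) * ½ ^ (16 ℕ.* B) * ½
          ≡⟨ cong (_* ½) (^-inverse {ofℕ 2} {½} refl (16 ℕ.* B)) ⟩
        1ℚ * ½
          ≡⟨⟩
        ½ ∎

    -- The product is divided by the bound 4^B for the factor at `y`. A truncated series at a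
    -- negative argument has no evident sign, so nonpositive values are excluded first, again by the
    -- product.
    expSum-neg-≥ : ∀ {y} → 0ℚ ≤ℚ y → y ≤ℚ ofℕ B → ∀ n → 16 ℕ.* B ℕ.+ 2 ≤ n → ½ * ¼ ^ B ≤ℚ expSum n (- y)
    expSum-neg-≥ {y} 0≤y y≤B n N≤n = cases (ℚₚ.≤-total 0ℚ e)
      where
      e = expSum n (- y)
      cases : 0ℚ ≤ℚ e ⊎ e ≤ℚ 0ℚ → ½ * ¼ ^ B ≤ℚ e
      cases (inj₁ 0≤e) = begin
        ½ * ¼ ^ B                  ≤⟨ *-monoʳ {¼ ^ B} (^-nn 0≤¼ B) (ℚₚ.≤-trans (expSum-product 0≤y y≤B n N≤n)
                                        (*-monoʳ {e} 0≤e (ℚₚ.≤-trans (expSum-mono 0≤y y≤B n) (expSum-≤4^ B n)))) ⟩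
        ofℕ 4 ^ B * e * ¼ ^ B      ≡⟨ solve 3 (λ p e q → p :* e :* q := p :* q :* e) refl (ofℕ 4 ^ B) e (¼ ^ B) ⟩
        ofℕ 4 ^ B * ¼ ^ B * e      ≡⟨ cong (_* e) (^-inverse {ofℕ 4} {¼} refl B) ⟩
        1ℚ * e                     ≡⟨ ℚₚ.*-identityˡ e ⟩
        e                          ∎
      cases (inj₂ e≤0) = ⊥-elim (ℚₚ.<-irrefl refl (ℚₚ.<-≤-trans 0<½ (begin
        ½                          ≤⟨ expSum-product 0≤y y≤B n N≤n ⟩
        expSum n y * e             ≤⟨ *-monoˡ {expSum n y} (expSum-nn 0≤y n) e≤0 ⟩
        expSum n y * 0ℚ            ≡⟨ ℚₚ.*-zeroʳ (expSum n y) ⟩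
        0ℚ                         ∎)))

-- The truncated logarithm compared with the binary one.

module Logarithm where

  open CauchyLemmas using (^-nn; module Geometric)
  open ExpLnLemmas using (0≤lnTerm; square-nn)
  open Powers
  open ℚₚ.≤-Reasoning

  -- `lnSeq` reads only the n-th approximation of its argument, so this is the n-th approximation of
  -- ln at every real whose n-th approximation is `y`. Nested logarithms become nested `lnAt n`.
  lnAt : ℕ → ℚ → ℚ
  lnAt n y = lnSeq (λ _ → y) n

  geometric : ℚ → ℕ → ℚ
  geometric x zero    = 0ℚ
  geometric x (suc n) = geometric x n + x ^ n

  geometric-sum : ∀ x n → (1ℚ - x) * geometric x n ≡ 1ℚ - x ^ n
  geometric-sum x zero    = solve 1 (λ x → (con 1ℚ :- x) :* con 0ℚ := con 1ℚ :- con 1ℚ) refl x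
  geometric-sum x (suc n) = trans (ℚₚ.*-distribˡ-+ (1ℚ - x) (geometric x n) (x ^ n)) (trans (cong (_+ (1ℚ - x) * x ^ n) (geometric-sum x n))
    (solve 2 (λ x X → con 1ℚ :- X :+ (con 1ℚ :- x) :* X := con 1ℚ :- x :* X) refl x (x ^ n)))

  geometric-nn : ∀ {x} → 0ℚ ≤ℚ x → ∀ n → 0ℚ ≤ℚ geometric x n
  geometric-nn 0≤x zero    = ℚₚ.≤-refl
  geometric-nn 0≤x (suc n) = +-nn (geometric-nn 0≤x n) (^-nn 0≤x n)

  artanh : ℕ → ℚ → ℚ
  artanh n u = u * partialSum lnTerm (u * u) n

  module _ {a b} (0≤b : 0ℚ ≤ℚ b) (b≤a : b ≤ℚ a) where

    private
      odd-power : ∀ u n → u * (u * u) ^ n ≡ u ^ suc (2 ℕ.* n)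
      odd-power u n = cong (λ z → u * z) (trans (cong (λ z → (u * z) ^ n) (sym (ℚₚ.*-identityʳ u))) (^-assocʳ u 2 n))

      even-power : ∀ u n → u ^ (2 ℕ.* n) ≡ (u * u) ^ n
      even-power u n = trans (sym (^-assocʳ u 2 n)) (cong (λ z → (u * z) ^ n) (ℚₚ.*-identityʳ u))

      cancel-lnTerm : ∀ n d X → lnTerm n * (ofℕ (suc (2 ℕ.* n)) * d * X) ≡ d * X
      cancel-lnTerm n d X = trans
        (solve 4 (λ t m d X → t :* (m :* d :* X) := m :* t :* (d :* X)) refl (lnTerm n) (ofℕ (suc (2 ℕ.* n))) d X)
        (trans (cong (_* (d * X)) (inv-*ʳ (0<ofℕ (suc (2 ℕ.* n))))) (ℚₚ.*-identityˡ (d * X)))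

      artanh-step : ∀ n → artanh (suc n) a - artanh (suc n) b ≡
        (artanh n a - artanh n b) + lnTerm n * (a ^ suc (2 ℕ.* n) - b ^ suc (2 ℕ.* n))
      artanh-step n = trans
        (solve 7 (λ a b t A B P Q → a :* (P :+ t :* A) :- b :* (Q :+ t :* B) := (a :* P :- b :* Q) :+ t :* (a :* A :- b :* B)) refl
          a b (lnTerm n) ((a * a) ^ n) ((b * b) ^ n) (partialSum lnTerm (a * a) n) (partialSum lnTerm (b * b) n))
        (cong₂ (λ s t → (artanh n a - artanh n b) + lnTerm n * (s - t)) (odd-power a n) (odd-power b n))

    -- The derivative of the truncated artanh is the truncated geometric series in u², since
    -- `lnTerm n` cancels the exponent 2 n + 1. This bound takes the derivative at `a`, the next one
    -- at `b`.
    artanh-diff-≤ : ∀ n → artanh n a - artanh n b ≤ℚ (a - b) * geometric (a * a) n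
    artanh-diff-≤ zero    = ℚₚ.≤-reflexive (solve 2 (λ a b → a :* con 0ℚ :- b :* con 0ℚ := (a :- b) :* con 0ℚ) refl a b)
    artanh-diff-≤ (suc n) = begin
      artanh (suc n) a - artanh (suc n) b
        ≡⟨ artanh-step n ⟩
      (artanh n a - artanh n b) + lnTerm n * (a ^ suc (2 ℕ.* n) - b ^ suc (2 ℕ.* n))
        ≤⟨ ℚₚ.+-mono-≤ (artanh-diff-≤ n) (*-monoˡ {lnTerm n} (0≤lnTerm n) (^-diff-≤ 0≤b b≤a (2 ℕ.* n))) ⟩
      (a - b) * geometric (a * a) n + lnTerm n * (ofℕ (suc (2 ℕ.* n)) * (a - b) * a ^ (2 ℕ.* n))
        ≡⟨ cong (λ z → (a - b) * geometric (a * a) n + z) (cancel-lnTerm n (a - b) (a ^ (2 ℕ.* n))) ⟩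
      (a - b) * geometric (a * a) n + (a - b) * a ^ (2 ℕ.* n)
        ≡⟨ cong (λ z → (a - b) * geometric (a * a) n + (a - b) * z) (even-power a n) ⟩
      (a - b) * geometric (a * a) n + (a - b) * (a * a) ^ n
        ≡⟨ ℚₚ.*-distribˡ-+ (a - b) (geometric (a * a) n) ((a * a) ^ n) ⟨
      (a - b) * geometric (a * a) (suc n) ∎

    artanh-diff-≥ : ∀ n → (a - b) * geometric (b * b) n ≤ℚ artanh n a - artanh n b
    artanh-diff-≥ zero    = ℚₚ.≤-reflexive (solve 2 (λ a b → (a :- b) :* con 0ℚ := a :* con 0ℚ :- b :* con 0ℚ) refl a b)
    artanh-diff-≥ (suc n) = begin
      (a - b) * geometric (b * b) (suc n)
        ≡⟨ ℚₚ.*-distribˡ-+ (a - b) (geometric (b * b) n) ((b * b) ^ n) ⟩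
      (a - b) * geometric (b * b) n + (a - b) * (b * b) ^ n
        ≡⟨ cong (λ z → (a - b) * geometric (b * b) n + (a - b) * z) (even-power b n) ⟨
      (a - b) * geometric (b * b) n + (a - b) * b ^ (2 ℕ.* n)
        ≡⟨ cong (λ z → (a - b) * geometric (b * b) n + z) (cancel-lnTerm n (a - b) (b ^ (2 ℕ.* n))) ⟨
      (a - b) * geometric (b * b) n + lnTerm n * (ofℕ (suc (2 ℕ.* n)) * (a - b) * b ^ (2 ℕ.* n))
        ≤⟨ ℚₚ.+-mono-≤ (artanh-diff-≥ n) (*-monoˡ {lnTerm n} (0≤lnTerm n) (^-diff-≥ 0≤b b≤a (2 ℕ.* n))) ⟩
      (artanh n a - artanh n b) + lnTerm n * (a ^ suc (2 ℕ.* n) - b ^ suc (2 ℕ.* n))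
        ≡⟨ artanh-step n ⟨
      artanh (suc n) a - artanh (suc n) b ∎

  möbius≡ : ∀ {y} → 0ℚ ≤ℚ y → möbius y ≡ 1ℚ - ofℕ 2 * inv (y + 1ℚ)
  möbius≡ {y} 0≤y = trans
    (solve 2 (λ y i → (y :- con 1ℚ) :* i := (y :+ con 1ℚ) :* i :- con (ofℕ 2) :* i) refl y (inv (y + 1ℚ)))
    (cong (_- ofℕ 2 * inv (y + 1ℚ)) (inv-*ʳ (+1-pos 0≤y)))

  1≤⇒0≤ : ∀ {y} → 1ℚ ≤ℚ y → 0ℚ ≤ℚ y
  1≤⇒0≤ = ℚₚ.≤-trans 0≤1

  möbius-mono : ∀ {x y} → 0ℚ ≤ℚ x → x ≤ℚ y → möbius x ≤ℚ möbius y
  möbius-mono {x} {y} 0≤x x≤y = subst₂ _≤ℚ_ (sym (möbius≡ 0≤x)) (sym (möbius≡ (ℚₚ.≤-trans 0≤x x≤y)))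
    (ℚₚ.+-monoʳ-≤ 1ℚ (ℚₚ.neg-antimono-≤ (*-monoˡ {ofℕ 2} (0≤ofℕ 2) (inv-anti (+1-pos 0≤x) (ℚₚ.+-monoˡ-≤ 1ℚ x≤y)))))

  möbius-nn : ∀ {y} → 1ℚ ≤ℚ y → 0ℚ ≤ℚ möbius y
  möbius-nn 1≤y = möbius-mono {1ℚ} 0≤1 1≤y

  lnAt-mono : ∀ {x y} → 1ℚ ≤ℚ x → x ≤ℚ y → ∀ n → lnAt n x ≤ℚ lnAt n y
  lnAt-mono {x} {y} 1≤x x≤y n = *-monoˡ {ofℕ 2} {X} {A} (0≤ofℕ 2) (≤-by {X} {A} (A - X) (ℚₚ.≤-trans
      (*-nn (diff≥0 u≤v) (geometric-nn (square-nn u) n)) (artanh-diff-≥ (möbius-nn 1≤x) u≤v n))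
      (solve 2 (λ A X → X :+ (A :- X) := A) refl A X))
    where
    u = möbius x
    v = möbius y
    u≤v = möbius-mono (1≤⇒0≤ 1≤x) x≤y
    A = artanh n v
    X = artanh n u

  lnAt-1 : ∀ n → lnAt n 1ℚ ≡ 0ℚ
  lnAt-1 n = solve 1 (λ s → con (ofℕ 2) :* (con 0ℚ :* s) := con 0ℚ) refl (partialSum lnTerm 0ℚ n)

  lnAt-nn : ∀ {y} → 1ℚ ≤ℚ y → ∀ n → 0ℚ ≤ℚ lnAt n y
  lnAt-nn {y} 1≤y n = subst (_≤ℚ lnAt n y) (lnAt-1 n) (lnAt-mono ℚₚ.≤-refl 1≤y n)

  module Double {y} (1≤y : 1ℚ ≤ℚ y) where

    0≤y = 1≤⇒0≤ 1≤y
    2y = ofℕ 2 * y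

    y≤2y : y ≤ℚ 2y
    y≤2y = ≤-by y 0≤y (solve 1 (λ y → y :+ y := con (ofℕ 2) :* y) refl y)

    i = inv (2y + 1ℚ)
    j = inv (y + 1ℚ)
    a = möbius 2y
    b = möbius y

    0<i : 0ℚ < i
    0<i = inv-pos (+1-pos (ℚₚ.≤-trans 0≤y y≤2y))

    0<j : 0ℚ < j
    0<j = inv-pos (+1-pos 0≤y)

    i≤j : i ≤ℚ j
    i≤j = inv-anti (+1-pos 0≤y) (ℚₚ.+-monoˡ-≤ 1ℚ y≤2y)

    j≤½ : j ≤ℚ ½
    j≤½ = inv-anti {ofℕ 2} (0<ofℕ 2) (ℚₚ.+-monoˡ-≤ 1ℚ 1≤y)

    0≤b = möbius-nn 1≤y
    b≤a : b ≤ℚ a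
    b≤a = möbius-mono 0≤y y≤2y

    -- This is (2 y + 1) + 1 = 2 (y + 1) divided by both denominators; it eliminates `y` from the
    -- next two estimates.
    ij : j + i * j ≡ ofℕ 2 * i
    ij = begin-equality
      j + i * j                              ≡⟨ cong (_+ i * j) (ℚₚ.*-identityˡ j) ⟨
      1ℚ * j + i * j                         ≡⟨ cong (λ z → z * j + i * j) (inv-*ʳ (+1-pos (ℚₚ.≤-trans 0≤y y≤2y))) ⟨
      (2y + 1ℚ) * i * j + i * j              ≡⟨ solve 3 (λ y i j → (con (ofℕ 2) :* y :+ con 1ℚ) :* i :* j :+ i :* j := con (ofℕ 2) :* i :* ((y :+ con 1ℚ) :* j)) refl y i j ⟩
      ofℕ 2 * i * ((y + 1ℚ) * j)             ≡⟨ cong (λ z → ofℕ 2 * i * z) (inv-*ʳ (+1-pos 0≤y)) ⟩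
      ofℕ 2 * i * 1ℚ                         ≡⟨ ℚₚ.*-identityʳ (ofℕ 2 * i) ⟩
      ofℕ 2 * i                              ∎

    a≡ = möbius≡ (ℚₚ.≤-trans 0≤y y≤2y)
    b≡ = möbius≡ 0≤y

    -- Shaped so that 1 - a² meets `geometric (a * a) n` and leaves 1 - a^(2 n) ≤ 1. The next
    -- estimate does the same at `b`, from below.
    2[a-b]≤ : ofℕ 2 * (a - b) ≤ℚ 1ℚ - a * a
    2[a-b]≤ = subst₂ (λ a b → ofℕ 2 * (a - b) ≤ℚ 1ℚ - a * a) (sym a≡) (sym b≡)
      (≤-by (ofℕ 4 * (i * (j - i))) (*-nn (0≤ofℕ 4) (*-nn (ℚₚ.<⇒≤ 0<i) (diff≥0 i≤j))) (begin-equality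
        ofℕ 2 * (1ℚ - ofℕ 2 * i - (1ℚ - ofℕ 2 * j)) + ofℕ 4 * (i * (j - i))
          ≡⟨ solve 2 (λ i j → con (ofℕ 2) :* (con 1ℚ :- con (ofℕ 2) :* i :- (con 1ℚ :- con (ofℕ 2) :* j)) :+ con (ofℕ 4) :* (i :* (j :- i))
                           := con (ofℕ 4) :* (j :+ i :* j) :- con (ofℕ 4) :* i :- con (ofℕ 4) :* (i :* i)) refl i j ⟩
        ofℕ 4 * (j + i * j) - ofℕ 4 * i - ofℕ 4 * (i * i)
          ≡⟨ cong (λ z → ofℕ 4 * z - ofℕ 4 * i - ofℕ 4 * (i * i)) ij ⟩
        ofℕ 4 * (ofℕ 2 * i) - ofℕ 4 * i - ofℕ 4 * (i * i)
          ≡⟨ solve 1 (λ i → con (ofℕ 4) :* (con (ofℕ 2) :* i) :- con (ofℕ 4) :* i :- con (ofℕ 4) :* (i :* i)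
                         := con 1ℚ :- (con 1ℚ :- con (ofℕ 2) :* i) :* (con 1ℚ :- con (ofℕ 2) :* i)) refl i ⟩
        1ℚ - (1ℚ - ofℕ 2 * i) * (1ℚ - ofℕ 2 * i) ∎))

    2[a-b]≥ : ½ * (1ℚ - b * b) ≤ℚ ofℕ 2 * (a - b)
    2[a-b]≥ = subst₂ (λ a b → ½ * (1ℚ - b * b) ≤ℚ ofℕ 2 * (a - b)) (sym a≡) (sym b≡)
      (≤-by (ofℕ 2 * (j * (j - i))) (*-nn (0≤ofℕ 2) (*-nn (ℚₚ.<⇒≤ 0<j) (diff≥0 i≤j))) (begin-equality
        ½ * (1ℚ - (1ℚ - ofℕ 2 * j) * (1ℚ - ofℕ 2 * j)) + ofℕ 2 * (j * (j - i))
          ≡⟨ solve 2 (λ i j → con ½ :* (con 1ℚ :- (con 1ℚ :- con (ofℕ 2) :* j) :* (con 1ℚ :- con (ofℕ 2) :* j)) :+ con (ofℕ 2) :* (j :* (j :- i))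
                           := con (ofℕ 4) :* j :- con (ofℕ 2) :* (j :+ i :* j)) refl i j ⟩
        ofℕ 4 * j - ofℕ 2 * (j + i * j)
          ≡⟨ cong (λ z → ofℕ 4 * j - ofℕ 2 * z) ij ⟩
        ofℕ 4 * j - ofℕ 2 * (ofℕ 2 * i)
          ≡⟨ solve 2 (λ i j → con (ofℕ 4) :* j :- con (ofℕ 2) :* (con (ofℕ 2) :* i)
                           := con (ofℕ 2) :* (con 1ℚ :- con (ofℕ 2) :* i :- (con 1ℚ :- con (ofℕ 2) :* j))) refl i j ⟩
        ofℕ 2 * (1ℚ - ofℕ 2 * i - (1ℚ - ofℕ 2 * j)) ∎))

    0<1-b² : 0ℚ < 1ℚ - b * b
    0<1-b² = subst (λ b → 0ℚ < 1ℚ - b * b) (sym b≡) (subst (0ℚ <_)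
      (solve 1 (λ j → con (ofℕ 4) :* (j :* (con ½ :+ (con ½ :- j))) := con 1ℚ :- (con 1ℚ :- con (ofℕ 2) :* j) :* (con 1ℚ :- con (ofℕ 2) :* j)) refl j)
      (*-pos (0<ofℕ 4) (*-pos 0<j (ℚₚ.+-mono-<-≤ 0<½ (diff≥0 j≤½)))))

    doubling-≤ : ∀ n → lnAt n 2y ≤ℚ lnAt n y + 1ℚ
    doubling-≤ n = ≤-by {lnAt n 2y} {lnAt n y + 1ℚ} (1ℚ - ofℕ 2 * (A - B)) (diff≥0 (begin
        ofℕ 2 * (A - B)                              ≤⟨ *-monoˡ {ofℕ 2} (0≤ofℕ 2) (artanh-diff-≤ 0≤b b≤a n) ⟩
        ofℕ 2 * ((a - b) * geometric (a * a) n)      ≡⟨ ℚₚ.*-assoc (ofℕ 2) (a - b) (geometric (a * a) n) ⟨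
        ofℕ 2 * (a - b) * geometric (a * a) n        ≤⟨ *-monoʳ {geometric (a * a) n} (geometric-nn (square-nn a) n) 2[a-b]≤ ⟩
        (1ℚ - a * a) * geometric (a * a) n           ≡⟨ geometric-sum (a * a) n ⟩
        1ℚ - (a * a) ^ n                             ≤⟨ ≤-by ((a * a) ^ n) (^-nn (square-nn a) n) (solve 1 (λ x → con 1ℚ :- x :+ x := con 1ℚ) refl ((a * a) ^ n)) ⟩
        1ℚ                                           ∎))
      (solve 2 (λ A B → con (ofℕ 2) :* A :+ (con 1ℚ :- con (ofℕ 2) :* (A :- B)) := con (ofℕ 2) :* B :+ con 1ℚ) refl A B)
      where
      A = artanh n a
      B = artanh n b

    -- Truncation leaves the factor 1 - b^(2 n), which reaches ½ only from a precision depending on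
    -- `y` on. The other ½ comes from `2[a-b]≥`.
    doubling-≥ : ∃[ N ] (∀ n → N ≤ n → lnAt n y + ½ * ½ ≤ℚ lnAt n 2y)
    doubling-≥ = proj₁ small½ , λ n N≤n →
      ≤-by {lnAt n y + ½ * ½} {lnAt n 2y} (ofℕ 2 * (artanh n a - artanh n b) - ½ * ½) (diff≥0 (begin
        ½ * ½                                        ≤⟨ *-monoˡ {½} (ℚₚ.<⇒≤ 0<½) (≤-by {½} (½ - (b * b) ^ n) (diff≥0 (proj₂ small½ n N≤n))
                                                          (solve 1 (λ x → con ½ :+ (con ½ :- x) := con 1ℚ :- x) refl ((b * b) ^ n))) ⟩
        ½ * (1ℚ - (b * b) ^ n)                       ≡⟨ cong (λ z → ½ * z) (geometric-sum (b * b) n) ⟨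
        ½ * ((1ℚ - b * b) * geometric (b * b) n)     ≡⟨ ℚₚ.*-assoc ½ (1ℚ - b * b) (geometric (b * b) n) ⟨
        ½ * (1ℚ - b * b) * geometric (b * b) n       ≤⟨ *-monoʳ {geometric (b * b) n} (geometric-nn (square-nn b) n) 2[a-b]≥ ⟩
        ofℕ 2 * (a - b) * geometric (b * b) n        ≡⟨ ℚₚ.*-assoc (ofℕ 2) (a - b) (geometric (b * b) n) ⟩
        ofℕ 2 * ((a - b) * geometric (b * b) n)      ≤⟨ *-monoˡ {ofℕ 2} (0≤ofℕ 2) (artanh-diff-≥ 0≤b b≤a n) ⟩
        ofℕ 2 * (artanh n a - artanh n b)            ∎))
      (solve 2 (λ A B → con (ofℕ 2) :* B :+ con ½ :* con ½ :+ (con (ofℕ 2) :* (A :- B) :- con ½ :* con ½) := con (ofℕ 2) :* A) refl (artanh n a) (artanh n b))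
      where
      small½ = Geometric.small (b * b) (1ℚ - b * b) (square-nn b) 0<1-b²
        (solve 1 (λ x → x :+ (con 1ℚ :- x) := con 1ℚ) refl (b * b)) ½ 0<½

  private
    1≤2^ : ∀ e → 1ℚ ≤ℚ ofℕ (2 ℕ.^ e)
    1≤2^ e = ofℕ-mono (ℕₚ.m^n>0 2 e)

  lnAt-≤ : ∀ n e {y} → 1ℚ ≤ℚ y → y ≤ℚ ofℕ (2 ℕ.^ e) → lnAt n y ≤ℚ ofℕ e
  lnAt-≤ n e {y} 1≤y y≤ = ℚₚ.≤-trans (lnAt-mono 1≤y y≤ n) (bound e)
    where
    bound : ∀ e → lnAt n (ofℕ (2 ℕ.^ e)) ≤ℚ ofℕ e
    bound zero    = ℚₚ.≤-reflexive (lnAt-1 n)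
    bound (suc e) = begin
      lnAt n (ofℕ (2 ℕ.^ suc e))        ≡⟨ cong (lnAt n) (ofℕ-* 2 (2 ℕ.^ e)) ⟩
      lnAt n (ofℕ 2 * ofℕ (2 ℕ.^ e))    ≤⟨ Double.doubling-≤ (1≤2^ e) n ⟩
      lnAt n (ofℕ (2 ℕ.^ e)) + 1ℚ       ≤⟨ ℚₚ.+-monoˡ-≤ 1ℚ (bound e) ⟩
      ofℕ e + 1ℚ                        ≡⟨ trans (ofℕ-suc e) (ℚₚ.+-comm 1ℚ (ofℕ e)) ⟨
      ofℕ (suc e)                       ∎

  -- Each doubling up to 2^E has its own threshold and N is their maximum, so the bound is uniform
  -- for e ≤ E only. This ties the precision to the horizon.
  lnAt-≥ : ∀ E → ∃[ N ] (∀ n → N ≤ n → ∀ e → e ≤ E → ∀ {y} → ofℕ (2 ℕ.^ e) ≤ℚ y → ½ * ½ * ofℕ e ≤ℚ lnAt n y)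
  lnAt-≥ E = proj₁ (bound E) , λ n N≤n e e≤E ≤y → ℚₚ.≤-trans (proj₂ (bound E) n N≤n e e≤E) (lnAt-mono (1≤2^ e) ≤y n)
    where
    bound : ∀ E → ∃[ N ] (∀ n → N ≤ n → ∀ e → e ≤ E → ½ * ½ * ofℕ e ≤ℚ lnAt n (ofℕ (2 ℕ.^ e)))
    bound zero    = 0 , λ { n _ zero ℕ.z≤n → ℚₚ.≤-reflexive (sym (lnAt-1 n)) }
    bound (suc E) = N₁ ℕ.⊔ N₂ , go
      where
      N₁ = proj₁ (bound E)
      N₂ = proj₁ (Double.doubling-≥ (1≤2^ E))
      go : ∀ n → N₁ ℕ.⊔ N₂ ≤ n → ∀ e → e ≤ suc E → ½ * ½ * ofℕ e ≤ℚ lnAt n (ofℕ (2 ℕ.^ e))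
      go n N≤n e e≤ = cases (ℕₚ.m≤n⇒m<n∨m≡n e≤)
        where
        last : ½ * ½ * ofℕ (suc E) ≤ℚ lnAt n (ofℕ (2 ℕ.^ suc E))
        last = begin
          ½ * ½ * ofℕ (suc E)               ≡⟨ trans (cong (λ z → ½ * ½ * z) (ofℕ-suc E)) (solve 1 (λ e → con ½ :* con ½ :* (con 1ℚ :+ e) := con ½ :* con ½ :* e :+ con ½ :* con ½) refl (ofℕ E)) ⟩
          ½ * ½ * ofℕ E + ½ * ½             ≤⟨ ℚₚ.+-monoˡ-≤ (½ * ½) (proj₂ (bound E) n (ℕₚ.m⊔n≤o⇒m≤o N₁ N₂ N≤n) E ℕₚ.≤-refl) ⟩
          lnAt n (ofℕ (2 ℕ.^ E)) + ½ * ½    ≤⟨ proj₂ (Double.doubling-≥ (1≤2^ E)) n (ℕₚ.m⊔n≤o⇒n≤o N₁ N₂ N≤n) ⟩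
          lnAt n (ofℕ 2 * ofℕ (2 ℕ.^ E))    ≡⟨ cong (lnAt n) (ofℕ-* 2 (2 ℕ.^ E)) ⟨
          lnAt n (ofℕ (2 ℕ.^ suc E))        ∎
        cases : e ℕ.< suc E ⊎ e ≡ suc E → ½ * ½ * ofℕ e ≤ℚ lnAt n (ofℕ (2 ℕ.^ e))
        cases (inj₁ (ℕ.s≤s e≤E)) = proj₂ (bound E) n (ℕₚ.m⊔n≤o⇒m≤o N₁ N₂ N≤n) e e≤E
        cases (inj₂ e≡)          = subst (λ e → ½ * ½ * ofℕ e ≤ℚ lnAt n (ofℕ (2 ℕ.^ e))) (sym e≡) last

-- Independent coins: the chances of silence and of a single transmitter.

module Coins where

  open ℚₚ.≤-Reasoning
  open CauchyLemmas using (^-nn)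

  𝔼 : ∀ {k} → Vec ℚ k → (Subset k → ℚ) → ℚ
  𝔼 []       f = f []
  𝔼 (p ∷ ps) f = p * 𝔼 ps (λ c → f (true ∷ c)) + (1ℚ - p) * 𝔼 ps (λ c → f (false ∷ c))

  -- Bound for the transmission probabilities: for 2^e ≤ j < 2^(e + 1) they are at most (e + 1) / j,
  -- which over j ≥ 3 is largest at j = 4. The distance to 1 keeps `silence` positive.
  ¾ : ℚ
  ¾ = ½ + ½ * ½

  Valid : ∀ {k} → Vec ℚ k → Set
  Valid = All (λ p → 0ℚ ≤ℚ p × p ≤ℚ ¾)

  ⟦_⟧ : Bool → ℚ
  ⟦ b ⟧ = if b then 1ℚ else 0ℚ

  ⟦⟧-nn : ∀ b → 0ℚ ≤ℚ ⟦ b ⟧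
  ⟦⟧-nn true  = 0≤1
  ⟦⟧-nn false = ℚₚ.≤-refl

  ⟦⟧≤1 : ∀ b → ⟦ b ⟧ ≤ℚ 1ℚ
  ⟦⟧≤1 true  = ℚₚ.≤-refl
  ⟦⟧≤1 false = 0≤1

  private
    ¼≤1-p : ∀ {p} → p ≤ℚ ¾ → ½ * ½ ≤ℚ 1ℚ - p
    ¼≤1-p {p} p≤¾ = ≤-by (¾ - p) (diff≥0 p≤¾) (solve 1 (λ p → con (½ * ½) :+ (con ¾ :- p) := con 1ℚ :- p) refl p)

    0≤¼ : 0ℚ ≤ℚ ½ * ½
    0≤¼ = *-nn (ℚₚ.<⇒≤ 0<½) (ℚₚ.<⇒≤ 0<½)

    0≤1-p : ∀ {p} → p ≤ℚ ¾ → 0ℚ ≤ℚ 1ℚ - p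
    0≤1-p p≤¾ = ℚₚ.≤-trans 0≤¼ (¼≤1-p p≤¾)

  𝔼-cong : ∀ {k} (ps : Vec ℚ k) {f g : Subset k → ℚ} → (∀ c → f c ≡ g c) → 𝔼 ps f ≡ 𝔼 ps g
  𝔼-cong []       f≡g = f≡g []
  𝔼-cong (p ∷ ps) f≡g = cong₂ (λ x y → p * x + (1ℚ - p) * y) (𝔼-cong ps (λ c → f≡g (true ∷ c))) (𝔼-cong ps (λ c → f≡g (false ∷ c)))

  𝔼-const : ∀ {k} (ps : Vec ℚ k) x → 𝔼 ps (λ _ → x) ≡ x
  𝔼-const []       x = refl
  𝔼-const (p ∷ ps) x = trans (cong₂ (λ y z → p * y + (1ℚ - p) * z) (𝔼-const ps x) (𝔼-const ps x))
    (solve 2 (λ p x → p :* x :+ (con 1ℚ :- p) :* x := x) refl p x)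

  𝔼-+ : ∀ {k} (ps : Vec ℚ k) f g → 𝔼 ps (λ c → f c + g c) ≡ 𝔼 ps f + 𝔼 ps g
  𝔼-+ []       f g = refl
  𝔼-+ (p ∷ ps) f g = trans (cong₂ (λ y z → p * y + (1ℚ - p) * z)
      (𝔼-+ ps (λ c → f (true ∷ c)) (λ c → g (true ∷ c))) (𝔼-+ ps (λ c → f (false ∷ c)) (λ c → g (false ∷ c))))
    (solve 5 (λ p a b c d → p :* (a :+ b) :+ (con 1ℚ :- p) :* (c :+ d) := (p :* a :+ (con 1ℚ :- p) :* c) :+ (p :* b :+ (con 1ℚ :- p) :* d)) refl
      p (𝔼 ps (λ c → f (true ∷ c))) (𝔼 ps (λ c → g (true ∷ c))) (𝔼 ps (λ c → f (false ∷ c))) (𝔼 ps (λ c → g (false ∷ c))))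

  𝔼-* : ∀ {k} (ps : Vec ℚ k) x f → 𝔼 ps (λ c → x * f c) ≡ x * 𝔼 ps f
  𝔼-* []       x f = refl
  𝔼-* (p ∷ ps) x f = trans (cong₂ (λ y z → p * y + (1ℚ - p) * z) (𝔼-* ps x (λ c → f (true ∷ c))) (𝔼-* ps x (λ c → f (false ∷ c))))
    (solve 4 (λ p x a b → p :* (x :* a) :+ (con 1ℚ :- p) :* (x :* b) := x :* (p :* a :+ (con 1ℚ :- p) :* b)) refl
      p x (𝔼 ps (λ c → f (true ∷ c))) (𝔼 ps (λ c → f (false ∷ c))))

  𝔼-affine : ∀ {k} (ps : Vec ℚ k) x y f → 𝔼 ps (λ c → x + y * f c) ≡ x + y * 𝔼 ps f
  𝔼-affine ps x y f = trans (𝔼-+ ps (λ _ → x) (λ c → y * f c)) (cong₂ _+_ (𝔼-const ps x) (𝔼-* ps y f))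

  𝔼-nn : ∀ {k} {ps : Vec ℚ k} → Valid ps → ∀ {f} → (∀ c → 0ℚ ≤ℚ f c) → 0ℚ ≤ℚ 𝔼 ps f
  𝔼-nn []                      0≤f = 0≤f []
  𝔼-nn ((0≤p , p≤¾) ∷ valid) 0≤f =
    +-nn (*-nn 0≤p (𝔼-nn valid (λ c → 0≤f (true ∷ c)))) (*-nn (0≤1-p p≤¾) (𝔼-nn valid (λ c → 0≤f (false ∷ c))))

  ΣFin : ∀ k → (Fin k → ℚ) → ℚ
  ΣFin zero    f = 0ℚ
  ΣFin (suc k) f = f zero + ΣFin k (λ u → f (suc u))

  ΣFin-mono : ∀ k {f g : Fin k → ℚ} → (∀ u → f u ≤ℚ g u) → ΣFin k f ≤ℚ ΣFin k g
  ΣFin-mono zero    f≤g = ℚₚ.≤-refl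
  ΣFin-mono (suc k) f≤g = ℚₚ.+-mono-≤ (f≤g zero) (ΣFin-mono k (λ u → f≤g (suc u)))

  ΣFin-nn : ∀ k {f : Fin k → ℚ} → (∀ u → 0ℚ ≤ℚ f u) → 0ℚ ≤ℚ ΣFin k f
  ΣFin-nn zero    0≤f = ℚₚ.≤-refl
  ΣFin-nn (suc k) 0≤f = +-nn (0≤f zero) (ΣFin-nn k (λ u → 0≤f (suc u)))

  term≤ΣFin : ∀ k {f : Fin k → ℚ} → (∀ u → 0ℚ ≤ℚ f u) → ∀ u → f u ≤ℚ ΣFin k f
  term≤ΣFin (suc k) {f} 0≤f zero    = ≤-by (ΣFin k (λ u → f (suc u))) (ΣFin-nn k (λ u → 0≤f (suc u))) refl
  term≤ΣFin (suc k) {f} 0≤f (suc u) = ℚₚ.≤-trans (term≤ΣFin k (λ u → 0≤f (suc u)) u)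
    (≤-by (f zero) (0≤f zero) (ℚₚ.+-comm (ΣFin k (λ u → f (suc u))) (f zero)))

  ΣFin-const : ∀ k x → ΣFin k (λ _ → x) ≡ ofℕ k * x
  ΣFin-const zero    x = sym (ℚₚ.*-zeroˡ x)
  ΣFin-const (suc k) x = trans (cong (λ z → x + z) (ΣFin-const k x))
    (trans (solve 2 (λ k x → x :+ k :* x := (con 1ℚ :+ k) :* x) refl (ofℕ k) x) (cong (_* x) (sym (ofℕ-+ 1 k))))

  𝔼-ΣFin : ∀ {k} (ps : Vec ℚ k) l (f : Fin l → Subset k → ℚ) → 𝔼 ps (λ c → ΣFin l (λ u → f u c)) ≡ ΣFin l (λ u → 𝔼 ps (f u))
  𝔼-ΣFin ps zero    f = 𝔼-const ps 0ℚ
  𝔼-ΣFin ps (suc l) f = trans (𝔼-+ ps (f zero) (λ c → ΣFin l (λ u → f (suc u) c)))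
    (cong (λ z → 𝔼 ps (f zero) + z) (𝔼-ΣFin ps l (λ u → f (suc u))))

  sumᵛ : ∀ {k} → Vec ℚ k → ℚ
  sumᵛ []       = 0ℚ
  sumᵛ (p ∷ ps) = p + sumᵛ ps

  sumᵛ-nn : ∀ {k} {ps : Vec ℚ k} → Valid ps → 0ℚ ≤ℚ sumᵛ ps
  sumᵛ-nn []                  = ℚₚ.≤-refl
  sumᵛ-nn ((0≤p , _) ∷ valid) = +-nn 0≤p (sumᵛ-nn valid)

  silence : ∀ {k} → Vec ℚ k → ℚ
  silence []       = 1ℚ
  silence (p ∷ ps) = (1ℚ - p) * silence ps

  silence-nn : ∀ {k} {ps : Vec ℚ k} → Valid ps → 0ℚ ≤ℚ silence ps
  silence-nn []                    = 0≤1
  silence-nn ((_ , p≤¾) ∷ valid) = *-nn (0≤1-p p≤¾) (silence-nn valid)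

  1-sum≤silence : ∀ {k} {ps : Vec ℚ k} → Valid ps → 1ℚ - sumᵛ ps ≤ℚ silence ps
  1-sum≤silence []                    = ℚₚ.≤-refl
  1-sum≤silence {ps = p ∷ ps} ((0≤p , p≤¾) ∷ valid) = begin
    1ℚ - (p + sumᵛ ps)               ≤⟨ ≤-by (p * sumᵛ ps) (*-nn 0≤p (sumᵛ-nn valid))
                                          (solve 2 (λ p s → con 1ℚ :- (p :+ s) :+ p :* s := (con 1ℚ :- p) :* (con 1ℚ :- s)) refl p (sumᵛ ps)) ⟩
    (1ℚ - p) * (1ℚ - sumᵛ ps)        ≤⟨ *-monoˡ {1ℚ - p} (0≤1-p p≤¾) (1-sum≤silence valid) ⟩
    (1ℚ - p) * silence ps            ∎

  -- The price of half a unit of probability mass: the coin that needs it leaves a factor of at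
  -- least ¼ for silence, and the leftover r ≤ ½ leaves 1 - r ≥ ½.
  ⅛ : ℚ
  ⅛ = ½ * (½ * ½)

  -- The total r + m/2 is consumed greedily; a half is borrowed from m/2 whenever p exceeds r.
  silence-≥-greedy : ∀ {k} {ps : Vec ℚ k} → Valid ps → ∀ m r → 0ℚ ≤ℚ r → r ≤ℚ ½ →
    sumᵛ ps ≤ℚ r + ½ * ofℕ m → (1ℚ - r) * ⅛ ^ m ≤ℚ silence ps
  silence-≥-greedy [] m r 0≤r r≤½ sum≤ = begin
    (1ℚ - r) * ⅛ ^ m                 ≤⟨ *-mono {1ℚ - r} {1ℚ} {⅛ ^ m} {1ℚ} (diff≥0 (ℚₚ.≤-trans r≤½ ½≤1)) 0≤1
                                          (≤-by r 0≤r (solve 1 (λ r → con 1ℚ :- r :+ r := con 1ℚ) refl r)) (Powers.^≤1 0≤⅛ ⅛≤1 m) ⟩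
    1ℚ                               ∎
    where
    ½≤1 : ½ ≤ℚ 1ℚ
    ½≤1 = ≤-by ½ (ℚₚ.<⇒≤ 0<½) refl
    0≤⅛ : 0ℚ ≤ℚ ⅛
    0≤⅛ = *-nn (ℚₚ.<⇒≤ 0<½) 0≤¼
    ⅛≤1 : ⅛ ≤ℚ 1ℚ
    ⅛≤1 = *-mono {½} {1ℚ} {½ * ½} {1ℚ} (ℚₚ.<⇒≤ 0<½) 0≤1 ½≤1 (*-mono {½} {1ℚ} {½} {1ℚ} (ℚₚ.<⇒≤ 0<½) 0≤1 ½≤1 ½≤1)
  silence-≥-greedy {ps = p ∷ ps} ((0≤p , p≤¾) ∷ valid) m r 0≤r r≤½ sum≤ with ℚₚ.≤-total p r
  ... | inj₁ p≤r = begin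
    (1ℚ - r) * ⅛ ^ m                 ≤⟨ *-monoʳ {⅛ ^ m} (^-nn (*-nn (ℚₚ.<⇒≤ 0<½) 0≤¼) m) (≤-by {1ℚ - r} {(1ℚ - p) * (1ℚ - (r - p))} (p * (r - p)) (*-nn 0≤p (diff≥0 p≤r))
                                          (solve 2 (λ p r → con 1ℚ :- r :+ p :* (r :- p) := (con 1ℚ :- p) :* (con 1ℚ :- (r :- p))) refl p r)) ⟩
    (1ℚ - p) * (1ℚ - (r - p)) * ⅛ ^ m ≡⟨ ℚₚ.*-assoc (1ℚ - p) (1ℚ - (r - p)) (⅛ ^ m) ⟩
    (1ℚ - p) * ((1ℚ - (r - p)) * ⅛ ^ m) ≤⟨ *-monoˡ {1ℚ - p} (0≤1-p p≤¾) (silence-≥-greedy valid m (r - p) (diff≥0 p≤r)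
                                          (ℚₚ.≤-trans (≤-by p 0≤p (solve 2 (λ p r → r :- p :+ p := r) refl p r)) r≤½)
                                          (≤-by (r + ½ * ofℕ m - (p + sumᵛ ps)) (diff≥0 sum≤)
                                            (solve 4 (λ p s r m → s :+ (r :+ con ½ :* m :- (p :+ s)) := r :- p :+ con ½ :* m) refl p (sumᵛ ps) r (ofℕ m)))) ⟩
    (1ℚ - p) * silence ps            ∎
  silence-≥-greedy {ps = p ∷ ps} ((0≤p , p≤¾) ∷ valid) zero r 0≤r r≤½ sum≤ | inj₂ r≤p =
    silence-≥-zero
    where
    silence-≥-zero : (1ℚ - r) * ⅛ ^ 0 ≤ℚ (1ℚ - p) * silence ps
    silence-≥-zero = begin
      (1ℚ - r) * 1ℚ                  ≤⟨ ≤-by (r + 0ℚ - (p + sumᵛ ps)) (diff≥0 sum≤)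
                                          (solve 3 (λ p s r → (con 1ℚ :- r) :* con 1ℚ :+ (r :+ con 0ℚ :- (p :+ s)) := con 1ℚ :- (p :+ s)) refl p (sumᵛ ps) r) ⟩
      1ℚ - (p + sumᵛ ps)             ≤⟨ 1-sum≤silence ((0≤p , p≤¾) ∷ valid) ⟩
      (1ℚ - p) * silence ps          ∎
  silence-≥-greedy {ps = p ∷ ps} ((0≤p , p≤¾) ∷ valid) (suc m) r 0≤r r≤½ sum≤ | inj₂ r≤p = begin
    (1ℚ - r) * (⅛ * ⅛ ^ m)           ≤⟨ *-monoʳ {⅛ * ⅛ ^ m} (*-nn 0≤⅛ (^-nn 0≤⅛ m)) (≤-by {1ℚ - r} {1ℚ} r 0≤r (solve 1 (λ r → con 1ℚ :- r :+ r := con 1ℚ) refl r)) ⟩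
    1ℚ * (⅛ * ⅛ ^ m)                 ≡⟨ solve 1 (λ z → con 1ℚ :* (con ⅛ :* z) := con (½ * ½) :* (con ½ :* z)) refl (⅛ ^ m) ⟩
    (½ * ½) * (½ * ⅛ ^ m)            ≤⟨ *-mono {½ * ½} {1ℚ - p} {½ * ⅛ ^ m} {silence ps} 0≤¼ (silence-nn valid) (¼≤1-p p≤¾) half ⟩
    (1ℚ - p) * silence ps            ∎
    where
    0≤⅛ = *-nn (ℚₚ.<⇒≤ 0<½) 0≤¼
    split : ½ * ofℕ (suc m) ≡ ½ + ½ * ofℕ m
    split = trans (cong (λ z → ½ * z) (ofℕ-+ 1 m)) (solve 1 (λ m → con ½ :* (con 1ℚ :+ m) := con ½ :+ con ½ :* m) refl (ofℕ m))
    sum≤′ : p + sumᵛ ps ≤ℚ r + (½ + ½ * ofℕ m)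
    sum≤′ = subst (λ z → p + sumᵛ ps ≤ℚ r + z) split sum≤
    half : ½ * ⅛ ^ m ≤ℚ silence ps
    -- A coin larger than `r + ½` overdraws the borrowed half, but then the remaining coins fit into
    -- m / 2 with nothing left over.
    half with ℚₚ.≤-total p (r + ½)
    ... | inj₁ p≤r+½ = ℚₚ.≤-trans
      (*-monoʳ {⅛ ^ m} (^-nn 0≤⅛ m) (≤-by {½} (p - r) (diff≥0 r≤p) (solve 2 (λ p r → con ½ :+ (p :- r) := con 1ℚ :- (r :+ con ½ :- p)) refl p r)))
      (silence-≥-greedy valid m (r + ½ - p) (diff≥0 p≤r+½)
        (≤-by (p - r) (diff≥0 r≤p) (solve 2 (λ p r → r :+ con ½ :- p :+ (p :- r) := con ½) refl p r))
        (≤-by (r + (½ + ½ * ofℕ m) - (p + sumᵛ ps)) (diff≥0 sum≤′)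
          (solve 4 (λ p s r m → s :+ (r :+ (con ½ :+ con ½ :* m) :- (p :+ s)) := r :+ con ½ :- p :+ con ½ :* m) refl p (sumᵛ ps) r (ofℕ m))))
    ... | inj₂ r+½≤p = ℚₚ.≤-trans
      (*-monoʳ {⅛ ^ m} (^-nn 0≤⅛ m) (≤-by {½} {1ℚ - 0ℚ} ½ (ℚₚ.<⇒≤ 0<½) refl))
      (silence-≥-greedy valid m 0ℚ ℚₚ.≤-refl (ℚₚ.<⇒≤ 0<½)
        (≤-by ((r + (½ + ½ * ofℕ m) - (p + sumᵛ ps)) + (p - (r + ½))) (+-nn (diff≥0 sum≤′) (diff≥0 r+½≤p))
          (solve 4 (λ p s r m → s :+ (r :+ (con ½ :+ con ½ :* m) :- (p :+ s) :+ (p :- (r :+ con ½))) := con 0ℚ :+ con ½ :* m) refl p (sumᵛ ps) r (ofℕ m))))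

  silence-≥ : ∀ {k} {ps : Vec ℚ k} → Valid ps → ∀ m → sumᵛ ps ≤ℚ ½ * ofℕ m → ⅛ ^ m ≤ℚ silence ps
  silence-≥ {ps = ps} valid m sum≤ = subst (_≤ℚ silence ps) (ℚₚ.*-identityˡ (⅛ ^ m))
    (silence-≥-greedy valid m 0ℚ ℚₚ.≤-refl (ℚₚ.<⇒≤ 0<½) (subst (sumᵛ ps ≤ℚ_) (sym (ℚₚ.+-identityˡ (½ * ofℕ m))) sum≤))

  solo : ∀ {k} → Subset k → Bool
  solo c = ∣ c ∣ ℕ.≡ᵇ 1

  𝔼-silence : ∀ {k} (ps : Vec ℚ k) → 𝔼 ps (λ c → ⟦ ∣ c ∣ ℕ.≡ᵇ 0 ⟧) ≡ silence ps
  𝔼-silence []       = refl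
  𝔼-silence (p ∷ ps) = trans (cong₂ (λ y z → p * y + (1ℚ - p) * z) (𝔼-const ps 0ℚ) (𝔼-silence ps))
    (solve 2 (λ p s → p :* con 0ℚ :+ (con 1ℚ :- p) :* s := (con 1ℚ :- p) :* s) refl p (silence ps))

  -- The exact chance is `silence` times the sum of p / (1 - p); the bound drops the denominators.
  𝔼-solo-≥ : ∀ {k} {ps : Vec ℚ k} → Valid ps → sumᵛ ps * silence ps ≤ℚ 𝔼 ps (λ c → ⟦ solo c ⟧)
  𝔼-solo-≥ []                    = ℚₚ.≤-refl
  𝔼-solo-≥ {ps = p ∷ ps} ((0≤p , p≤¾) ∷ valid) = begin
    (p + σ) * ((1ℚ - p) * s)                 ≤⟨ ≤-by (p * (p * s)) (*-nn 0≤p (*-nn 0≤p (silence-nn valid)))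
                                                  (solve 3 (λ p σ s → (p :+ σ) :* ((con 1ℚ :- p) :* s) :+ p :* (p :* s) := p :* s :+ (con 1ℚ :- p) :* (σ :* s)) refl p σ s) ⟩
    p * s + (1ℚ - p) * (σ * s)               ≤⟨ ℚₚ.+-mono-≤ (ℚₚ.≤-reflexive (cong (λ z → p * z) (sym (𝔼-silence ps)))) (*-monoˡ {1ℚ - p} (0≤1-p p≤¾) (𝔼-solo-≥ valid)) ⟩
    𝔼 (p ∷ ps) (λ c → ⟦ solo c ⟧)            ∎
    where
    σ = sumᵛ ps
    s = silence ps

  -- In the exact chance the product runs over the other stations only; restoring the factor 1 - p
  -- of `u` turns it into `silence` and can only lower it.
  𝔼-only-≥ : ∀ {k} {ps : Vec ℚ k} → Valid ps → ∀ u →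
    Vec.lookup ps u * silence ps ≤ℚ 𝔼 ps (λ c → ⟦ Vec.lookup c u ∧ solo c ⟧)
  𝔼-only-≥ {ps = p ∷ ps} ((0≤p , p≤¾) ∷ valid) zero = begin
    p * ((1ℚ - p) * s)                       ≤⟨ ≤-by (p * (p * s)) (*-nn 0≤p (*-nn 0≤p (silence-nn valid)))
                                                  (solve 2 (λ p s → p :* ((con 1ℚ :- p) :* s) :+ p :* (p :* s) := p :* s :+ (con 1ℚ :- p) :* con 0ℚ) refl p s) ⟩
    p * s + (1ℚ - p) * 0ℚ                    ≡⟨ cong₂ (λ y z → p * y + (1ℚ - p) * z) (𝔼-silence ps) (𝔼-const ps 0ℚ) ⟨
    𝔼 (p ∷ ps) (λ c → ⟦ Vec.lookup c zero ∧ solo c ⟧) ∎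
    where s = silence ps
  𝔼-only-≥ {ps = p ∷ ps} ((0≤p , p≤¾) ∷ valid) (suc u) = begin
    q * ((1ℚ - p) * s)                       ≡⟨ solve 3 (λ q p s → q :* ((con 1ℚ :- p) :* s) := con 0ℚ :+ (con 1ℚ :- p) :* (q :* s)) refl q p s ⟩
    0ℚ + (1ℚ - p) * (q * s)                  ≤⟨ ℚₚ.+-mono-≤ (*-nn 0≤p (𝔼-nn valid (λ c → ⟦⟧-nn (Vec.lookup c u ∧ (∣ c ∣ ℕ.≡ᵇ 0))))) (*-monoˡ {1ℚ - p} (0≤1-p p≤¾) (𝔼-only-≥ valid u)) ⟩
    𝔼 (p ∷ ps) (λ c → ⟦ Vec.lookup c (suc u) ∧ solo c ⟧) ∎
    where
    s = silence ps
    q = Vec.lookup ps u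

-- Sums over intervals and the transition of the stations in one round.

module Ranges where

  sumFrom : (ℕ → ℕ) → ℕ → ℕ → ℕ
  sumFrom f r zero    = 0
  sumFrom f r (suc n) = f r ℕ.+ sumFrom f (suc r) n

  sumFrom-+ : ∀ f r m n → sumFrom f r (m ℕ.+ n) ≡ sumFrom f r m ℕ.+ sumFrom f (r ℕ.+ m) n
  sumFrom-+ f r zero    n = cong (λ x → sumFrom f x n) (sym (ℕₚ.+-identityʳ r))
  sumFrom-+ f r (suc m) n = trans (cong (f r ℕ.+_) (trans (sumFrom-+ f (suc r) m n) (cong (λ x → sumFrom f (suc r) m ℕ.+ sumFrom f x n) (sym (ℕₚ.+-suc r m)))))
    (sym (ℕₚ.+-assoc (f r) (sumFrom f (suc r) m) (sumFrom f (r ℕ.+ suc m) n)))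

  sumFrom-≤ : ∀ f r n B → (∀ i → r ≤ i → f i ≤ B) → sumFrom f r n ≤ n ℕ.* B
  sumFrom-≤ f r zero    B f≤ = ℕ.z≤n
  sumFrom-≤ f r (suc n) B f≤ = ℕₚ.+-mono-≤ (f≤ r ℕₚ.≤-refl) (sumFrom-≤ f (suc r) n B (λ i r<i → f≤ i (ℕₚ.<⇒≤ r<i)))

module Rounds where

  T⇒≡true : ∀ {b} → T b → b ≡ true
  T⇒≡true {true} _ = refl

  -- `expectation` also runs over outcomes in which a station transmits with probability 0; those are excluded here.
  data Possible : ∀ {k} → Subset k → Vec Status k → Set where
    []       : Possible [] []
    listen   : ∀ {k x} {c : Subset k} {s} → Possible c s → Possible (false ∷ c) (x ∷ s)
    send     : ∀ {k r} {c : Subset k} {s} → Possible c s → Possible (true ∷ c) (active (suc r) ∷ s)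

  advance : ∀ {k} → Subset k → Vec Status k → Vec Status k
  advance = Vec.zipWith nextRound

-- The integer part H of the potential: mass still to be emitted and stations not yet off.

module Population (mass : ℕ → ℕ) (L S g : ℕ) .{{_ : NonZero S}} where

  open Coins using (solo)
  open Rounds

  massFrom = Ranges.sumFrom mass

  remaining : Status → ℕ
  remaining asleep     = massFrom 0 L
  remaining (active r) = massFrom r (L ℕ.∸ r)
  remaining (off r)    = 0

  -- Age `suc r` is local round r + 1, whose probability is indexed by `r`; age 0 is the activation
  -- round, in which nothing is sent.
  emitted : Status → ℕ
  emitted (active (suc r)) = mass r
  emitted _                = 0

  pending : Status → ℕ
  pending (off r) = 0
  pending _       = 1

  total : ∀ {k} → (Status → ℕ) → Vec Status k → ℕ
  total f []      = 0
  total f (x ∷ s) = f x ℕ.+ total f s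

  data Timely : Status → Set where
    asleep : Timely asleep
    active : ∀ {r} → r ℕ.< L → Timely (active r)
    off    : ∀ {r} → r ≤ L → Timely (off r)

  -- A station still active at age `L` has used local rounds 1 to L in vain, whereas switching off
  -- in round `L` itself is in time; hence the different inequalities.
  data Failed : Status → Set where
    active : ∀ {r} → L ≤ r → Failed (active r)
    off    : ∀ {r} → L ℕ.< r → Failed (off r)

  timely? : ∀ {k} (s : Vec Status k) → All Timely s ⊎ ∃[ u ] Failed (Vec.lookup s u)
  timely? []      = inj₁ []
  timely? (x ∷ s) with status x | timely? s
    where
    status : ∀ x → Timely x ⊎ Failed x
    status asleep = inj₁ asleep
    status (active r) with ℕₚ.<-≤-connex r L
    ... | inj₁ r<L = inj₁ (active r<L)
    ... | inj₂ L≤r = inj₂ (active L≤r)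
    status (off r) with ℕₚ.≤-<-connex r L
    ... | inj₁ r≤L = inj₁ (off r≤L)
    ... | inj₂ L<r = inj₂ (off L<r)
  ... | inj₂ failed | _                 = inj₂ (zero , failed)
  ... | inj₁ timely | inj₁ all          = inj₁ (timely ∷ all)
  ... | inj₁ timely | inj₂ (u , failed) = inj₂ (suc u , failed)

  -- Conservation of mass. A station of age `L` or more would emit mass that `remaining` does not
  -- contain, so all stations have to be timely.
  advance-remaining : ∀ {k} (a : Subset k) {s} → All Timely s →
    total remaining s ≡ total remaining (advance a s) ℕ.+ total emitted (advance a s)
  advance-remaining []      []                     = refl
  advance-remaining (b ∷ a) (_∷_ {x = x} {xs = s} ok all) = trans
    (cong₂ ℕ._+_ (step b ok) (advance-remaining a all))
    (S.solve 4 (λ a b c d → (a S.:+ b) S.:+ (c S.:+ d) S.:= (a S.:+ c) S.:+ (b S.:+ d)) refl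
      (remaining (nextRound b x)) (emitted (nextRound b x)) (total remaining (advance a s)) (total emitted (advance a s)))
    where
    step : ∀ b {x} → Timely x → remaining x ≡ remaining (nextRound b x) ℕ.+ emitted (nextRound b x)
    step true  asleep      = sym (ℕₚ.+-identityʳ (massFrom 0 L))
    step false asleep      = sym (ℕₚ.+-identityʳ (massFrom 0 L))
    step true  (active {r} r<L) = trans (cong (massFrom r) (ℕₚ.+-∸-assoc 1 r<L)) (ℕₚ.+-comm (mass r) (massFrom (suc r) (L ℕ.∸ suc r)))
    step false (active {r} r<L) = trans (cong (massFrom r) (ℕₚ.+-∸-assoc 1 r<L)) (ℕₚ.+-comm (mass r) (massFrom (suc r) (L ℕ.∸ suc r)))
    step true  (off _)     = refl
    step false (off _)     = refl

  advance-pending : ∀ {k} (a : Subset k) s → total pending (advance a s) ≡ total pending s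
  advance-pending []      []      = refl
  advance-pending (b ∷ a) (x ∷ s) = cong₂ ℕ._+_ (step b x) (advance-pending a s)
    where
    step : ∀ b x → pending (nextRound b x) ≡ pending x
    step true  asleep     = refl
    step false asleep     = refl
    step true  (active r) = refl
    step false (active r) = refl
    step true  (off r)    = refl
    step false (off r)    = refl

  total-acknowledge : ∀ f → (∀ r → f (off r) ≡ 0) → ∀ {k} (c : Subset k) s → total f (Vec.zipWith acknowledge c s) ≤ total f s
  total-acknowledge f f-off []      []      = ℕ.z≤n
  total-acknowledge f f-off (b ∷ c) (x ∷ s) = ℕₚ.+-mono-≤ (step b x) (total-acknowledge f f-off c s)
    where
    step : ∀ b x → f (acknowledge b x) ≤ f x
    step true  asleep     = ℕₚ.≤-refl
    step true  (active r) = ℕₚ.≤-trans (ℕₚ.≤-reflexive (f-off r)) ℕ.z≤n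
    step true  (off r)    = ℕₚ.≤-refl
    step false x          = ℕₚ.≤-refl

  total-resolve : ∀ f → (∀ r → f (off r) ≡ 0) → ∀ {k} (c : Subset k) s → total f (resolve c s) ≤ total f s
  total-resolve f f-off c s with solo c
  ... | true  = total-acknowledge f f-off c s
  ... | false = ℕₚ.≤-refl

  -- In an impossible outcome the lone transmitter could be asleep or already off, and then no
  -- station would switch off; `Possible` excludes this.
  pending-drop : ∀ {k} {c : Subset k} {s} → Possible c s → T (solo c) → suc (total pending (resolve c s)) ≤ total pending s
  pending-drop {c = c} ok is-solo with ∣ c ∣ ℕ.≡ᵇ 1 in eq
  ... | true = drop ok (ℕₚ.≤-reflexive (sym (ℕₚ.≡ᵇ⇒≡ ∣ c ∣ 1 (subst T (sym eq) tt))))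
    where
    drop : ∀ {k} {c : Subset k} {s} → Possible c s → 1 ≤ ∣ c ∣ → suc (total pending (Vec.zipWith acknowledge c s)) ≤ total pending s
    drop (listen {x = x} {c = c} {s = s} ok) 1≤ = subst (_≤ pending x ℕ.+ total pending s)
      (ℕₚ.+-suc (pending x) (total pending (Vec.zipWith acknowledge c s))) (ℕₚ.+-monoʳ-≤ (pending x) (drop ok 1≤))
    drop (send {c = c} {s = s} ok) _ = ℕ.s≤s (total-acknowledge pending (λ _ → refl) c s)

  -- Rounded down to a natural number because it serves as an exponent.
  H : ∀ {k} → Vec Status k → ℕ
  H s = total remaining s ℕ./ S ℕ.+ g ℕ.* total pending s

  H-advance : ∀ {k} (a : Subset k) {s} → All Timely s → H (advance a s) ≤ H s
  H-advance a {s} ok = ℕₚ.+-mono-≤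
    (ℕ÷./-monoˡ-≤ S (ℕₚ.m+n≤o⇒m≤o _ (ℕₚ.≤-reflexive (sym (advance-remaining a ok)))))
    (ℕₚ.≤-reflexive (cong (g ℕ.*_) (advance-pending a s)))

  -- Taking at least `S` off the numerator lowers the quotient by at least 1, in spite of the
  -- rounding.
  H-advance-crowded : ∀ {k} (a : Subset k) {s} → All Timely s → S ≤ total emitted (advance a s) → suc (H (advance a s)) ≤ H s
  H-advance-crowded a {s} ok S≤ = ℕₚ.+-mono-≤ (begin
      suc (R′ ℕ./ S)        ≡⟨ cong (λ x → suc (x ℕ./ S)) (ℕₚ.m+n∸n≡m R′ S) ⟨
      suc ((R′ ℕ.+ S ℕ.∸ S) ℕ./ S) ≡⟨ ℕ÷.m/n≡1+[m∸n]/n (ℕₚ.m≤n+m S R′) ⟨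
      (R′ ℕ.+ S) ℕ./ S      ≤⟨ ℕ÷./-monoˡ-≤ S (ℕₚ.≤-trans (ℕₚ.+-monoʳ-≤ R′ S≤) (ℕₚ.≤-reflexive (sym (advance-remaining a ok)))) ⟩
      total remaining s ℕ./ S ∎)
    (ℕₚ.≤-reflexive (cong (g ℕ.*_) (advance-pending a s)))
    where
    open ℕₚ.≤-Reasoning
    R′ = total remaining (advance a s)

  H-resolve : ∀ {k} (c : Subset k) s → H (resolve c s) ≤ H s
  H-resolve c s = ℕₚ.+-mono-≤ (ℕ÷./-monoˡ-≤ S (total-resolve remaining (λ _ → refl) c s))
    (ℕₚ.*-monoʳ-≤ g (total-resolve pending (λ _ → refl) c s))

  H-solo : ∀ {k} {c : Subset k} {s} → Possible c s → T (solo c) → g ℕ.+ H (resolve c s) ≤ H s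
  H-solo {c = c} {s} ok is-solo = begin
    g ℕ.+ (R′ ℕ.+ g ℕ.* N′)   ≡⟨ ℕₚ.+-comm g (R′ ℕ.+ g ℕ.* N′) ⟩
    R′ ℕ.+ g ℕ.* N′ ℕ.+ g     ≡⟨ ℕₚ.+-assoc R′ (g ℕ.* N′) g ⟩
    R′ ℕ.+ (g ℕ.* N′ ℕ.+ g)   ≡⟨ cong (R′ ℕ.+_) (trans (ℕₚ.+-comm (g ℕ.* N′) g) (sym (ℕₚ.*-suc g N′))) ⟩
    R′ ℕ.+ g ℕ.* suc N′       ≤⟨ ℕₚ.+-mono-≤ (ℕ÷./-monoˡ-≤ S (total-resolve remaining (λ _ → refl) c s)) (ℕₚ.*-monoʳ-≤ g (pending-drop ok is-solo)) ⟩
    H s                       ∎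
    where
    open ℕₚ.≤-Reasoning
    R′ = total remaining (resolve c s) ℕ./ S
    N′ = total pending (resolve c s)

  lookup-resolve : ∀ {k} (c : Subset k) s u →
    Vec.lookup (resolve c s) u ≡ (if solo c then acknowledge (Vec.lookup c u) (Vec.lookup s u) else Vec.lookup s u)
  lookup-resolve c s u with solo c
  ... | true  = Vecₚ.lookup-zipWith acknowledge u c s
  ... | false = refl

  data Activated : Status → Set where
    active : ∀ {r} → Activated (active r)
    off    : ∀ {r} → Activated (off r)

  every-activated : ∀ {k} (s : Vec Status k) → T (every activated s) → All Activated s
  every-activated []             _ = []
  every-activated (active r ∷ s) t = active ∷ every-activated s t
  every-activated (off r ∷ s)    t = off ∷ every-activated s t

  -- A station that must have switched off or failed after n more rounds.
  data Old (n : ℕ) : Status → Set where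
    active : ∀ {r} → L ≤ r ℕ.+ n → Old n (active r)
    off    : ∀ {r} → Old n (off r)

  Old-advance : ∀ {n k} (a : Subset k) {s} → All (Old (suc n)) s → All (Old n) (advance a s)
  Old-advance     []          []                    = []
  Old-advance {n} (true ∷ a)  (active {r} L≤ ∷ old) = active (subst (L ≤_) (ℕₚ.+-suc r n) L≤) ∷ Old-advance a old
  Old-advance {n} (false ∷ a) (active {r} L≤ ∷ old) = active (subst (L ≤_) (ℕₚ.+-suc r n) L≤) ∷ Old-advance a old
  Old-advance     (true ∷ a)  (off ∷ old)           = off ∷ Old-advance a old
  Old-advance     (false ∷ a) (off ∷ old)           = off ∷ Old-advance a old

  Old-step : ∀ {n k} (c a : Subset k) {s} → All (Old (suc n)) s → All (Old n) (resolve c (advance a s))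
  Old-step {n} c a {s} old with solo c
  ... | true  = acknowledged c (Old-advance a old)
    where
    acknowledged : ∀ {k} (c : Subset k) {s} → All (Old n) s → All (Old n) (Vec.zipWith acknowledge c s)
    acknowledged []          []                = []
    acknowledged (true ∷ c)  (active _ ∷ old)  = off ∷ acknowledged c old
    acknowledged (true ∷ c)  (off ∷ old)       = off ∷ acknowledged c old
    acknowledged (false ∷ c) (x ∷ old)         = x ∷ acknowledged c old
  ... | false = Old-advance a old

-- The rational process and its supermartingale.

module Model (p : ℕ → ℚ) (p-valid : ∀ r → 0ℚ ≤ℚ p r × p r ≤ℚ Coins.¾) where

  open Coins
  open Rounds

  transmit : Status → ℚ
  transmit (active (suc r)) = p r
  transmit _                = 0ℚ

  coins : ∀ {k} → Vec Status k → Vec ℚ k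
  coins = Vec.map transmit

  coins-valid : ∀ {k} (s : Vec Status k) → Valid (coins s)
  coins-valid []      = []
  coins-valid (x ∷ s) = valid x ∷ coins-valid s
    where
    0-valid : 0ℚ ≤ℚ 0ℚ × 0ℚ ≤ℚ ¾
    0-valid = ℚₚ.≤-refl , ℚₚ.nonNegative⁻¹ ¾
    valid : ∀ x → 0ℚ ≤ℚ transmit x × transmit x ≤ℚ ¾
    valid asleep           = 0-valid
    valid (active zero)    = 0-valid
    valid (active (suc r)) = p-valid r
    valid (off r)          = 0-valid

  -- The comparison is required for possible outcomes only, since all others carry a factor 0. This
  -- makes `H-solo` applicable under the expectation.
  𝔼-mono : ∀ {k} (s : Vec Status k) {f g : Subset k → ℚ} → (∀ c → Possible c s → f c ≤ℚ g c) → 𝔼 (coins s) f ≤ℚ 𝔼 (coins s) g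
  𝔼-mono [] f≤g = f≤g [] []
  𝔼-mono (x ∷ s) {f} {g} f≤g = ℚₚ.+-mono-≤ (true-part x f≤g)
      (*-monoˡ {1ℚ - transmit x} 0≤1-p (𝔼-mono s (λ c ok → f≤g (false ∷ c) (listen ok))))
    where
    px≤1 : transmit x ≤ℚ 1ℚ
    px≤1 = ℚₚ.≤-trans (proj₂ (All.head (coins-valid (x ∷ s)))) (≤-by {¾} {1ℚ} (½ * ½) (ℚₚ.nonNegative⁻¹ (½ * ½)) refl)
    0≤1-p = diff≥0 px≤1
    zero-part : 0ℚ * 𝔼 (coins s) (λ c → f (true ∷ c)) ≤ℚ 0ℚ * 𝔼 (coins s) (λ c → g (true ∷ c))
    zero-part = ℚₚ.≤-reflexive (trans (ℚₚ.*-zeroˡ (𝔼 (coins s) (λ c → f (true ∷ c)))) (sym (ℚₚ.*-zeroˡ (𝔼 (coins s) (λ c → g (true ∷ c))))))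
    true-part : ∀ x → (∀ c → Possible c (x ∷ s) → f c ≤ℚ g c) →
      transmit x * 𝔼 (coins s) (λ c → f (true ∷ c)) ≤ℚ transmit x * 𝔼 (coins s) (λ c → g (true ∷ c))
    true-part asleep           f≤g = zero-part
    true-part (active zero)    f≤g = zero-part
    true-part (active (suc r)) f≤g = *-monoˡ {p r} (proj₁ (p-valid r)) (𝔼-mono s (λ c ok → f≤g (true ∷ c) (send ok)))
    true-part (off r)          f≤g = zero-part

  prob : ∀ {k} → Adversary k → ℕ → History k → Vec Status k → Event k → ℚ
  prob A zero    h s E = ⟦ E s ⟧
  prob A (suc n) h s E = 𝔼 (coins (advance (A h) s)) (λ c → prob A n (c ∷ h) (resolve c (advance (A h) s)) E)

  prob-nn : ∀ {k} (A : Adversary k) n h s E → 0ℚ ≤ℚ prob A n h s E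
  prob-nn A zero    h s E = ⟦⟧-nn (E s)
  prob-nn A (suc n) h s E = 𝔼-nn (coins-valid (advance (A h) s)) (λ c → prob-nn A n (c ∷ h) (resolve c (advance (A h) s)) E)

  prob≤1 : ∀ {k} (A : Adversary k) n h s E → prob A n h s E ≤ℚ 1ℚ
  prob≤1 A zero    h s E = ⟦⟧≤1 (E s)
  prob≤1 A (suc n) h s E = subst (prob A (suc n) h s E ≤ℚ_) (𝔼-const (coins s′) 1ℚ)
    (𝔼-mono s′ (λ c _ → prob≤1 A n (c ∷ h) (resolve c s′) E))
    where s′ = advance (A h) s

  module Potential
    (w q : ℚ) (0<w : 0ℚ < w) (0≤q : 0ℚ ≤ℚ q) (w+q≡1 : w + q ≡ 1ℚ) (L : ℕ) (p-low : ∀ r → r ℕ.< L → ofℕ 2 * q ≤ℚ p r)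
    (mass : ℕ → ℕ) (κ : ℚ) (0≤κ : 0ℚ ≤ℚ κ) (p≤mass : ∀ r → r ℕ.< L → p r ≤ℚ κ * ofℕ (mass r))
    (μ S : ℕ) .{{_ : NonZero S}} (κS≤ : κ * ofℕ S ≤ℚ ½ * ofℕ μ)
    (g : ℕ) (gq≤1 : ofℕ g * q ≤ℚ 1ℚ) (g≡ : ofℕ g * ⅛ ^ μ ≡ ofℕ 4)
    where

    open CauchyLemmas using (^-nn)
    open Population mass L S g
    open Powers

    open ℚₚ.≤-Reasoning

    z : ℚ
    z = inv w

    wz≡1 : w * z ≡ 1ℚ
    wz≡1 = inv-*ʳ 0<w

    0≤w = ℚₚ.<⇒≤ 0<w

    w≤1 : w ≤ℚ 1ℚ
    w≤1 = ≤-by q 0≤q w+q≡1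

    0≤z : 0ℚ ≤ℚ z
    0≤z = ℚₚ.<⇒≤ (inv-pos 0<w)

    1≤z : 1ℚ ≤ℚ z
    1≤z = inv-anti 0<w w≤1

    w^z^ : ∀ n → w ^ n * z ^ n ≡ 1ℚ
    w^z^ = ^-inverse {w} {z} wz≡1

    -- This is w^(L - n), written with the inverse `z` because `n` may exceed `L`.
    weight : ℕ → ℚ
    weight n = w ^ L * z ^ n

    weight-nn : ∀ n → 0ℚ ≤ℚ weight n
    weight-nn n = *-nn (^-nn 0≤w L) (^-nn 0≤z n)

    weight-mono : ∀ {m n} → m ≤ n → weight m ≤ℚ weight n
    weight-mono {m} {n} m≤n = *-monoˡ {w ^ L} (^-nn 0≤w L) (^-monoʳ 1≤z m≤n)

    weight-+ : ∀ m n → weight n ≡ w ^ m * weight (m ℕ.+ n)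
    weight-+ m n = begin-equality
      w ^ L * z ^ n                       ≡⟨ ℚₚ.*-identityˡ (w ^ L * z ^ n) ⟨
      1ℚ * (w ^ L * z ^ n)                ≡⟨ cong (_* (w ^ L * z ^ n)) (w^z^ m) ⟨
      w ^ m * z ^ m * (w ^ L * z ^ n)     ≡⟨ solve 4 (λ a b c d → a :* b :* (c :* d) := a :* (c :* (b :* d))) refl (w ^ m) (z ^ m) (w ^ L) (z ^ n) ⟩
      w ^ m * (w ^ L * (z ^ m * z ^ n))   ≡⟨ cong (λ x → w ^ m * (w ^ L * x)) (^-homo-* z m n) ⟨
      w ^ m * weight (m ℕ.+ n)            ∎

    -- A sleeping station has age 0, so its activation does not change the value. A late success
    -- counts 1 like any failure, so that the sum over stations stays at least 1 after a failure.
    φ : ℕ → Status → ℚ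
    φ h asleep     = weight h
    φ h (active r) = weight (h ℕ.+ r)
    φ h (off r)    = if r ℕ.≤ᵇ L then 0ℚ else 1ℚ

    φ-nn : ∀ h x → 0ℚ ≤ℚ φ h x
    φ-nn h asleep     = weight-nn h
    φ-nn h (active r) = weight-nn (h ℕ.+ r)
    φ-nn h (off r)    = nonneg (r ℕ.≤ᵇ L)
      where
      nonneg : ∀ b → 0ℚ ≤ℚ (if b then 0ℚ else 1ℚ)
      nonneg true  = ℚₚ.≤-refl
      nonneg false = 0≤1

    φ-off : ∀ h {r} → r ≤ L → φ h (off r) ≡ 0ℚ
    φ-off h r≤L = cong (λ b → if b then 0ℚ else 1ℚ) (T⇒≡true (ℕₚ.≤⇒≤ᵇ r≤L))

    φ-failed : ∀ h {x} → Failed x → 1ℚ ≤ℚ φ h x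
    φ-failed h (active {r} L≤r) = subst (_≤ℚ weight (h ℕ.+ r)) (w^z^ L) (weight-mono (ℕₚ.≤-trans L≤r (ℕₚ.m≤n+m r h)))
    φ-failed h (off {r} L<r)    = late (r ℕ.≤ᵇ L) (λ t → ℕₚ.<⇒≱ L<r (ℕₚ.≤ᵇ⇒≤ r L t))
      where
      late : ∀ b → (T b → ⊥) → 1ℚ ≤ℚ (if b then 0ℚ else 1ℚ)
      late true  ¬t = ⊥-elim (¬t tt)
      late false _  = ℚₚ.≤-refl

    G : ∀ {k} → Vec Status k → ℚ
    G {k} s = ΣFin k (λ u → φ (H s) (Vec.lookup s u))

    G-nn : ∀ {k} (s : Vec Status k) → 0ℚ ≤ℚ G s
    G-nn {k} s = ΣFin-nn k (λ u → φ-nn (H s) (Vec.lookup s u))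

    G-failed : ∀ {k} (s : Vec Status k) u → Failed (Vec.lookup s u) → 1ℚ ≤ℚ G s
    G-failed {k} s u failed = ℚₚ.≤-trans (φ-failed (H s) failed) (term≤ΣFin k (λ u → φ-nn (H s) (Vec.lookup s u)) u)

    sum-coins : ∀ {k} (a : Subset k) {s} → All Timely s → sumᵛ (coins (advance a s)) ≤ℚ κ * ofℕ (total emitted (advance a s))
    sum-coins []      []         = ℚₚ.≤-reflexive (sym (ℚₚ.*-zeroʳ κ))
    sum-coins (b ∷ a) (_∷_ {x = x} {xs = s} ok all) = begin
      transmit (nextRound b x) + sumᵛ (coins (advance a s))
        ≤⟨ ℚₚ.+-mono-≤ (step b ok) (sum-coins a all) ⟩
      κ * ofℕ (emitted (nextRound b x)) + κ * ofℕ (total emitted (advance a s))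
        ≡⟨ ℚₚ.*-distribˡ-+ κ (ofℕ (emitted (nextRound b x))) (ofℕ (total emitted (advance a s))) ⟨
      κ * (ofℕ (emitted (nextRound b x)) + ofℕ (total emitted (advance a s)))
        ≡⟨ cong (λ y → κ * y) (ofℕ-+ (emitted (nextRound b x)) (total emitted (advance a s))) ⟨
      κ * ofℕ (emitted (nextRound b x) ℕ.+ total emitted (advance a s)) ∎
      where
      step : ∀ b {x} → Timely x → transmit (nextRound b x) ≤ℚ κ * ofℕ (emitted (nextRound b x))
      step true  asleep           = ℚₚ.≤-reflexive (sym (ℚₚ.*-zeroʳ κ))
      step false asleep           = ℚₚ.≤-reflexive (sym (ℚₚ.*-zeroʳ κ))
      step true  (active {r} r<L) = p≤mass r r<L
      step false (active {r} r<L) = p≤mass r r<L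
      step true  (off _)          = ℚₚ.≤-reflexive (sym (ℚₚ.*-zeroʳ κ))
      step false (off _)          = ℚₚ.≤-reflexive (sym (ℚₚ.*-zeroʳ κ))

    w≡ : w ≡ 1ℚ - q
    w≡ = trans (solve 2 (λ w q → w := w :+ q :- q) refl w q) (cong (_- q) w+q≡1)

    -- With x = g q, Bernoulli gives w^g ≤ 1 / (1 + x), and 1 - 1 / (1 + x) ≥ x / 2 for x ≤ 1; the
    -- two are combined without division.
    half-gq : ½ * (ofℕ g * q) ≤ℚ 1ℚ - w ^ g
    half-gq = *-cancel {r = ofℕ 2} (0<ofℕ 2) (≤-by ((1ℚ - W * (1ℚ + x)) + (1ℚ - W) * (1ℚ - x))
        (+-nn (diff≥0 (bernoulli⁻ 0≤w 0≤q w+q≡1 g)) (*-nn (diff≥0 (^≤1 0≤w w≤1 g)) (diff≥0 gq≤1)))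
        (solve 2 (λ W x → con ½ :* x :* con (ofℕ 2) :+ ((con 1ℚ :- W :* (con 1ℚ :+ x)) :+ (con 1ℚ :- W) :* (con 1ℚ :- x)) := (con 1ℚ :- W) :* con (ofℕ 2)) refl W x))
      where
      W = w ^ g
      x = ofℕ g * q

    module Step {k} (a : Subset k) {s : Vec Status k} (ok : All Timely s) where

      s′ = advance a s
      ps = coins s′

      Φ : Fin k → Subset k → ℚ
      Φ u c = φ (H (resolve c s′)) (Vec.lookup (resolve c s′) u)

      lookup-advance : ∀ u → Vec.lookup s′ u ≡ nextRound (Vec.lookup a u) (Vec.lookup s u)
      lookup-advance u = Vecₚ.lookup-zipWith nextRound u a s

      step-off : ∀ u r → Vec.lookup s u ≡ off r → 𝔼 ps (Φ u) ≤ℚ φ (H s) (off r)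
      step-off u r eq = ℚₚ.≤-reflexive (trans (𝔼-cong ps (λ c → cong (φ (H (resolve c s′))) (stays c))) (𝔼-const ps (φ (H s) (off r))))
        where
        next : ∀ b → nextRound b (off r) ≡ off r
        next true  = refl
        next false = refl
        ack : ∀ b → acknowledge b (off r) ≡ off r
        ack true  = refl
        ack false = refl
        stays : ∀ c → Vec.lookup (resolve c s′) u ≡ off r
        stays c = trans (lookup-resolve c s′ u) (trans
          (cong (λ x → if solo c then acknowledge (Vec.lookup c u) x else x)
            (trans (lookup-advance u) (trans (cong (nextRound (Vec.lookup a u)) eq) (next (Vec.lookup a u)))))
          (trans (cong (λ x → if solo c then x else off r) (ack (Vec.lookup c u))) (Boolₚ.if-eta (solo c))))

      step-asleep : ∀ u → Vec.lookup s u ≡ asleep → 𝔼 ps (Φ u) ≤ℚ weight (H s)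
      step-asleep u eq = subst (𝔼 ps (Φ u) ≤ℚ_) (𝔼-const ps (weight (H s))) (𝔼-mono s′ (λ c _ → bound c))
        where
        H≤ : ∀ c → H (resolve c s′) ≤ H s
        H≤ c = ℕₚ.≤-trans (H-resolve c s′) (H-advance a ok)
        young : ∀ b b′ b″ → let x = nextRound b asleep in ∀ {h} → h ≤ H s → φ h (if b″ then acknowledge b′ x else x) ≤ℚ weight (H s)
        young true  true  true  {h} h≤ = weight-nn (H s)
        young true  false true  {h} h≤ = weight-mono (ℕₚ.≤-trans (ℕₚ.≤-reflexive (ℕₚ.+-identityʳ h)) h≤)
        young true  _     false {h} h≤ = weight-mono (ℕₚ.≤-trans (ℕₚ.≤-reflexive (ℕₚ.+-identityʳ h)) h≤)
        young false true  true  h≤ = weight-mono h≤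
        young false false true  h≤ = weight-mono h≤
        young false _     false h≤ = weight-mono h≤
        bound : ∀ c → Φ u c ≤ℚ weight (H s)
        bound c = subst (λ x → φ (H (resolve c s′)) x ≤ℚ weight (H s))
          (sym (trans (lookup-resolve c s′ u) (cong (λ x → if solo c then acknowledge (Vec.lookup c u) x else x)
            (trans (lookup-advance u) (cong (nextRound (Vec.lookup a u)) eq)))))
          (young (Vec.lookup a u) (Vec.lookup c u) (solo c) (H≤ c))

      module Active (u : Fin k) (r : ℕ) (eq : Vec.lookup s u ≡ active r) (r<L : r ℕ.< L) where

        -- The value when the station stays on and the round's outcome leaves `H` as it is: at most
        -- 1 / w times the value before the round.
        K = weight (H s′ ℕ.+ suc r)

        x′≡ : Vec.lookup s′ u ≡ active (suc r)
        x′≡ = trans (lookup-advance u) (trans (cong (nextRound (Vec.lookup a u)) eq) (next (Vec.lookup a u)))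
          where
          next : ∀ b → nextRound b (active r) ≡ active (suc r)
          next true  = refl
          next false = refl

        wK≤ : w * K ≤ℚ weight (H s ℕ.+ r)
        wK≤ = begin
          w * K                          ≡⟨ cong₂ _*_ (ℚₚ.*-identityʳ w) (cong weight (sym (ℕₚ.+-suc (H s′) r))) ⟨
          w ^ 1 * weight (1 ℕ.+ (H s′ ℕ.+ r)) ≡⟨ weight-+ 1 (H s′ ℕ.+ r) ⟨
          weight (H s′ ℕ.+ r)            ≤⟨ weight-mono (ℕₚ.+-monoˡ-≤ r (H-advance a ok)) ⟩
          weight (H s ℕ.+ r)             ∎

        resolved : ∀ c → Vec.lookup (resolve c s′) u ≡ (if solo c then acknowledge (Vec.lookup c u) (active (suc r)) else active (suc r))
        resolved c = trans (lookup-resolve c s′ u) (cong (λ x → if solo c then acknowledge (Vec.lookup c u) x else x) x′≡)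

        Φ-≤ : ∀ c {h} → H (resolve c s′) ≤ h → Φ u c ≤ℚ weight (h ℕ.+ suc r)
        Φ-≤ c {h} H≤h = subst (λ x → φ (H (resolve c s′)) x ≤ℚ weight (h ℕ.+ suc r)) (sym (resolved c)) (cases (solo c) (Vec.lookup c u))
          where
          succeeded : ∀ {h′} → φ h′ (off (suc r)) ≤ℚ weight (h ℕ.+ suc r)
          succeeded {h′} = subst (_≤ℚ weight (h ℕ.+ suc r)) (sym (φ-off h′ r<L)) (weight-nn (h ℕ.+ suc r))
          cases : ∀ b b′ → φ (H (resolve c s′)) (if b then acknowledge b′ (active (suc r)) else active (suc r)) ≤ℚ weight (h ℕ.+ suc r)
          cases true  true  = succeeded {H (resolve c s′)}
          cases true  false = weight-mono (ℕₚ.+-monoˡ-≤ (suc r) H≤h)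
          cases false _     = weight-mono (ℕₚ.+-monoˡ-≤ (suc r) H≤h)

        Φ-success : ∀ c → T (Vec.lookup c u ∧ solo c) → Φ u c ≡ 0ℚ
        Φ-success c success = trans (cong (φ (H (resolve c s′))) (trans (resolved c) (switched-off (Vec.lookup c u) (solo c) success)))
          (φ-off (H (resolve c s′)) r<L)
          where
          switched-off : ∀ b b′ → T (b ∧ b′) → (if b′ then acknowledge b (active (suc r)) else active (suc r)) ≡ off (suc r)
          switched-off true true _ = refl

        -- The drop of `H` by 1 pays for the ageing in every outcome; no chance of success enters.
        crowded : S ≤ total emitted s′ → 𝔼 ps (Φ u) ≤ℚ weight (H s ℕ.+ r)
        crowded S≤ = subst (𝔼 ps (Φ u) ≤ℚ_) (𝔼-const ps (weight (H s ℕ.+ r))) (𝔼-mono s′ (λ c _ → ℚₚ.≤-trans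
          (Φ-≤ c (H-resolve c s′))
          (weight-mono (ℕₚ.≤-trans (ℕₚ.≤-reflexive (ℕₚ.+-suc (H s′) r)) (ℕₚ.+-monoˡ-≤ r (H-advance-crowded a ok S≤))))))

        -- Common to the other two cases: on the event `f` the value falls by the relative gain `y`,
        -- and an expected relative gain of at least `q` makes up for the factor 1 / w of ageing.
        decrease : ∀ y (f : Subset k → ℚ) → 0ℚ ≤ℚ y → (∀ c → Possible c s′ → Φ u c ≤ℚ K + (- (K * y)) * f c) → q ≤ℚ y * 𝔼 ps f →
          𝔼 ps (Φ u) ≤ℚ weight (H s ℕ.+ r)
        decrease y f 0≤y Φ≤ q≤ = begin
          𝔼 ps (Φ u)                              ≤⟨ 𝔼-mono s′ Φ≤ ⟩
          𝔼 ps (λ c → K + (- (K * y)) * f c)      ≡⟨ 𝔼-affine ps K (- (K * y)) f ⟩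
          K + (- (K * y)) * 𝔼 ps f                ≤⟨ ≤-by (K * (y * 𝔼 ps f - q)) (*-nn (weight-nn (H s′ ℕ.+ suc r)) (diff≥0 q≤))
                                                       (solve 4 (λ K y e q → K :+ (:- (K :* y)) :* e :+ K :* (y :* e :- q) := (con 1ℚ :- q) :* K) refl K y (𝔼 ps f) q) ⟩
          (1ℚ - q) * K                            ≡⟨ cong (_* K) w≡ ⟨
          w * K                                   ≤⟨ wK≤ ⟩
          weight (H s ℕ.+ r)                      ∎

        -- The event is that `u` transmits alone, which removes the whole value. Silence has chance
        -- at least ½, and the 2 in `p-low` compensates for it.
        calm : sumᵛ ps ≤ℚ ½ → 𝔼 ps (Φ u) ≤ℚ weight (H s ℕ.+ r)
        calm sum≤½ = decrease 1ℚ (λ c → ⟦ Vec.lookup c u ∧ solo c ⟧) 0≤1 (λ c _ → pointwise (Vec.lookup c u ∧ solo c) (Φ-≤ c (H-resolve c s′)) (Φ-success c)) (begin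
            q                                       ≡⟨ solve 1 (λ q → q := con (ofℕ 2) :* q :* con ½) refl q ⟩
            ofℕ 2 * q * ½                           ≤⟨ *-mono {ofℕ 2 * q} {Vec.lookup ps u} {½} {silence ps} (*-nn (0≤ofℕ 2) 0≤q) (silence-nn (coins-valid s′)) low silent ⟩
            Vec.lookup ps u * silence ps            ≤⟨ 𝔼-only-≥ (coins-valid s′) u ⟩
            𝔼 ps (λ c → ⟦ Vec.lookup c u ∧ solo c ⟧) ≡⟨ ℚₚ.*-identityˡ (𝔼 ps (λ c → ⟦ Vec.lookup c u ∧ solo c ⟧)) ⟨
            1ℚ * 𝔼 ps (λ c → ⟦ Vec.lookup c u ∧ solo c ⟧) ∎)
          where
          low : ofℕ 2 * q ≤ℚ Vec.lookup ps u
          low = subst (ofℕ 2 * q ≤ℚ_) (sym (trans (Vecₚ.lookup-map u transmit s′) (cong transmit x′≡))) (p-low r r<L)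
          silent : ½ ≤ℚ silence ps
          silent = ℚₚ.≤-trans (≤-by {½} (½ - sumᵛ ps) (diff≥0 sum≤½) (solve 1 (λ s → con ½ :+ (con ½ :- s) := con 1ℚ :- s) refl (sumᵛ ps)))
            (1-sum≤silence (coins-valid s′))
          pointwise : ∀ b {x} → x ≤ℚ K → (T b → x ≡ 0ℚ) → x ≤ℚ K + (- (K * 1ℚ)) * ⟦ b ⟧
          pointwise true  x≤K ≡0 = ℚₚ.≤-reflexive (trans (≡0 tt) (solve 1 (λ K → con 0ℚ := K :+ (:- (K :* con 1ℚ)) :* con 1ℚ) refl K))
          pointwise false x≤K ≡0 = ℚₚ.≤-trans x≤K (ℚₚ.≤-reflexive (solve 1 (λ K → K := K :+ (:- (K :* con 1ℚ)) :* con 0ℚ) refl K))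

        -- The event is any success at all: it takes `g` off `H`, a relative gain 1 - w^g ≥ g q / 2,
        -- even when another station is the one that succeeds. Its chance is at least ½ ⅛^μ = 2 / g
        -- by `g≡`, and the product of the two bounds is `q`.
        busy : total emitted s′ ℕ.< S → ½ ≤ℚ sumᵛ ps → 𝔼 ps (Φ u) ≤ℚ weight (H s ℕ.+ r)
        busy emitted<S ½≤sum = decrease (1ℚ - w ^ g) (λ c → ⟦ solo c ⟧) 0≤1-w^g (λ c possible → pointwise c possible) (begin
            q                                       ≡⟨ solve 1 (λ q → q := con (½ * ½) :* con (ofℕ 4) :* q) refl q ⟩
            ½ * ½ * ofℕ 4 * q                       ≡⟨ cong (λ x → ½ * ½ * x * q) g≡ ⟨
            ½ * ½ * (ofℕ g * ⅛ ^ μ) * q             ≡⟨ solve 3 (λ g e q → con (½ * ½) :* (g :* e) :* q := con ½ :* (g :* q) :* (con ½ :* e)) refl (ofℕ g) (⅛ ^ μ) q ⟩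
            ½ * (ofℕ g * q) * (½ * ⅛ ^ μ)           ≤⟨ *-mono {½ * (ofℕ g * q)} {1ℚ - w ^ g} {½ * ⅛ ^ μ} {𝔼 ps (λ c → ⟦ solo c ⟧)}
                                                         (*-nn (ℚₚ.<⇒≤ 0<½) (*-nn (0≤ofℕ g) 0≤q)) (𝔼-nn (coins-valid s′) (λ c → ⟦⟧-nn (solo c))) half-gq solo≥ ⟩
            (1ℚ - w ^ g) * 𝔼 ps (λ c → ⟦ solo c ⟧)  ∎)
          where
          0≤1-w^g : 0ℚ ≤ℚ 1ℚ - w ^ g
          0≤1-w^g = diff≥0 (^≤1 0≤w w≤1 g)
          sum≤ : sumᵛ ps ≤ℚ ½ * ofℕ μ
          sum≤ = ℚₚ.≤-trans (sum-coins a ok) (ℚₚ.≤-trans (*-monoˡ {κ} 0≤κ (ofℕ-mono (ℕₚ.<⇒≤ emitted<S))) κS≤)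
          solo≥ : ½ * ⅛ ^ μ ≤ℚ 𝔼 ps (λ c → ⟦ solo c ⟧)
          solo≥ = ℚₚ.≤-trans (*-mono {½} {sumᵛ ps} {⅛ ^ μ} {silence ps} (ℚₚ.<⇒≤ 0<½) (silence-nn (coins-valid s′)) ½≤sum (silence-≥ (coins-valid s′) μ sum≤))
            (𝔼-solo-≥ (coins-valid s′))
          pointwise : ∀ c → Possible c s′ → Φ u c ≤ℚ K + (- (K * (1ℚ - w ^ g))) * ⟦ solo c ⟧
          pointwise c possible = cases (solo c) (λ is-solo → H-solo possible is-solo)
            where
            cases : ∀ b → (T b → g ℕ.+ H (resolve c s′) ≤ H s′) → Φ u c ≤ℚ K + (- (K * (1ℚ - w ^ g))) * ⟦ b ⟧
            cases false _ = ℚₚ.≤-trans (Φ-≤ c (H-resolve c s′)) (ℚₚ.≤-reflexive (solve 2 (λ K y → K := K :+ (:- (K :* y)) :* con 0ℚ) refl K (1ℚ - w ^ g)))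
            cases true g+H≤ = begin
              Φ u c                                          ≤⟨ Φ-≤ c ℕₚ.≤-refl ⟩
              weight (H (resolve c s′) ℕ.+ suc r)            ≡⟨ weight-+ g (H (resolve c s′) ℕ.+ suc r) ⟩
              w ^ g * weight (g ℕ.+ (H (resolve c s′) ℕ.+ suc r)) ≤⟨ *-monoˡ {w ^ g} (^-nn 0≤w g) (weight-mono (ℕₚ.≤-trans (ℕₚ.≤-reflexive (sym (ℕₚ.+-assoc g (H (resolve c s′)) (suc r)))) (ℕₚ.+-monoˡ-≤ (suc r) (g+H≤ tt)))) ⟩
              w ^ g * K                                      ≡⟨ solve 2 (λ W K → W :* K := K :+ (:- (K :* (con 1ℚ :- W))) :* con 1ℚ) refl (w ^ g) K ⟩
              K + (- (K * (1ℚ - w ^ g))) * 1ℚ                ∎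

        step-active : 𝔼 ps (Φ u) ≤ℚ weight (H s ℕ.+ r)
        step-active = cases (ℕₚ.<-≤-connex (total emitted s′) S) (ℚₚ.≤-total (sumᵛ ps) ½)
          where
          cases : total emitted s′ ℕ.< S ⊎ S ≤ total emitted s′ → sumᵛ ps ≤ℚ ½ ⊎ ½ ≤ℚ sumᵛ ps → 𝔼 ps (Φ u) ≤ℚ weight (H s ℕ.+ r)
          cases (inj₂ S≤) _            = crowded S≤
          cases (inj₁ <S) (inj₁ sum≤½) = calm sum≤½
          cases (inj₁ <S) (inj₂ ½≤sum) = busy <S ½≤sum

      step : ∀ u → 𝔼 ps (Φ u) ≤ℚ φ (H s) (Vec.lookup s u)
      step u = cases (Vec.lookup s u) refl (Allₚ.lookup⁺ ok u)
        where
        cases : ∀ x → Vec.lookup s u ≡ x → Timely x → 𝔼 ps (Φ u) ≤ℚ φ (H s) x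
        cases asleep     eq _            = step-asleep u eq
        cases (active r) eq (active r<L) = Active.step-active u r eq r<L
        cases (off r)    eq _            = step-off u r eq

      -- By linearity the stations may be treated one at a time, however strongly the coins and the
      -- adversary couple them.
      supermartingale : 𝔼 ps (λ c → G (resolve c s′)) ≤ℚ G s
      supermartingale = subst (_≤ℚ G s) (sym (𝔼-ΣFin ps k Φ)) (ΣFin-mono k step)

    module _ {k} (A : Adversary k) (L′ : ℕ) (L≤L′ : L ≤ L′) where

      E : Event k
      E = every (succeededWithin L′)

      finished : ∀ {k} (s : Vec Status k) → All (Old 0) s → All Timely s → ⟦ every (succeededWithin L′) s ⟧ ≡ 1ℚ
      finished []      []                      []               = refl
      finished (_ ∷ s) (active {r} L≤ ∷ _)     (active r<L ∷ _) = ⊥-elim (ℕₚ.<⇒≱ r<L (subst (L ≤_) (ℕₚ.+-identityʳ r) L≤))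
      finished (off r ∷ s) (off ∷ old) (off r≤L ∷ timely) =
        trans (cong (λ b → ⟦ b ∧ every (succeededWithin L′) s ⟧) (T⇒≡true (ℕₚ.≤⇒≤ᵇ (ℕₚ.≤-trans r≤L L≤L′)))) (finished s old timely)

      private
        below-0 : ∀ {x y z} → x ≤ℚ 1ℚ → 1ℚ ≤ℚ y → 0ℚ ≤ℚ z → x - y ≤ℚ z
        below-0 {x} {y} {z} x≤1 1≤y 0≤z = ≤-by ((1ℚ - x) + (y - 1ℚ) + z) (+-nn (+-nn (diff≥0 x≤1) (diff≥0 1≤y)) 0≤z)
          (solve 3 (λ x y z → x :- y :+ ((con 1ℚ :- x) :+ (y :- con 1ℚ) :+ z) := z) refl x y z)

        one-step : ∀ h {s} → All Timely s → ∀ (f f′ : Subset k → ℚ) → let s′ = advance (A h) s in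
          (∀ c → f c - G (resolve c s′) ≤ℚ f′ c) → 𝔼 (coins s′) f - G s ≤ℚ 𝔼 (coins s′) f′
        one-step h {s} ok f f′ f≤f′ = begin
          𝔼 ps f - G s                                     ≤⟨ ℚₚ.+-monoʳ-≤ (𝔼 ps f) (ℚₚ.neg-antimono-≤ (Step.supermartingale (A h) ok)) ⟩
          𝔼 ps f - 𝔼 ps (λ c → G (resolve c s′))           ≡⟨ solve 2 (λ x y → x :- y := x :+ con (- 1ℚ) :* y) refl (𝔼 ps f) (𝔼 ps (λ c → G (resolve c s′))) ⟩
          𝔼 ps f + - 1ℚ * 𝔼 ps (λ c → G (resolve c s′))    ≡⟨ cong (λ x → 𝔼 ps f + x) (𝔼-* ps (- 1ℚ) (λ c → G (resolve c s′))) ⟨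
          𝔼 ps f + 𝔼 ps (λ c → - 1ℚ * G (resolve c s′))    ≡⟨ 𝔼-+ ps f (λ c → - 1ℚ * G (resolve c s′)) ⟨
          𝔼 ps (λ c → f c + - 1ℚ * G (resolve c s′))       ≤⟨ 𝔼-mono s′ (λ c _ → subst (_≤ℚ f′ c)
                                                                (solve 2 (λ x y → x :- y := x :+ con (- 1ℚ) :* y) refl (f c) (G (resolve c s′))) (f≤f′ c)) ⟩
          𝔼 ps f′                                          ∎
          where
          s′ = advance (A h) s
          ps = coins s′

      -- Backward induction over the remaining rounds takes the place of a stopping time: after a
      -- failure `G s ≥ 1` and the bound is vacuous, so the supermartingale step is applied only
      -- while all stations are timely.
      finish : ∀ n h s → All (Old n) s → 1ℚ - G s ≤ℚ prob A n h s E
      finish-timely : ∀ n h s → All (Old n) s → All Timely s → 1ℚ - G s ≤ℚ prob A n h s E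

      finish n h s old = cases (timely? s)
        where
        cases : All Timely s ⊎ ∃[ u ] Failed (Vec.lookup s u) → 1ℚ - G s ≤ℚ prob A n h s E
        cases (inj₁ timely)       = finish-timely n h s old timely
        cases (inj₂ (u , failed)) = below-0 ℚₚ.≤-refl (G-failed s u failed) (prob-nn A n h s E)

      finish-timely zero    h s old timely = ≤-by (G s) (G-nn s)
        (trans (solve 1 (λ g → con 1ℚ :- g :+ g := con 1ℚ) refl (G s)) (sym (finished s old timely)))
      finish-timely (suc n) h s old timely = subst (λ x → x - G s ≤ℚ prob A (suc n) h s E) (𝔼-const (coins (advance (A h) s)) 1ℚ)
        (one-step h timely (λ _ → 1ℚ) _ (λ c → finish n (c ∷ h) (resolve c (advance (A h) s)) (Old-step c (A h) old)))

      -- The same induction, carrying the probability of full activation in place of 1. Once all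
      -- stations are activated, `L` further rounds bring each of them to age `L` or switch it off.
      activation-then-finish : ∀ n h s → prob A n h s (every activated) - G s ≤ℚ prob A (n ℕ.+ L) h s E
      activation-then-finish zero h s = cases (every activated s) (λ t → finish L h s (All.map old (every-activated s t)))
        where
        old : ∀ {x} → Activated x → Old L x
        old (active {r}) = active (ℕₚ.m≤n+m L r)
        old off          = off
        cases : ∀ b → (T b → 1ℚ - G s ≤ℚ prob A L h s E) → ⟦ b ⟧ - G s ≤ℚ prob A L h s E
        cases true  bound = bound tt
        cases false _     = ≤-by (G s + prob A L h s E) (+-nn (G-nn s) (prob-nn A L h s E))
          (solve 2 (λ g p → con 0ℚ :- g :+ (g :+ p) := p) refl (G s) (prob A L h s E))
      activation-then-finish (suc n) h s = cases (timely? s)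
        where
        cases : All Timely s ⊎ ∃[ u ] Failed (Vec.lookup s u) → prob A (suc n) h s (every activated) - G s ≤ℚ prob A (suc n ℕ.+ L) h s E
        cases (inj₁ timely)       = one-step h timely _ _ (λ c → activation-then-finish n (c ∷ h) (resolve c (advance (A h) s)))
        cases (inj₂ (u , failed)) = below-0 (prob≤1 A (suc n) h s (every activated)) (G-failed s u failed) (prob-nn A (suc n ℕ.+ L) h s E)

      initial : Vec Status k
      initial = Vec.replicate k asleep

      -- All ages are 0 at the start, so `D` is the slack that `H` leaves in the exponent.
      G-initial : ∀ D → (k ℕ.* massFrom 0 L) ℕ./ S ℕ.+ g ℕ.* k ℕ.+ D ≤ L → G initial ≤ℚ ofℕ k * w ^ D
      G-initial D H+D≤L = begin
        G initial                                ≤⟨ ΣFin-mono k (λ u → ℚₚ.≤-trans (ℚₚ.≤-reflexive (cong (φ (H initial)) (Vecₚ.lookup-replicate u asleep))) bound) ⟩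
        ΣFin k (λ _ → w ^ D)                   ≡⟨ ΣFin-const k (w ^ D) ⟩
        ofℕ k * w ^ D                          ∎
        where
        total-replicate : ∀ f k → total f (Vec.replicate k asleep) ≡ k ℕ.* f asleep
        total-replicate f zero    = refl
        total-replicate f (suc k) = cong (f asleep ℕ.+_) (total-replicate f k)
        H≡ : H initial ≡ (k ℕ.* massFrom 0 L) ℕ./ S ℕ.+ g ℕ.* k
        H≡ = cong₂ (λ x y → x ℕ./ S ℕ.+ g ℕ.* y) (total-replicate remaining k) (trans (total-replicate pending k) (ℕₚ.*-identityʳ k))
        bound : weight (H initial) ≤ℚ w ^ D
        bound = begin
          w ^ L * z ^ H initial                  ≤⟨ *-monoʳ {z ^ H initial} (^-nn 0≤z (H initial)) (^-antiʳ 0≤w w≤1 (subst (λ x → x ℕ.+ D ≤ L) (sym H≡) H+D≤L)) ⟩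
          w ^ (H initial ℕ.+ D) * z ^ H initial    ≡⟨ cong (_* z ^ H initial) (^-homo-* w (H initial) D) ⟩
          w ^ H initial * w ^ D * z ^ H initial    ≡⟨ solve 3 (λ a b c → a :* b :* c := a :* c :* b) refl (w ^ H initial) (w ^ D) (z ^ H initial) ⟩
          w ^ H initial * z ^ H initial * w ^ D    ≡⟨ cong (_* w ^ D) (w^z^ (H initial)) ⟩
          1ℚ * w ^ D                           ≡⟨ ℚₚ.*-identityˡ (w ^ D) ⟩
          w ^ D                                ∎

      success-probability : ∀ n D → (k ℕ.* massFrom 0 L) ℕ./ S ℕ.+ g ℕ.* k ℕ.+ D ≤ L →
        prob A n [] initial (every activated) - ofℕ k * w ^ D ≤ℚ prob A (n ℕ.+ L) [] initial E
      success-probability n D H+D≤L = ℚₚ.≤-trans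
        (ℚₚ.+-monoʳ-≤ (prob A n [] initial (every activated)) (ℚₚ.neg-antimono-≤ (G-initial D H+D≤L)))
        (activation-then-finish n [] initial)

-- Integer scales for log k, log log k and the horizon.

module Parameters where

  open ℕₚ.≤-Reasoning
  open Ranges

  n<b^n : ∀ {b} → 2 ≤ b → ∀ n → n ℕ.< b ℕ.^ n
  n<b^n {b} 2≤b zero    = ℕₚ.≤-refl
  n<b^n {b} 2≤b (suc n) = begin
    suc (suc n)             ≤⟨ ℕₚ.+-mono-≤ (ℕₚ.≤-trans (ℕ.s≤s (ℕ.z≤n {n})) (n<b^n 2≤b n)) (n<b^n 2≤b n) ⟩
    b ℕ.^ n ℕ.+ b ℕ.^ n     ≡⟨ cong (b ℕ.^ n ℕ.+_) (ℕₚ.+-identityʳ (b ℕ.^ n)) ⟨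
    2 ℕ.* b ℕ.^ n           ≤⟨ ℕₚ.*-monoˡ-≤ (b ℕ.^ n) 2≤b ⟩
    b ℕ.* b ℕ.^ n           ∎

  -- An integer logarithm of X / m. The search descends from the exponent `X`, which is too large
  -- because X < b^X.
  bracket : ∀ {b} → 2 ≤ b → ∀ m X → 1 ≤ m → m ≤ X → ∃[ e ] (b ℕ.^ e ℕ.* m ≤ X × X ℕ.< b ℕ.^ suc e ℕ.* m)
  bracket {b} 2≤b m X 1≤m m≤X = search X (ℕₚ.<-≤-trans (n<b^n 2≤b X) (ℕₚ.m≤m*n (b ℕ.^ X) m {{ℕ.>-nonZero 1≤m}}))
    where
    search : ∀ n → X ℕ.< b ℕ.^ n ℕ.* m → ∃[ e ] (b ℕ.^ e ℕ.* m ≤ X × X ℕ.< b ℕ.^ suc e ℕ.* m)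
    search zero    X< = ⊥-elim (ℕₚ.<⇒≱ X< (ℕₚ.≤-trans (ℕₚ.≤-reflexive (ℕₚ.*-identityˡ m)) m≤X))
    search (suc n) X< with ℕₚ.≤-<-connex (b ℕ.^ n ℕ.* m) X
    ... | inj₁ ≤X  = n , ≤X , X<
    ... | inj₂ X<′ = search n X<′

  ^-cancel-≤ : ∀ {m n} → 2 ℕ.^ m ≤ 2 ℕ.^ n → m ≤ n
  ^-cancel-≤ {m} {n} le with ℕₚ.≤-<-connex m n
  ... | inj₁ m≤n = m≤n
  ... | inj₂ n<m = ⊥-elim (ℕₚ.<⇒≱ (ℕₚ.^-monoʳ-< 2 (ℕ.s≤s (ℕ.s≤s ℕ.z≤n)) n<m) le)

  ^-cancel-< : ∀ {m n} → 2 ℕ.^ m ℕ.< 2 ℕ.^ n → m ℕ.< n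
  ^-cancel-< {m} {n} lt with ℕₚ.<-≤-connex m n
  ... | inj₁ m<n = m<n
  ... | inj₂ n≤m = ⊥-elim (ℕₚ.<⇒≱ lt (ℕₚ.^-monoʳ-≤ 2 n≤m))

  -- Raising `E` by 1 doubles the right side, while E + 1 ≤ 2 E. Thus the lower bound on ln j / j is
  -- least at the end of the horizon.
  n/2^n-anti : ∀ {e} E → 1 ≤ e → e ≤ E → E ℕ.* 2 ℕ.^ e ≤ e ℕ.* 2 ℕ.^ E
  n/2^n-anti {e} zero    1≤e e≤0 = ℕ.z≤n
  n/2^n-anti {e} (suc E) 1≤e e≤ with ℕₚ.m≤n⇒m<n∨m≡n e≤
  ... | inj₂ refl          = ℕₚ.≤-refl
  ... | inj₁ (ℕ.s≤s e≤E) = begin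
    suc E ℕ.* 2 ℕ.^ e            ≤⟨ ℕₚ.*-monoˡ-≤ (2 ℕ.^ e) (ℕₚ.≤-trans (ℕₚ.+-monoˡ-≤ E (ℕₚ.≤-trans 1≤e e≤E)) (ℕₚ.≤-reflexive (cong (E ℕ.+_) (sym (ℕₚ.+-identityʳ E))))) ⟩
    2 ℕ.* E ℕ.* 2 ℕ.^ e          ≡⟨ ℕₚ.*-assoc 2 E (2 ℕ.^ e) ⟩
    2 ℕ.* (E ℕ.* 2 ℕ.^ e)        ≤⟨ ℕₚ.*-monoʳ-≤ 2 (n/2^n-anti E 1≤e e≤E) ⟩
    2 ℕ.* (e ℕ.* 2 ℕ.^ E)        ≡⟨ S.solve 2 (λ e p → S.con 2 S.:* (e S.:* p) S.:= e S.:* (S.con 2 S.:* p)) refl e (2 ℕ.^ E) ⟩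
    e ℕ.* 2 ℕ.^ suc E            ∎

  4[e+1]≤3j : ∀ {e j} → 3 ≤ j → 2 ℕ.^ e ≤ j → j ℕ.< 2 ℕ.^ suc e → 4 ℕ.* suc e ≤ 3 ℕ.* j
  4[e+1]≤3j {zero}        3≤j _   j< = ⊥-elim (ℕₚ.<⇒≱ j< (ℕₚ.<⇒≤ 3≤j))
  4[e+1]≤3j {suc zero}    3≤j _   _  = ℕₚ.≤-trans (ℕₚ.n≤1+n 8) (ℕₚ.*-monoʳ-≤ 3 3≤j)
  4[e+1]≤3j {suc (suc e)} 3≤j e≤j _  = ℕₚ.≤-trans (large e) (ℕₚ.*-monoʳ-≤ 3 e≤j)
    where
    large : ∀ e → 4 ℕ.* (3 ℕ.+ e) ≤ 3 ℕ.* 2 ℕ.^ (2 ℕ.+ e)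
    large zero    = ℕₚ.≤-refl
    large (suc e) = begin
      4 ℕ.* (4 ℕ.+ e)                                    ≡⟨ S.solve 1 (λ e → S.con 4 S.:* (S.con 4 S.:+ e) S.:= S.con 4 S.:* (S.con 3 S.:+ e) S.:+ S.con 4) refl e ⟩
      4 ℕ.* (3 ℕ.+ e) ℕ.+ 4                              ≤⟨ ℕₚ.+-mono-≤ (large e) (ℕₚ.≤-trans (ℕₚ.m≤m+n 4 (8 ℕ.+ 4 ℕ.* e)) (ℕₚ.≤-trans (ℕₚ.≤-reflexive (S.solve 1 (λ e → S.con 4 S.:+ (S.con 8 S.:+ S.con 4 S.:* e) S.:= S.con 4 S.:* (S.con 3 S.:+ e)) refl e)) (large e))) ⟩
      3 ℕ.* 2 ℕ.^ (2 ℕ.+ e) ℕ.+ 3 ℕ.* 2 ℕ.^ (2 ℕ.+ e)    ≡⟨ S.solve 1 (λ p → S.con 3 S.:* p S.:+ S.con 3 S.:* p S.:= S.con 3 S.:* (S.con 2 S.:* p)) refl (2 ℕ.^ (2 ℕ.+ e)) ⟩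
      3 ℕ.* 2 ℕ.^ (3 ℕ.+ e)                              ∎

  -- ℓ, μ and 2 ^ E stand for log k, log log k and k log² k / log log k; the factor 2 ^ 12 = 16 · 16²
  -- absorbs (E + 1)² ≤ (16 ℓ)² in `mass-fits`.
  record Scale (k : ℕ) : Set where
    field
      ℓ μ E      : ℕ
      2≤ℓ        : 2 ≤ ℓ
      1≤μ        : 1 ≤ μ
      2^ℓ≤2k     : 2 ℕ.^ ℓ ≤ 2 ℕ.* k
      k<2^ℓ      : k ℕ.< 2 ℕ.^ ℓ
      ℓ≤k        : ℓ ≤ k
      8^μ≤8ℓ     : 8 ℕ.^ μ ≤ 8 ℕ.* ℓ
      ℓ<8^μ      : ℓ ℕ.< 8 ℕ.^ μ
      μ≤ℓ        : μ ≤ ℓ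
      kℓℓ≤2^Eμ   : 2 ℕ.^ 12 ℕ.* (k ℕ.* (ℓ ℕ.* ℓ)) ≤ 2 ℕ.^ E ℕ.* μ
      2^Eμ≤2kℓℓ  : 2 ℕ.^ E ℕ.* μ ≤ 2 ℕ.* (2 ℕ.^ 12 ℕ.* (k ℕ.* (ℓ ℕ.* ℓ)))

  scale : ∀ k → 3 ≤ k → Scale k
  scale k 3≤k = record
    -- All three exponents are one above the bracketed value, which gives upper bounds on k, ℓ and
    -- X; the reverse bounds pay factors 2, 8 and 2.
    { ℓ = ℓ ; μ = μ ; E = suc f
    ; 2≤ℓ = 2≤ℓ e 2^e≤k k<
    ; 1≤μ = ℕ.s≤s ℕ.z≤n
    ; 2^ℓ≤2k = ℕₚ.*-monoʳ-≤ 2 2^e≤k′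
    ; k<2^ℓ = k<
    ; ℓ≤k = ℕₚ.≤-trans (n<b^n ℕₚ.≤-refl e) 2^e≤k′
    ; 8^μ≤8ℓ = ℕₚ.*-monoʳ-≤ 8 (ℕₚ.≤-trans (ℕₚ.≤-reflexive (sym (ℕₚ.*-identityʳ (8 ℕ.^ d)))) 8^d≤ℓ)
    ; ℓ<8^μ = subst (ℓ ℕ.<_) (ℕₚ.*-identityʳ (8 ℕ.^ suc d)) ℓ<
    ; μ≤ℓ = μ≤ℓ
    ; kℓℓ≤2^Eμ = ℕₚ.<⇒≤ X<
    ; 2^Eμ≤2kℓℓ = ℕₚ.≤-trans (ℕₚ.≤-reflexive (ℕₚ.*-assoc 2 (2 ℕ.^ f) μ)) (ℕₚ.*-monoʳ-≤ 2 2^fμ≤X)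
    }
    where
    2≤8 : 2 ≤ 8
    2≤8 = ℕ.s≤s (ℕ.s≤s ℕ.z≤n)
    k-bracket = bracket {2} ℕₚ.≤-refl 1 k ℕₚ.≤-refl (ℕₚ.≤-trans (ℕ.s≤s ℕ.z≤n) 3≤k)
    e = proj₁ k-bracket
    2^e≤k = proj₁ (proj₂ k-bracket)
    2^e≤k′ : 2 ℕ.^ e ≤ k
    2^e≤k′ = ℕₚ.≤-trans (ℕₚ.≤-reflexive (sym (ℕₚ.*-identityʳ (2 ℕ.^ e)))) 2^e≤k
    k< : k ℕ.< 2 ℕ.^ suc e
    k< = subst (k ℕ.<_) (ℕₚ.*-identityʳ (2 ℕ.^ suc e)) (proj₂ (proj₂ k-bracket))
    ℓ = suc e
    2≤ℓ : ∀ e → 2 ℕ.^ e ℕ.* 1 ≤ k → k ℕ.< 2 ℕ.^ suc e → 2 ≤ suc e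
    2≤ℓ zero    _ k<2 = ⊥-elim (ℕₚ.<⇒≱ k<2 (ℕₚ.<⇒≤ 3≤k))
    2≤ℓ (suc e) _ _   = ℕ.s≤s (ℕ.s≤s ℕ.z≤n)
    -- Base 8 matches the price ⅛ in `silence-≥`: at load μ / 2 the bound ⅛^μ on the chance of
    -- silence has order 1 / ℓ.
    ℓ-bracket = bracket {8} 2≤8 1 ℓ ℕₚ.≤-refl (ℕ.s≤s ℕ.z≤n)
    d = proj₁ ℓ-bracket
    8^d≤ℓ = proj₁ (proj₂ ℓ-bracket)
    ℓ< = proj₂ (proj₂ ℓ-bracket)
    μ = suc d
    μ≤ℓ : μ ≤ ℓ
    μ≤ℓ = ℕₚ.≤-trans (n<b^n 2≤8 d) (ℕₚ.≤-trans (ℕₚ.≤-reflexive (sym (ℕₚ.*-identityʳ (8 ℕ.^ d)))) 8^d≤ℓ)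
    c = 2 ℕ.^ 12
    X = c ℕ.* (k ℕ.* (ℓ ℕ.* ℓ))
    μ≤X : μ ≤ X
    μ≤X = ℕₚ.≤-trans μ≤ℓ (ℕₚ.≤-trans (ℕₚ.m≤m*n ℓ ℓ) (ℕₚ.≤-trans (ℕₚ.m≤n*m (ℓ ℕ.* ℓ) k {{ℕ.>-nonZero (ℕₚ.≤-trans (ℕ.s≤s ℕ.z≤n) 3≤k)}})
      (ℕₚ.m≤n*m (k ℕ.* (ℓ ℕ.* ℓ)) c)))
    X-bracket = bracket {2} ℕₚ.≤-refl μ X (ℕ.s≤s ℕ.z≤n) μ≤X
    f = proj₁ X-bracket
    2^fμ≤X = proj₁ (proj₂ X-bracket)
    X< = proj₂ (proj₂ X-bracket)

  module ScaleProperties {k} (3≤k : 3 ≤ k) (sc : Scale k) where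

    open Scale sc public

    c = 2 ℕ.^ 12

    ckℓ≤2^E : c ℕ.* (k ℕ.* ℓ) ≤ 2 ℕ.^ E
    ckℓ≤2^E = ℕₚ.*-cancelʳ-≤ (c ℕ.* (k ℕ.* ℓ)) (2 ℕ.^ E) μ {{ℕ.>-nonZero 1≤μ}} (begin
      c ℕ.* (k ℕ.* ℓ) ℕ.* μ      ≤⟨ ℕₚ.*-monoʳ-≤ (c ℕ.* (k ℕ.* ℓ)) μ≤ℓ ⟩
      c ℕ.* (k ℕ.* ℓ) ℕ.* ℓ      ≡⟨ trans (ℕₚ.*-assoc c (k ℕ.* ℓ) ℓ) (cong (c ℕ.*_) (ℕₚ.*-assoc k ℓ ℓ)) ⟩
      c ℕ.* (k ℕ.* (ℓ ℕ.* ℓ))    ≤⟨ kℓℓ≤2^Eμ ⟩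
      2 ℕ.^ E ℕ.* μ              ∎)

    n*kℓ≤2^E : ∀ n → n ≤ c → n ℕ.* (k ℕ.* ℓ) ≤ 2 ℕ.^ E
    n*kℓ≤2^E n n≤c = ℕₚ.≤-trans (ℕₚ.*-monoˡ-≤ (k ℕ.* ℓ) n≤c) ckℓ≤2^E

    small : ∀ n {_ : T (n ℕ.≤ᵇ c)} → n ≤ c
    small n {n≤c} = ℕₚ.≤ᵇ⇒≤ n c n≤c

    ℓ≤E : ℓ ≤ E
    ℓ≤E = ^-cancel-≤ (begin
      2 ℕ.^ ℓ            ≤⟨ 2^ℓ≤2k ⟩
      2 ℕ.* k            ≤⟨ ℕₚ.*-monoʳ-≤ 2 (ℕₚ.m≤m*n k ℓ {{ℕ.>-nonZero (ℕₚ.<⇒≤ 2≤ℓ)}}) ⟩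
      2 ℕ.* (k ℕ.* ℓ)    ≤⟨ n*kℓ≤2^E 2 (small 2) ⟩
      2 ℕ.^ E            ∎)

    2≤E : 2 ≤ E
    2≤E = ℕₚ.≤-trans 2≤ℓ ℓ≤E

    -- From 2^E ≤ 2^13 k ℓ², with `k` and `ℓ` both bounded crudely by 2^ℓ.
    E≤13+3ℓ : E ≤ 13 ℕ.+ 3 ℕ.* ℓ
    E≤13+3ℓ = ^-cancel-≤ (begin
      2 ℕ.^ E                                            ≤⟨ ℕₚ.m≤m*n (2 ℕ.^ E) μ {{ℕ.>-nonZero 1≤μ}} ⟩
      2 ℕ.^ E ℕ.* μ                                      ≤⟨ 2^Eμ≤2kℓℓ ⟩
      2 ℕ.* (c ℕ.* (k ℕ.* (ℓ ℕ.* ℓ)))                    ≤⟨ ℕₚ.*-monoʳ-≤ 2 (ℕₚ.*-monoʳ-≤ c (ℕₚ.*-mono-≤ (ℕₚ.<⇒≤ k<2^ℓ) (ℕₚ.*-mono-≤ ℓ≤P ℓ≤P))) ⟩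
      2 ℕ.* (c ℕ.* (P ℕ.* (P ℕ.* P)))                    ≡⟨ ℕₚ.*-assoc 2 c (P ℕ.* (P ℕ.* P)) ⟨
      2 ℕ.^ 13 ℕ.* (P ℕ.* (P ℕ.* P))                     ≡⟨ cong (2 ℕ.^ 13 ℕ.*_) (trans (cong (λ x → P ℕ.* (P ℕ.* x)) (sym (ℕₚ.*-identityʳ P))) (trans (ℕₚ.^-*-assoc 2 ℓ 3) (cong (2 ℕ.^_) (ℕₚ.*-comm ℓ 3)))) ⟩
      2 ℕ.^ 13 ℕ.* 2 ℕ.^ (3 ℕ.* ℓ)                       ≡⟨ ℕₚ.^-distribˡ-+-* 2 13 (3 ℕ.* ℓ) ⟨
      2 ℕ.^ (13 ℕ.+ 3 ℕ.* ℓ)                             ∎)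
      where
      P = 2 ℕ.^ ℓ
      ℓ≤P = ℕₚ.<⇒≤ (n<b^n ℕₚ.≤-refl ℓ)

    -- The estimate yields 10 ℓ; 16 is the next power of 2.
    E+1≤16ℓ : suc E ≤ 16 ℕ.* ℓ
    E+1≤16ℓ = begin
      suc E                        ≤⟨ ℕ.s≤s E≤13+3ℓ ⟩
      14 ℕ.+ 3 ℕ.* ℓ               ≤⟨ ℕₚ.+-monoˡ-≤ (3 ℕ.* ℓ) (ℕₚ.*-monoʳ-≤ 7 2≤ℓ) ⟩
      7 ℕ.* ℓ ℕ.+ 3 ℕ.* ℓ          ≤⟨ ℕₚ.m≤m+n (7 ℕ.* ℓ ℕ.+ 3 ℕ.* ℓ) (6 ℕ.* ℓ) ⟩
      7 ℕ.* ℓ ℕ.+ 3 ℕ.* ℓ ℕ.+ 6 ℕ.* ℓ ≡⟨ S.solve 1 (λ l → S.con 7 S.:* l S.:+ S.con 3 S.:* l S.:+ S.con 6 S.:* l S.:= S.con 16 S.:* l) refl ℓ ⟩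
      16 ℕ.* ℓ                     ∎

    -- Divided by `capacity`, the mass of all stations then comes to at most a quarter of the
    -- horizon, which limits the crowded rounds.
    mass-fits : 16 ℕ.* (k ℕ.* (suc E ℕ.* suc E)) ≤ 2 ℕ.^ E ℕ.* μ
    mass-fits = begin
      16 ℕ.* (k ℕ.* (suc E ℕ.* suc E))             ≤⟨ ℕₚ.*-monoʳ-≤ 16 (ℕₚ.*-monoʳ-≤ k (ℕₚ.*-mono-≤ E+1≤16ℓ E+1≤16ℓ)) ⟩
      16 ℕ.* (k ℕ.* (16 ℕ.* ℓ ℕ.* (16 ℕ.* ℓ)))     ≡⟨ regroup 16 ⟩
      16 ℕ.* 16 ℕ.* 16 ℕ.* (k ℕ.* (ℓ ℕ.* ℓ))       ≤⟨ kℓℓ≤2^Eμ ⟩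
      2 ℕ.^ E ℕ.* μ                                ∎
      where
      regroup : ∀ a → a ℕ.* (k ℕ.* (a ℕ.* ℓ ℕ.* (a ℕ.* ℓ))) ≡ a ℕ.* a ℕ.* a ℕ.* (k ℕ.* (ℓ ℕ.* ℓ))
      regroup a = S.solve 3 (λ a k l → a S.:* (k S.:* (a S.:* l S.:* (a S.:* l))) S.:= a S.:* a S.:* a S.:* (k S.:* (l S.:* l))) refl a k ℓ

    g : ℕ
    g = 4 ℕ.* 8 ℕ.^ μ

    g≤32ℓ : g ≤ 32 ℕ.* ℓ
    g≤32ℓ = ℕₚ.≤-trans (ℕₚ.*-monoʳ-≤ 4 8^μ≤8ℓ) (ℕₚ.≤-reflexive (sym (ℕₚ.*-assoc 4 8 ℓ)))

    4gk≤2^E : 4 ℕ.* (g ℕ.* k) ≤ 2 ℕ.^ E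
    4gk≤2^E = begin
      4 ℕ.* (g ℕ.* k)              ≤⟨ ℕₚ.*-monoʳ-≤ 4 (ℕₚ.*-monoˡ-≤ k g≤32ℓ) ⟩
      4 ℕ.* (32 ℕ.* ℓ ℕ.* k)       ≡⟨ regroup 4 32 ⟩
      4 ℕ.* 32 ℕ.* (k ℕ.* ℓ)       ≤⟨ n*kℓ≤2^E 128 (small 128) ⟩
      2 ℕ.^ E                      ∎
      where
      regroup : ∀ a b → a ℕ.* (b ℕ.* ℓ ℕ.* k) ≡ a ℕ.* b ℕ.* (k ℕ.* ℓ)
      regroup a b = S.solve 4 (λ a b k l → a S.:* (b S.:* l S.:* k) S.:= a S.:* b S.:* (k S.:* l)) refl a b k ℓ

    -- Gives g q ≤ 1/16, as required for Bernoulli's bound on w^g to be linear in g q.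
    gE≤2^E : g ℕ.* E ≤ 2 ℕ.^ E
    gE≤2^E = begin
      g ℕ.* E                      ≤⟨ ℕₚ.*-mono-≤ g≤32ℓ (ℕₚ.≤-trans (ℕₚ.n≤1+n E) E+1≤16ℓ) ⟩
      32 ℕ.* ℓ ℕ.* (16 ℕ.* ℓ)      ≤⟨ ℕₚ.*-monoˡ-≤ (16 ℕ.* ℓ) (ℕₚ.*-monoʳ-≤ 32 ℓ≤k) ⟩
      32 ℕ.* k ℕ.* (16 ℕ.* ℓ)      ≡⟨ regroup 32 16 ⟩
      32 ℕ.* 16 ℕ.* (k ℕ.* ℓ)      ≤⟨ n*kℓ≤2^E 512 (small 512) ⟩
      2 ℕ.^ E                      ∎
      where
      regroup : ∀ a b → a ℕ.* k ℕ.* (b ℕ.* ℓ) ≡ a ℕ.* b ℕ.* (k ℕ.* ℓ)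
      regroup a b = S.solve 4 (λ a b k l → a S.:* k S.:* (b S.:* l) S.:= a S.:* b S.:* (k S.:* l)) refl a b k ℓ

    module Masses (b : ℕ) .{{_ : NonZero b}} where

      index : ℕ → ℕ
      index r = 3 ℕ.+ r ℕ./ b

      -- An integer upper bound for the probability in units of `κ` = ½ 2^(-E): it is at most (E +
      -- 1) / j, and the quotient is rounded up. The ½ in the unit makes the crowded threshold μ / 2
      -- the integer `capacity`.
      mass : ℕ → ℕ
      mass r = 2 ℕ.* suc E ℕ.* suc (2 ℕ.^ E ℕ./ index r)

      horizon : ℕ
      horizon = b ℕ.* 2 ℕ.^ E

      capacity : ℕ
      capacity = 2 ℕ.^ E ℕ.* μ

      -- From age b 2^e on the index is at least 2^e. The added 1 in `mass` is absorbed because 2^(E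
      -- - e) ≥ 1.
      mass-≤ : ∀ e → e ≤ E → ∀ r → b ℕ.* 2 ℕ.^ e ≤ r → mass r ≤ 4 ℕ.* suc E ℕ.* 2 ℕ.^ (E ℕ.∸ e)
      mass-≤ e e≤E r b2^e≤r = begin
        2 ℕ.* suc E ℕ.* suc Q                        ≤⟨ ℕₚ.*-monoʳ-≤ (2 ℕ.* suc E) (ℕₚ.+-mono-≤ (ℕₚ.m^n>0 2 (E ℕ.∸ e)) Q≤) ⟩
        2 ℕ.* suc E ℕ.* (R ℕ.+ R)                    ≡⟨ S.solve 2 (λ a r → S.con 2 S.:* a S.:* (r S.:+ r) S.:= S.con 4 S.:* a S.:* r) refl (suc E) R ⟩
        4 ℕ.* suc E ℕ.* R                            ∎
        where
        Q = 2 ℕ.^ E ℕ./ index r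
        R = 2 ℕ.^ (E ℕ.∸ e)
        2^e≤j : 2 ℕ.^ e ≤ index r
        2^e≤j = begin
          2 ℕ.^ e                   ≡⟨ ℕ÷.m*n/n≡m (2 ℕ.^ e) b ⟨
          (2 ℕ.^ e ℕ.* b) ℕ./ b     ≤⟨ ℕ÷./-monoˡ-≤ b (ℕₚ.≤-trans (ℕₚ.≤-reflexive (ℕₚ.*-comm (2 ℕ.^ e) b)) b2^e≤r) ⟩
          r ℕ./ b                   ≤⟨ ℕₚ.m≤n+m (r ℕ./ b) 3 ⟩
          index r                   ∎
        Q≤ : Q ≤ R
        Q≤ = ℕₚ.*-cancelʳ-≤ Q R (2 ℕ.^ e) {{ℕₚ.m^n≢0 2 e}} (begin
          Q ℕ.* 2 ℕ.^ e             ≤⟨ ℕₚ.*-monoʳ-≤ Q 2^e≤j ⟩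
          Q ℕ.* index r             ≤⟨ ℕ÷.m/n*n≤m (2 ℕ.^ E) (index r) ⟩
          2 ℕ.^ E                   ≡⟨ cong (2 ℕ.^_) (ℕₚ.m∸n+n≡m e≤E) ⟨
          2 ℕ.^ (E ℕ.∸ e ℕ.+ e)     ≡⟨ ℕₚ.^-distribˡ-+-* 2 (E ℕ.∸ e) e ⟩
          R ℕ.* 2 ℕ.^ e             ∎)

      -- Each doubling of the local clock contributes the same mass.
      sum-mass : ∀ e → e ≤ E → sumFrom mass 0 (b ℕ.* 2 ℕ.^ e) ≤ suc e ℕ.* (b ℕ.* (4 ℕ.* suc E ℕ.* 2 ℕ.^ E))
      sum-mass zero    _   = begin
        sumFrom mass 0 (b ℕ.* 1)                                ≡⟨ cong (sumFrom mass 0) (ℕₚ.*-identityʳ b) ⟩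
        sumFrom mass 0 b                                        ≤⟨ sumFrom-≤ mass 0 b _ (λ r _ → mass-0 r) ⟩
        b ℕ.* (4 ℕ.* suc E ℕ.* 2 ℕ.^ E)                         ≡⟨ ℕₚ.+-identityʳ _ ⟨
        1 ℕ.* (b ℕ.* (4 ℕ.* suc E ℕ.* 2 ℕ.^ E))                 ∎
        where
        mass-0 : ∀ r → mass r ≤ 4 ℕ.* suc E ℕ.* 2 ℕ.^ E
        mass-0 r = begin
          2 ℕ.* suc E ℕ.* suc (2 ℕ.^ E ℕ./ index r)             ≤⟨ ℕₚ.*-monoʳ-≤ (2 ℕ.* suc E) (ℕₚ.+-mono-≤ (ℕₚ.m^n>0 2 E) (ℕ÷.m/n≤m (2 ℕ.^ E) (index r))) ⟩
          2 ℕ.* suc E ℕ.* (2 ℕ.^ E ℕ.+ 2 ℕ.^ E)                 ≡⟨ S.solve 2 (λ a r → S.con 2 S.:* a S.:* (r S.:+ r) S.:= S.con 4 S.:* a S.:* r) refl (suc E) (2 ℕ.^ E) ⟩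
          4 ℕ.* suc E ℕ.* 2 ℕ.^ E                               ∎
      sum-mass (suc e) e<E = begin
        sumFrom mass 0 (b ℕ.* (2 ℕ.* P))                        ≡⟨ cong (sumFrom mass 0) (S.solve 2 (λ b p → b S.:* (S.con 2 S.:* p) S.:= b S.:* p S.:+ b S.:* p) refl b P) ⟩
        sumFrom mass 0 (b ℕ.* P ℕ.+ b ℕ.* P)                    ≡⟨ sumFrom-+ mass 0 (b ℕ.* P) (b ℕ.* P) ⟩
        sumFrom mass 0 (b ℕ.* P) ℕ.+ sumFrom mass (b ℕ.* P) (b ℕ.* P)
          ≤⟨ ℕₚ.+-mono-≤ (sum-mass e e≤E) (sumFrom-≤ mass (b ℕ.* P) (b ℕ.* P) _ (mass-≤ e e≤E)) ⟩
        suc e ℕ.* U ℕ.+ b ℕ.* P ℕ.* (4 ℕ.* suc E ℕ.* R)         ≡⟨ cong (suc e ℕ.* U ℕ.+_) (S.solve 4 (λ b p a r → b S.:* p S.:* (S.con 4 S.:* a S.:* r) S.:= b S.:* (S.con 4 S.:* a S.:* (r S.:* p))) refl b P (suc E) R) ⟩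
        suc e ℕ.* U ℕ.+ b ℕ.* (4 ℕ.* suc E ℕ.* (R ℕ.* P))       ≡⟨ cong (λ x → suc e ℕ.* U ℕ.+ b ℕ.* (4 ℕ.* suc E ℕ.* x)) (trans (sym (ℕₚ.^-distribˡ-+-* 2 (E ℕ.∸ e) e)) (cong (2 ℕ.^_) (ℕₚ.m∸n+n≡m e≤E))) ⟩
        suc e ℕ.* U ℕ.+ U                                       ≡⟨ ℕₚ.+-comm (suc e ℕ.* U) U ⟩
        suc (suc e) ℕ.* U                                       ∎
        where
        P = 2 ℕ.^ e
        R = 2 ℕ.^ (E ℕ.∸ e)
        U = b ℕ.* (4 ℕ.* suc E ℕ.* 2 ℕ.^ E)
        e≤E = ℕₚ.<⇒≤ e<E

      instance
        capacity≢0 : NonZero capacity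
        capacity≢0 = ℕ.>-nonZero (ℕₚ.*-mono-≤ (ℕₚ.m^n>0 2 E) 1≤μ)

      -- A quarter of the horizon goes to crowded rounds, a quarter to the `g` units of each
      -- station, and half to the exponent D; the last needs 2 · 16 B ≤ b.
      budget : ∀ B → 32 ℕ.* B ≤ b →
        (k ℕ.* sumFrom mass 0 horizon) ℕ./ capacity ℕ.+ g ℕ.* k ℕ.+ B ℕ.* (16 ℕ.* 2 ℕ.^ E) ≤ horizon
      budget B 32B≤b = ℕₚ.*-cancelˡ-≤ 4 (begin
        4 ℕ.* (X ℕ.+ g ℕ.* k ℕ.+ D)                  ≡⟨ S.solve 3 (λ x y d → S.con 4 S.:* (x S.:+ y S.:+ d) S.:= S.con 4 S.:* x S.:+ S.con 4 S.:* y S.:+ S.con 2 S.:* (S.con 2 S.:* d)) refl X (g ℕ.* k) D ⟩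
        4 ℕ.* X ℕ.+ 4 ℕ.* (g ℕ.* k) ℕ.+ 2 ℕ.* (2 ℕ.* D) ≤⟨ ℕₚ.+-mono-≤ (ℕₚ.+-mono-≤ 4X≤ (ℕₚ.≤-trans 4gk≤2^E (ℕₚ.m≤n*m (2 ℕ.^ E) b))) (ℕₚ.*-monoʳ-≤ 2 2D≤) ⟩
        horizon ℕ.+ horizon ℕ.+ 2 ℕ.* horizon        ≡⟨ S.solve 1 (λ t → t S.:+ t S.:+ S.con 2 S.:* t S.:= S.con 4 S.:* t) refl horizon ⟩
        4 ℕ.* horizon                                ∎)
        where
        D = B ℕ.* (16 ℕ.* 2 ℕ.^ E)
        W = sumFrom mass 0 horizon
        X = (k ℕ.* W) ℕ./ capacity
        2D≤ : 2 ℕ.* D ≤ horizon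
        2D≤ = begin
          2 ℕ.* (B ℕ.* (16 ℕ.* 2 ℕ.^ E))             ≡⟨ S.solve 2 (λ B p → S.con 2 S.:* (B S.:* (S.con 16 S.:* p)) S.:= S.con 32 S.:* B S.:* p) refl B (2 ℕ.^ E) ⟩
          32 ℕ.* B ℕ.* 2 ℕ.^ E                       ≤⟨ ℕₚ.*-monoˡ-≤ (2 ℕ.^ E) 32B≤b ⟩
          horizon                                    ∎
        4X≤ : 4 ℕ.* X ≤ horizon
        4X≤ = ℕₚ.*-cancelʳ-≤ (4 ℕ.* X) horizon capacity (begin
          4 ℕ.* X ℕ.* capacity                       ≡⟨ ℕₚ.*-assoc 4 X capacity ⟩
          4 ℕ.* (X ℕ.* capacity)                     ≤⟨ ℕₚ.*-monoʳ-≤ 4 (ℕ÷.m/n*n≤m (k ℕ.* W) capacity) ⟩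
          4 ℕ.* (k ℕ.* W)                            ≤⟨ ℕₚ.*-monoʳ-≤ 4 (ℕₚ.*-monoʳ-≤ k (sum-mass E ℕₚ.≤-refl)) ⟩
          4 ℕ.* (k ℕ.* (suc E ℕ.* (b ℕ.* (4 ℕ.* suc E ℕ.* 2 ℕ.^ E))))
            ≡⟨ S.solve 4 (λ k a b p → S.con 4 S.:* (k S.:* (a S.:* (b S.:* (S.con 4 S.:* a S.:* p)))) S.:= b S.:* p S.:* (S.con 16 S.:* (k S.:* (a S.:* a)))) refl k (suc E) b (2 ℕ.^ E) ⟩
          horizon ℕ.* (16 ℕ.* (k ℕ.* (suc E ℕ.* suc E))) ≤⟨ ℕₚ.*-monoʳ-≤ horizon mass-fits ⟩
          horizon ℕ.* capacity                       ∎)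

-- Bounds on the approximate probabilities at a sufficient precision.

approximateProb : (b : ℕ) .{{_ : NonZero b}} → ℕ → ℕ → ℚ
approximateProb b n r = Logarithm.lnAt n (ofℕ j) * inv (ofℕ j)
  where j = 3 ℕ.+ r ℕ./ b

module Approximation {k} (3≤k : 3 ≤ k) (sc : Parameters.Scale k) (b : ℕ) .{{_ : NonZero b}} (n : ℕ)
  (lnAt-low : ∀ e → e ≤ Parameters.Scale.E sc → ∀ {y} → ofℕ (2 ℕ.^ e) ≤ℚ y → ½ * ½ * ofℕ e ≤ℚ Logarithm.lnAt n y) where

  open Coins
  open Logarithm
  open Parameters
  open ScaleProperties 3≤k sc
  open Masses b
  open Powers
  open CauchyLemmas using (^-nn)
  open ℚₚ.≤-Reasoning

  p : ℕ → ℚ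
  p = approximateProb b n

  private
    0<j : ∀ r → 0ℚ < ofℕ (index r)
    0<j r = 0<ofℕ (index r)

    1≤j : ∀ r → 1ℚ ≤ℚ ofℕ (index r)
    1≤j r = ofℕ-mono {1} {index r} (ℕ.s≤s ℕ.z≤n)

    log-index : ∀ r → ∃[ e ] (2 ℕ.^ e ≤ index r × index r ℕ.< 2 ℕ.^ suc e)
    log-index r = proj₁ br , subst (_≤ index r) (ℕₚ.*-identityʳ (2 ℕ.^ proj₁ br)) (proj₁ (proj₂ br))
                           , subst (index r ℕ.<_) (ℕₚ.*-identityʳ (2 ℕ.^ suc (proj₁ br))) (proj₂ (proj₂ br))
      where br = bracket {2} ℕₚ.≤-refl 1 (index r) ℕₚ.≤-refl (ℕ.s≤s ℕ.z≤n)

    log-index≤E : ∀ r e → r ℕ.< horizon → 2 ℕ.^ e ≤ index r → e ≤ E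
    log-index≤E r e r<L 2^e≤j = ℕₚ.≤-pred (^-cancel-< {e} {suc E} (ℕₚ.≤-<-trans 2^e≤j (ℕₚ.<-≤-trans (ℕₚ.+-monoʳ-< 3 r/b<2^E) 3+≤)))
      where
      r/b<2^E : r ℕ./ b ℕ.< 2 ℕ.^ E
      r/b<2^E = ℕ÷.m<n*o⇒m/o<n (subst (r ℕ.<_) (ℕₚ.*-comm b (2 ℕ.^ E)) r<L)
      -- The index starts at 3, and E ≥ 2 makes 2^E large enough to absorb this offset.
      3+≤ : 3 ℕ.+ 2 ℕ.^ E ≤ 2 ℕ.^ suc E
      3+≤ = ℕₚ.≤-trans (ℕₚ.+-monoˡ-≤ (2 ℕ.^ E) (ℕₚ.≤-trans (ℕₚ.n≤1+n 3) (ℕₚ.^-monoʳ-≤ 2 2≤E)))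
        (ℕₚ.≤-reflexive (cong (2 ℕ.^ E ℕ.+_) (sym (ℕₚ.+-identityʳ (2 ℕ.^ E)))))

    lnAt-index-≤ : ∀ r e → index r ℕ.< 2 ℕ.^ suc e → lnAt n (ofℕ (index r)) ≤ℚ ofℕ (suc e)
    lnAt-index-≤ r e j< = lnAt-≤ n (suc e) {ofℕ (index r)} (1≤j r) (ofℕ-mono {index r} {2 ℕ.^ suc e} (ℕₚ.<⇒≤ j<))

    p*j : ∀ r → p r * ofℕ (index r) ≡ lnAt n (ofℕ (index r))
    p*j r = trans (solve 3 (λ l i j → l :* i :* j := l :* (j :* i)) refl l (inv j) j)
      (trans (cong (λ z → l * z) (inv-*ʳ (0<j r))) (ℚₚ.*-identityʳ l))
      where
      j = ofℕ (index r)
      l = lnAt n j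

    p-≤ : ∀ r {x} → lnAt n (ofℕ (index r)) ≤ℚ x * ofℕ (index r) → p r ≤ℚ x
    p-≤ r {x} h = *-cancel {p r} {x} (0<j r) (subst (_≤ℚ x * ofℕ (index r)) (sym (p*j r)) h)

    ≤-p : ∀ r {x} → x * ofℕ (index r) ≤ℚ lnAt n (ofℕ (index r)) → x ≤ℚ p r
    ≤-p r {x} h = *-cancel {x} {p r} (0<j r) (subst (x * ofℕ (index r) ≤ℚ_) (sym (p*j r)) h)

  p-valid : ∀ r → 0ℚ ≤ℚ p r × p r ≤ℚ ¾
  p-valid r = *-nn {lnAt n (ofℕ (index r))} {inv (ofℕ (index r))} (lnAt-nn {ofℕ (index r)} (1≤j r) n) (ℚₚ.<⇒≤ (inv-pos (0<j r))) , p-≤ r {¾} (begin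
    lnAt n (ofℕ j)              ≤⟨ lnAt-index-≤ r e j< ⟩
    ofℕ (suc e)                 ≡⟨ solve 1 (λ m → m := con (½ * ½) :* (con (ofℕ 4) :* m)) refl (ofℕ (suc e)) ⟩
    ½ * ½ * (ofℕ 4 * ofℕ (suc e)) ≡⟨ cong (λ z → ½ * ½ * z) (ofℕ-* 4 (suc e)) ⟨
    ½ * ½ * ofℕ (4 ℕ.* suc e)   ≤⟨ *-monoˡ {½ * ½} {ofℕ (4 ℕ.* suc e)} {ofℕ (3 ℕ.* j)} (ℚₚ.nonNegative⁻¹ (½ * ½)) (ofℕ-mono {4 ℕ.* suc e} {3 ℕ.* j} (4[e+1]≤3j {e} {j} (ℕₚ.m≤m+n 3 (r ℕ./ b)) 2^e≤j j<)) ⟩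
    ½ * ½ * ofℕ (3 ℕ.* j)       ≡⟨ cong (λ z → ½ * ½ * z) (ofℕ-* 3 j) ⟩
    ½ * ½ * (ofℕ 3 * ofℕ j)     ≡⟨ solve 1 (λ j → con (½ * ½) :* (con (ofℕ 3) :* j) := con ¾ :* j) refl (ofℕ j) ⟩
    ¾ * ofℕ j                   ∎)
    where
    j = index r
    e = proj₁ (log-index r)
    2^e≤j = proj₁ (proj₂ (log-index r))
    j< = proj₂ (proj₂ (log-index r))

  t : ℚ
  t = ½ ^ E

  0≤t : 0ℚ ≤ℚ t
  0≤t = ^-nn (ℚₚ.<⇒≤ 0<½) E

  2^E*t : ofℕ (2 ℕ.^ E) * t ≡ 1ℚ
  2^E*t = trans (cong (_* t) (ofℕ-^ 2 E)) (^-inverse {ofℕ 2} {½} refl E)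

  1/16 : ℚ
  1/16 = ½ * ½ * (½ * ½)

  -- In 1/16, a factor ¼ comes from `lnAt-low`, a ½ from rounding the index up to a power of 2, and
  -- a ½ from the 2 in `p-low`.
  q w : ℚ
  q = ofℕ E * (1/16 * t)
  w = 1ℚ - q

  0≤q : 0ℚ ≤ℚ q
  0≤q = *-nn (0≤ofℕ E) (*-nn (ℚₚ.nonNegative⁻¹ 1/16) 0≤t)

  q-≤ : ∀ m → m ℕ.* E ≤ 2 ℕ.^ E → ofℕ m * q ≤ℚ 1/16
  q-≤ m mE≤ = begin
    ofℕ m * (ofℕ E * (1/16 * t))          ≡⟨ solve 3 (λ m e t → m :* (e :* (con 1/16 :* t)) := con 1/16 :* (m :* e :* t)) refl (ofℕ m) (ofℕ E) t ⟩
    1/16 * (ofℕ m * ofℕ E * t)            ≡⟨ cong (λ z → 1/16 * (z * t)) (ofℕ-* m E) ⟨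
    1/16 * (ofℕ (m ℕ.* E) * t)            ≤⟨ *-monoˡ {1/16} (ℚₚ.nonNegative⁻¹ 1/16) (*-monoʳ {t} {ofℕ (m ℕ.* E)} {ofℕ (2 ℕ.^ E)} 0≤t (ofℕ-mono {m ℕ.* E} {2 ℕ.^ E} mE≤)) ⟩
    1/16 * (ofℕ (2 ℕ.^ E) * t)            ≡⟨ cong (λ z → 1/16 * z) 2^E*t ⟩
    1/16 * 1ℚ                             ≡⟨⟩
    1/16                                  ∎

  gq≤1 : ofℕ g * q ≤ℚ 1ℚ
  gq≤1 = ℚₚ.≤-trans (q-≤ g gE≤2^E) (≤-by {1/16} {1ℚ} (1ℚ - 1/16) (ℚₚ.nonNegative⁻¹ (1ℚ - 1/16)) refl)

  q≤1/16 : q ≤ℚ 1/16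
  q≤1/16 = subst (_≤ℚ 1/16) (ℚₚ.*-identityˡ q) (q-≤ 1 (ℕₚ.≤-trans (ℕₚ.≤-reflexive (ℕₚ.*-identityˡ E)) (ℕₚ.<⇒≤ (n<b^n ℕₚ.≤-refl E))))

  0<w : 0ℚ < w
  0<w = ℚₚ.<-≤-trans {0ℚ} {1ℚ - 1/16} (ℚₚ.positive⁻¹ (1ℚ - 1/16)) (ℚₚ.+-monoʳ-≤ 1ℚ (ℚₚ.neg-antimono-≤ q≤1/16))

  w+q≡1 : w + q ≡ 1ℚ
  w+q≡1 = solve 1 (λ q → con 1ℚ :- q :+ q := con 1ℚ) refl q

  p-low : ∀ r → r ℕ.< horizon → ofℕ 2 * q ≤ℚ p r
  p-low r r<L = ≤-p r {ofℕ 2 * q} (begin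
    ofℕ 2 * q * ofℕ j                           ≡⟨ solve 3 (λ E t j → con (ofℕ 2) :* (E :* (con 1/16 :* t)) :* j := con ⅛ :* t :* (E :* j)) refl (ofℕ E) t (ofℕ j) ⟩
    ⅛ * t * (ofℕ E * ofℕ j)                     ≡⟨ cong (λ z → ⅛ * t * z) (ofℕ-* E j) ⟨
    ⅛ * t * ofℕ (E ℕ.* j)                       ≤⟨ *-monoˡ {⅛ * t} {ofℕ (E ℕ.* j)} {ofℕ (2 ℕ.* (e ℕ.* 2 ℕ.^ E))} (*-nn (ℚₚ.nonNegative⁻¹ ⅛) 0≤t) (ofℕ-mono {E ℕ.* j} {2 ℕ.* (e ℕ.* 2 ℕ.^ E)} Ej≤) ⟩
    ⅛ * t * ofℕ (2 ℕ.* (e ℕ.* 2 ℕ.^ E))         ≡⟨ cong (λ z → ⅛ * t * z) (trans (ofℕ-* 2 (e ℕ.* 2 ℕ.^ E)) (cong (λ z → ofℕ 2 * z) (ofℕ-* e (2 ℕ.^ E)))) ⟩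
    ⅛ * t * (ofℕ 2 * (ofℕ e * ofℕ (2 ℕ.^ E)))   ≡⟨ solve 3 (λ t e P → con ⅛ :* t :* (con (ofℕ 2) :* (e :* P)) := con (½ * ½) :* e :* (P :* t)) refl t (ofℕ e) (ofℕ (2 ℕ.^ E)) ⟩
    ½ * ½ * ofℕ e * (ofℕ (2 ℕ.^ E) * t)         ≡⟨ cong (λ z → ½ * ½ * ofℕ e * z) 2^E*t ⟩
    ½ * ½ * ofℕ e * 1ℚ                          ≡⟨ ℚₚ.*-identityʳ (½ * ½ * ofℕ e) ⟩
    ½ * ½ * ofℕ e                               ≤⟨ lnAt-low e e≤E {ofℕ j} (ofℕ-mono {2 ℕ.^ e} {j} 2^e≤j) ⟩
    lnAt n (ofℕ j)                              ∎)
    where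
    j = index r
    e = proj₁ (log-index r)
    2^e≤j = proj₁ (proj₂ (log-index r))
    j< = proj₂ (proj₂ (log-index r))
    e≤E = log-index≤E r e r<L 2^e≤j
    1≤e : ∀ e → j ℕ.< 2 ℕ.^ suc e → 1 ≤ e
    1≤e zero    j<2 = ⊥-elim (ℕₚ.<⇒≱ j<2 (ℕₚ.≤-trans (ℕₚ.n≤1+n 2) (ℕₚ.m≤m+n 3 (r ℕ./ b))))
    1≤e (suc e) _   = ℕ.s≤s ℕ.z≤n
    Ej≤ : E ℕ.* j ≤ 2 ℕ.* (e ℕ.* 2 ℕ.^ E)
    Ej≤ = ℕₚ.≤-trans (ℕₚ.*-monoʳ-≤ E (ℕₚ.<⇒≤ j<)) (ℕₚ.≤-trans
      (ℕₚ.≤-reflexive (S.solve 2 (λ E p → E S.:* (S.con 2 S.:* p) S.:= S.con 2 S.:* (E S.:* p)) refl E (2 ℕ.^ e)))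
      (ℕₚ.*-monoʳ-≤ 2 (n/2^n-anti {e} E (1≤e e j<) e≤E)))

  κ : ℚ
  κ = ½ * t

  0≤κ : 0ℚ ≤ℚ κ
  0≤κ = *-nn (ℚₚ.<⇒≤ 0<½) 0≤t

  p≤mass : ∀ r → r ℕ.< horizon → p r ≤ℚ κ * ofℕ (mass r)
  p≤mass r r<L = p-≤ r {κ * ofℕ (mass r)} (begin
    lnAt n (ofℕ j)                              ≤⟨ lnAt-index-≤ r e j< ⟩
    ofℕ (suc e)                                 ≤⟨ ofℕ-mono {suc e} {suc E} (ℕ.s≤s (log-index≤E r e r<L 2^e≤j)) ⟩
    ofℕ (suc E)                                 ≡⟨ ℚₚ.*-identityʳ (ofℕ (suc E)) ⟨
    ofℕ (suc E) * 1ℚ                            ≡⟨ cong (λ z → ofℕ (suc E) * z) 2^E*t ⟨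
    ofℕ (suc E) * (ofℕ (2 ℕ.^ E) * t)           ≤⟨ *-monoˡ {ofℕ (suc E)} (0≤ofℕ (suc E)) (*-monoʳ {t} {ofℕ (2 ℕ.^ E)} {ofℕ (suc Q ℕ.* j)} 0≤t (ofℕ-mono {2 ℕ.^ E} {suc Q ℕ.* j} 2^E≤)) ⟩
    ofℕ (suc E) * (ofℕ (suc Q ℕ.* j) * t)       ≡⟨ cong (λ z → ofℕ (suc E) * (z * t)) (ofℕ-* (suc Q) j) ⟩
    ofℕ (suc E) * (ofℕ (suc Q) * ofℕ j * t)     ≡⟨ solve 4 (λ E Q j t → E :* (Q :* j :* t) := con ½ :* t :* (con (ofℕ 2) :* E :* Q) :* j) refl (ofℕ (suc E)) (ofℕ (suc Q)) (ofℕ j) t ⟩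
    κ * (ofℕ 2 * ofℕ (suc E) * ofℕ (suc Q)) * ofℕ j ≡⟨ cong (λ z → κ * z * ofℕ j) (trans (ofℕ-* (2 ℕ.* suc E) (suc Q)) (cong (_* ofℕ (suc Q)) (ofℕ-* 2 (suc E)))) ⟨
    κ * ofℕ (mass r) * ofℕ j                    ∎)
    where
    j = index r
    e = proj₁ (log-index r)
    2^e≤j = proj₁ (proj₂ (log-index r))
    j< = proj₂ (proj₂ (log-index r))
    Q = 2 ℕ.^ E ℕ./ j
    2^E≤ : 2 ℕ.^ E ≤ suc Q ℕ.* j
    2^E≤ = ℕₚ.≤-trans (ℕₚ.≤-reflexive (ℕ÷.m≡m%n+[m/n]*n (2 ℕ.^ E) j)) (ℕₚ.+-monoˡ-≤ (Q ℕ.* j) (ℕₚ.<⇒≤ (ℕ÷.m%n<n (2 ℕ.^ E) j)))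

  κ*capacity : κ * ofℕ capacity ≤ℚ ½ * ofℕ μ
  κ*capacity = ℚₚ.≤-reflexive (begin-equality
    ½ * t * ofℕ (2 ℕ.^ E ℕ.* μ)                 ≡⟨ cong (λ z → ½ * t * z) (ofℕ-* (2 ℕ.^ E) μ) ⟩
    ½ * t * (ofℕ (2 ℕ.^ E) * ofℕ μ)             ≡⟨ solve 3 (λ t P μ → con ½ :* t :* (P :* μ) := con ½ :* (P :* t :* μ)) refl t (ofℕ (2 ℕ.^ E)) (ofℕ μ) ⟩
    ½ * (ofℕ (2 ℕ.^ E) * t * ofℕ μ)             ≡⟨ cong (λ z → ½ * (z * ofℕ μ)) 2^E*t ⟩
    ½ * (1ℚ * ofℕ μ)                            ≡⟨ cong (λ z → ½ * z) (ℚₚ.*-identityˡ (ofℕ μ)) ⟩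
    ½ * ofℕ μ                                   ∎)

  g⅛^μ : ofℕ g * ⅛ ^ μ ≡ ofℕ 4
  g⅛^μ = begin-equality
    ofℕ (4 ℕ.* 8 ℕ.^ μ) * ⅛ ^ μ                 ≡⟨ cong (_* ⅛ ^ μ) (trans (ofℕ-* 4 (8 ℕ.^ μ)) (cong (λ z → ofℕ 4 * z) (ofℕ-^ 8 μ))) ⟩
    ofℕ 4 * ofℕ 8 ^ μ * ⅛ ^ μ                   ≡⟨ ℚₚ.*-assoc (ofℕ 4) (ofℕ 8 ^ μ) (⅛ ^ μ) ⟩
    ofℕ 4 * (ofℕ 8 ^ μ * ⅛ ^ μ)                 ≡⟨ cong (λ z → ofℕ 4 * z) (^-inverse {ofℕ 8} {⅛} refl μ) ⟩
    ofℕ 4 * 1ℚ                                  ≡⟨ ℚₚ.*-identityʳ (ofℕ 4) ⟩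
    ofℕ 4                                       ∎

  N : ℕ
  N = 16 ℕ.* 2 ℕ.^ E

  -- This is 1 - 1/N, while w = 1 - E/N. Since E need not divide N, the halving is proved for v^N
  -- and carried over by w ≤ v^E.
  v : ℚ
  v = 1ℚ - 1/16 * t

  private
    0≤1/N : 0ℚ ≤ℚ 1/16 * t
    0≤1/N = *-nn (ℚₚ.nonNegative⁻¹ 1/16) 0≤t

    t≤1 : t ≤ℚ 1ℚ
    t≤1 = ^≤1 (ℚₚ.<⇒≤ 0<½) (≤-by {½} {1ℚ} ½ (ℚₚ.<⇒≤ 0<½) refl) E

    0≤v : 0ℚ ≤ℚ v
    0≤v = diff≥0 (ℚₚ.≤-trans (*-monoˡ {1/16} (ℚₚ.nonNegative⁻¹ 1/16) t≤1) (≤-by {1/16 * 1ℚ} {1ℚ} (1ℚ - 1/16) (ℚₚ.nonNegative⁻¹ (1ℚ - 1/16)) refl))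

    v+1/N : v + 1/16 * t ≡ 1ℚ
    v+1/N = solve 1 (λ x → con 1ℚ :- x :+ x := con 1ℚ) refl (1/16 * t)

  w≤v^E : w ≤ℚ v ^ E
  w≤v^E = bernoulli⁺ 0≤v 0≤1/N v+1/N E

  v^N≤½ : v ^ N ≤ℚ ½
  v^N≤½ = *-cancel {v ^ N} {½} {ofℕ 2} (0<ofℕ 2) (subst (λ z → v ^ N * z ≤ℚ ½ * ofℕ 2) N*1/N (bernoulli⁻ 0≤v 0≤1/N v+1/N N))
    where
    N*1/N : 1ℚ + ofℕ N * (1/16 * t) ≡ ofℕ 2
    N*1/N = begin-equality
      1ℚ + ofℕ N * (1/16 * t)                   ≡⟨ cong (λ z → 1ℚ + z * (1/16 * t)) (ofℕ-* 16 (2 ℕ.^ E)) ⟩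
      1ℚ + ofℕ 16 * ofℕ (2 ℕ.^ E) * (1/16 * t)  ≡⟨ solve 2 (λ P t → con 1ℚ :+ con (ofℕ 16) :* P :* (con 1/16 :* t) := con 1ℚ :+ P :* t) refl (ofℕ (2 ℕ.^ E)) t ⟩
      1ℚ + ofℕ (2 ℕ.^ E) * t                    ≡⟨ cong (λ z → 1ℚ + z) 2^E*t ⟩
      ofℕ 2                                     ∎

  w^BN≤ : ∀ B → w ^ (B ℕ.* N) ≤ℚ ½ ^ (ℓ ℕ.* B)
  w^BN≤ B = begin
    w ^ (B ℕ.* N)                               ≤⟨ ^-monoˡ (ℚₚ.<⇒≤ 0<w) w≤v^E (B ℕ.* N) ⟩
    (v ^ E) ^ (B ℕ.* N)                         ≡⟨ ^-assocʳ v E (B ℕ.* N) ⟩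
    v ^ (E ℕ.* (B ℕ.* N))                       ≡⟨ cong (v ^_) (trans (sym (ℕₚ.*-assoc E B N)) (ℕₚ.*-comm (E ℕ.* B) N)) ⟩
    v ^ (N ℕ.* (E ℕ.* B))                       ≡⟨ ^-assocʳ v N (E ℕ.* B) ⟨
    (v ^ N) ^ (E ℕ.* B)                         ≤⟨ ^-monoˡ (^-nn 0≤v N) v^N≤½ (E ℕ.* B) ⟩
    ½ ^ (E ℕ.* B)                               ≤⟨ ^-antiʳ (ℚₚ.<⇒≤ 0<½) (≤-by {½} {1ℚ} ½ (ℚₚ.<⇒≤ 0<½) refl) (ℕₚ.*-monoˡ-≤ B ℓ≤E) ⟩
    ½ ^ (ℓ ℕ.* B)                               ∎

  -- Of the 2 h + 2 factors ½^ℓ, one pays for the k < 2^ℓ stations, one supplies the ½, and 2 h give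
  -- ¼^(h ℓ): exactly the lower bound available for k^(-η).
  k*w^≤ : ∀ h → ofℕ k * w ^ ((2 ℕ.* h ℕ.+ 2) ℕ.* N) ≤ℚ ½ * (½ * ½) ^ (h ℕ.* ℓ)
  k*w^≤ h = begin
    ofℕ k * w ^ ((2 ℕ.* h ℕ.+ 2) ℕ.* N)         ≤⟨ *-mono {ofℕ k} {ofℕ (2 ℕ.^ ℓ)} {w ^ ((2 ℕ.* h ℕ.+ 2) ℕ.* N)} {½ ^ (ℓ ℕ.* (2 ℕ.* h ℕ.+ 2))}
                                                     (0≤ofℕ k) (^-nn 0≤½ (ℓ ℕ.* (2 ℕ.* h ℕ.+ 2))) (ofℕ-mono {k} {2 ℕ.^ ℓ} (ℕₚ.<⇒≤ k<2^ℓ)) (w^BN≤ (2 ℕ.* h ℕ.+ 2)) ⟩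
    ofℕ (2 ℕ.^ ℓ) * ½ ^ (ℓ ℕ.* (2 ℕ.* h ℕ.+ 2)) ≡⟨ cong₂ _*_ (ofℕ-^ 2 ℓ) (cong (½ ^_) (S.solve 2 (λ l h → l S.:* (S.con 2 S.:* h S.:+ S.con 2) S.:= S.con 2 S.:* (h S.:* l) S.:+ (l S.:+ l)) refl ℓ h)) ⟩
    ofℕ 2 ^ ℓ * ½ ^ (2 ℕ.* (h ℕ.* ℓ) ℕ.+ (ℓ ℕ.+ ℓ)) ≡⟨ cong (λ z → ofℕ 2 ^ ℓ * z) (trans (^-homo-* ½ (2 ℕ.* (h ℕ.* ℓ)) (ℓ ℕ.+ ℓ)) (cong₂ _*_ (sym (^-assocʳ ½ 2 (h ℕ.* ℓ))) (^-homo-* ½ ℓ ℓ))) ⟩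
    ofℕ 2 ^ ℓ * ((½ ^ 2) ^ (h ℕ.* ℓ) * (½ ^ ℓ * ½ ^ ℓ)) ≡⟨ solve 3 (λ P Q H → P :* (Q :* (H :* H)) := P :* H :* H :* Q) refl (ofℕ 2 ^ ℓ) ((½ ^ 2) ^ (h ℕ.* ℓ)) (½ ^ ℓ) ⟩
    ofℕ 2 ^ ℓ * ½ ^ ℓ * ½ ^ ℓ * (½ ^ 2) ^ (h ℕ.* ℓ) ≡⟨ cong (λ z → z * ½ ^ ℓ * (½ ^ 2) ^ (h ℕ.* ℓ)) (^-inverse {ofℕ 2} {½} refl ℓ) ⟩
    1ℚ * ½ ^ ℓ * (½ ^ 2) ^ (h ℕ.* ℓ)            ≡⟨ cong (_* (½ ^ 2) ^ (h ℕ.* ℓ)) (ℚₚ.*-identityˡ (½ ^ ℓ)) ⟩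
    ½ ^ ℓ * (½ ^ 2) ^ (h ℕ.* ℓ)                 ≤⟨ *-monoʳ {(½ ^ 2) ^ (h ℕ.* ℓ)} (^-nn (ℚₚ.nonNegative⁻¹ (½ ^ 2)) (h ℕ.* ℓ))
                                                     (^-antiʳ 0≤½ (≤-by {½} {1ℚ} ½ 0≤½ refl) (ℕₚ.<⇒≤ 2≤ℓ)) ⟩
    ½ ^ 1 * (½ ^ 2) ^ (h ℕ.* ℓ)                 ≡⟨⟩
    ½ * (½ * ½) ^ (h ℕ.* ℓ)                     ∎
    where
    0≤½ = ℚₚ.<⇒≤ 0<½

  open Model p p-valid using (prob; module Potential)

  convergence : ∀ h → 32 ℕ.* (2 ℕ.* h ℕ.+ 2) ≤ b → ∀ (A : Adversary k) L → horizon ≤ L → ∀ m →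
    prob A m [] (Vec.replicate k asleep) (every activated) - ½ * (½ * ½) ^ (h ℕ.* ℓ)
      ≤ℚ prob A (m ℕ.+ horizon) [] (Vec.replicate k asleep) (every (succeededWithin L))
  convergence h b₀≤b A L horizon≤L m = ℚₚ.≤-trans
    (ℚₚ.+-monoʳ-≤ (prob A m [] (Vec.replicate k asleep) (every activated)) (ℚₚ.neg-antimono-≤ (k*w^≤ h)))
    (success-probability A L horizon≤L m ((2 ℕ.* h ℕ.+ 2) ℕ.* N) (budget (2 ℕ.* h ℕ.+ 2) b₀≤b))
    where
    open Potential w q 0<w 0≤q w+q≡1 horizon p-low mass κ 0≤κ p≤mass μ capacity κ*capacity g gq≤1 g⅛^μ

-- Agreement of the real and the rational process at precision n.

module Precision (b : ℕ) .{{_ : NonZero b}} (n : ℕ)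
  (p-valid : ∀ r → 0ℚ ≤ℚ approximateProb b n r × approximateProb b n r ≤ℚ Coins.¾) where

  open Coins
  open Model (approximateProb b n) p-valid
  open Rounds

  seq-transmitProb : ∀ x → seq (transmitProb b x) n ≡ transmit x
  seq-transmitProb asleep           = refl
  seq-transmitProb (active zero)    = refl
  seq-transmitProb (active (suc r)) = refl
  seq-transmitProb (off r)          = refl

  -- Sums and products of reals act termwise on their sequences, so taking the n-th approximation
  -- commutes with the recursion exactly, without error terms.
  seq-expectation : ∀ {k} (s : Vec Status k) (f : Subset k → ℝ) (g : Subset k → ℚ) → (∀ c → seq (f c) n ≡ g c) →
    seq (expectation (Vec.map (transmitProb b) s) f) n ≡ 𝔼 (coins s) g
  seq-expectation []      f g f≡g = f≡g []
  seq-expectation (x ∷ s) f g f≡g = cong₂ _+_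
    (cong₂ _*_ (seq-transmitProb x) (seq-expectation s (λ c → f (true ∷ c)) (λ c → g (true ∷ c)) (λ c → f≡g (true ∷ c))))
    (cong₂ _*_ (cong (λ z → 1ℚ - z) (seq-transmitProb x)) (seq-expectation s (λ c → f (false ∷ c)) (λ c → g (false ∷ c)) (λ c → f≡g (false ∷ c))))

  seq-probFrom : ∀ {k} (A : Adversary k) m h s E → seq (probFrom b A m h s E) n ≡ prob A m h s E
  seq-probFrom A zero h s E = indicator (E s)
    where
    indicator : ∀ e → seq (if e then 1ᴿ else 0ᴿ) n ≡ ⟦ e ⟧
    indicator true  = refl
    indicator false = refl
  seq-probFrom A (suc m) h s E = seq-expectation (advance (A h) s) _ _
    (λ c → seq-probFrom A m (c ∷ h) (resolve c (advance (A h) s)) E)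

-- The horizon b 2ᴱ lies below the latency bound.

module Latency (b : ℕ) where

  -- 192 = 3 · 8², from ln ln k ≤ 3 μ and ln k ≥ ℓ / 8.
  constant : ℕ
  constant = b ℕ.* (2 ℕ.^ 13 ℕ.* 192)

  module _ {k} (3≤k : 3 ≤ k) (sc : Parameters.Scale k) where

    open Logarithm
    open Parameters
    open Scale sc
    open CauchyLemmas using (max³)
    open Positivity using (fromℕ-pos; ln-pos; 1<ln)
    open ℚₚ.≤-Reasoning

    private
      X : ℕ
      X = k ℕ.* (ℓ ℕ.* ℓ)

      module At (n : ℕ) (low : ∀ e → e ≤ ℓ → ∀ {y} → ofℕ (2 ℕ.^ e) ≤ℚ y → ½ * ½ * ofℕ e ≤ℚ lnAt n y)
        (1≤l : 1ℚ ≤ℚ lnAt n (ofℕ k)) (0<x : 0ℚ < lnAt n (lnAt n (ofℕ k))) where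

        l = lnAt n (ofℕ k)
        x = lnAt n l

        l≤ℓ : l ≤ℚ ofℕ ℓ
        l≤ℓ = lnAt-≤ n ℓ {ofℕ k} (ofℕ-mono {1} {k} (3≤⇒1≤ 3≤k)) (ofℕ-mono {k} {2 ℕ.^ ℓ} (ℕₚ.<⇒≤ k<2^ℓ))

        x≤3μ : x ≤ℚ ofℕ (3 ℕ.* μ)
        x≤3μ = lnAt-≤ n (3 ℕ.* μ) {l} 1≤l (ℚₚ.≤-trans l≤ℓ (ofℕ-mono {ℓ} {2 ℕ.^ (3 ℕ.* μ)} (ℕₚ.≤-trans (ℕₚ.<⇒≤ ℓ<8^μ) (ℕₚ.≤-reflexive (ℕₚ.^-*-assoc 2 3 μ)))))

        -- As k ≥ 2^(ℓ - 1), the logarithm is at least (ℓ - 1) / 4, and ℓ ≥ 2 gives ℓ ≤ 2 (ℓ - 1).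
        ⅛ℓ≤l : Coins.⅛ * ofℕ ℓ ≤ℚ l
        ⅛ℓ≤l = begin
          Coins.⅛ * ofℕ ℓ               ≤⟨ *-monoˡ {Coins.⅛} {ofℕ ℓ} {ofℕ (2 ℕ.* ℕ.pred ℓ)} (ℚₚ.nonNegative⁻¹ Coins.⅛) (ofℕ-mono {ℓ} {2 ℕ.* ℕ.pred ℓ} (ℓ≤2[ℓ-1] 2≤ℓ)) ⟩
          Coins.⅛ * ofℕ (2 ℕ.* ℕ.pred ℓ) ≡⟨ cong (λ z → Coins.⅛ * z) (ofℕ-* 2 (ℕ.pred ℓ)) ⟩
          Coins.⅛ * (ofℕ 2 * ofℕ (ℕ.pred ℓ)) ≡⟨ solve 1 (λ e → con Coins.⅛ :* (con (ofℕ 2) :* e) := con (½ * ½) :* e) refl (ofℕ (ℕ.pred ℓ)) ⟩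
          ½ * ½ * ofℕ (ℕ.pred ℓ)        ≤⟨ low (ℕ.pred ℓ) ℕₚ.pred[n]≤n {ofℕ k} (ofℕ-mono {2 ℕ.^ ℕ.pred ℓ} {k} (2^[ℓ-1]≤k 2≤ℓ 2^ℓ≤2k)) ⟩
          l                             ∎
          where
          ℓ≤2[ℓ-1] : ∀ {ℓ} → 2 ≤ ℓ → ℓ ≤ 2 ℕ.* ℕ.pred ℓ
          ℓ≤2[ℓ-1] {suc zero} (ℕ.s≤s ())
          ℓ≤2[ℓ-1] {suc (suc e)} _ = ℕₚ.≤-trans (ℕₚ.≤-reflexive (ℕₚ.+-comm 1 (suc e))) (ℕₚ.+-monoʳ-≤ (suc e) (ℕ.s≤s ℕ.z≤n))
          2^[ℓ-1]≤k : ∀ {ℓ} → 2 ≤ ℓ → 2 ℕ.^ ℓ ≤ 2 ℕ.* k → 2 ℕ.^ ℕ.pred ℓ ≤ k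
          2^[ℓ-1]≤k {suc e} _ le = ℕₚ.*-cancelˡ-≤ 2 le

        -- Multiplying by `x` removes the reciprocal. The 2^13 in `constant` is the 2 · 2^12 of
        -- `2^Eμ≤2kℓℓ`.
        horizon-bound : ofℕ (b ℕ.* 2 ℕ.^ E) ≤ℚ ofℕ constant * ofℕ k * (l * l) * inv x
        horizon-bound = *-cancel {r = x} 0<x (begin
          ofℕ (b ℕ.* 2 ℕ.^ E) * x                          ≤⟨ *-monoˡ {ofℕ (b ℕ.* 2 ℕ.^ E)} {x} {ofℕ (3 ℕ.* μ)} (0≤ofℕ (b ℕ.* 2 ℕ.^ E)) x≤3μ ⟩
          ofℕ (b ℕ.* 2 ℕ.^ E) * ofℕ (3 ℕ.* μ)              ≡⟨ ofℕ-* (b ℕ.* 2 ℕ.^ E) (3 ℕ.* μ) ⟨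
          ofℕ (b ℕ.* 2 ℕ.^ E ℕ.* (3 ℕ.* μ))                ≤⟨ ofℕ-mono natural ⟩
          ofℕ (b ℕ.* c ℕ.* X ℕ.* 3)                        ≡⟨ trans (ofℕ-* (b ℕ.* c ℕ.* X) 3) (cong (_* ofℕ 3) (trans (ofℕ-* (b ℕ.* c) X)
                                                                (cong (λ z → ofℕ (b ℕ.* c) * z) (trans (ofℕ-* k (ℓ ℕ.* ℓ)) (cong (λ z → ofℕ k * z) (ofℕ-* ℓ ℓ)))))) ⟩
          ofℕ (b ℕ.* c) * (ofℕ k * (ofℕ ℓ * ofℕ ℓ)) * ofℕ 3 ≡⟨ solve 3 (λ B K L → B :* (K :* (L :* L)) :* con (ofℕ 3) := B :* con (ofℕ 192) :* K :* (con Coins.⅛ :* L :* (con Coins.⅛ :* L))) refl (ofℕ (b ℕ.* c)) (ofℕ k) (ofℕ ℓ) ⟩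
          ofℕ (b ℕ.* c) * ofℕ 192 * ofℕ k * (Coins.⅛ * ofℕ ℓ * (Coins.⅛ * ofℕ ℓ))
            ≤⟨ *-monoˡ {ofℕ (b ℕ.* c) * ofℕ 192 * ofℕ k} {Coins.⅛ * ofℕ ℓ * (Coins.⅛ * ofℕ ℓ)} {l * l} (*-nn (*-nn (0≤ofℕ (b ℕ.* c)) (0≤ofℕ 192)) (0≤ofℕ k))
                 (*-mono {Coins.⅛ * ofℕ ℓ} {l} {Coins.⅛ * ofℕ ℓ} {l} 0≤⅛ℓ (ℚₚ.≤-trans 0≤1 1≤l) ⅛ℓ≤l ⅛ℓ≤l) ⟩
          ofℕ (b ℕ.* c) * ofℕ 192 * ofℕ k * (l * l)        ≡⟨ cong (λ z → z * ofℕ k * (l * l)) (trans (sym (ofℕ-* (b ℕ.* c) 192)) (cong ofℕ (ℕₚ.*-assoc b c 192))) ⟩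
          ofℕ constant * ofℕ k * (l * l)                   ≡⟨ ℚₚ.*-identityʳ (ofℕ constant * ofℕ k * (l * l)) ⟨
          ofℕ constant * ofℕ k * (l * l) * 1ℚ              ≡⟨ cong (λ z → ofℕ constant * ofℕ k * (l * l) * z) (trans (ℚₚ.*-comm (inv x) x) (inv-*ʳ 0<x)) ⟨
          ofℕ constant * ofℕ k * (l * l) * (inv x * x)     ≡⟨ ℚₚ.*-assoc (ofℕ constant * ofℕ k * (l * l)) (inv x) x ⟨
          ofℕ constant * ofℕ k * (l * l) * inv x * x       ∎)
          where
          c = 2 ℕ.^ 13
          0≤⅛ℓ = *-nn {Coins.⅛} {ofℕ ℓ} (ℚₚ.nonNegative⁻¹ Coins.⅛) (0≤ofℕ ℓ)
          natural : b ℕ.* 2 ℕ.^ E ℕ.* (3 ℕ.* μ) ≤ b ℕ.* c ℕ.* X ℕ.* 3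
          natural = ℕₚ.≤-trans (ℕₚ.≤-reflexive (S.solve 3 (λ b p m → b S.:* p S.:* (S.con 3 S.:* m) S.:= b S.:* (p S.:* m) S.:* S.con 3) refl b (2 ℕ.^ E) μ))
            (ℕₚ.*-monoˡ-≤ 3 (ℕₚ.≤-trans (ℕₚ.*-monoʳ-≤ b (ℕₚ.≤-trans 2^Eμ≤2kℓℓ (ℕₚ.≤-reflexive (sym (ℕₚ.*-assoc 2 (2 ℕ.^ 12) X))))) (ℕₚ.≤-reflexive (sym (ℕₚ.*-assoc b c X)))))

      eventually-> : ∀ {y z} → y <ᴿ z → ∃[ N ] (∀ n → N ≤ n → seq y n < seq z n)
      eventually-> {y} (ε , 0<ε , N , y+ε≤z) = N , λ n N≤n → ℚₚ.<-≤-trans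
        (subst (_< seq y n + ε) (ℚₚ.+-identityʳ (seq y n)) (ℚₚ.+-monoʳ-< (seq y n) 0<ε)) (y+ε≤z n N≤n)

      0<k : 0ᴿ <ᴿ fromℕ k
      0<k = fromℕ-pos (3≤⇒1≤ 3≤k)

      1<k : 1ᴿ <ᴿ fromℕ k
      1<k = 1ℚ , 0<1 , 0 , λ _ _ → ofℕ-mono {2} {k} (ℕₚ.<⇒≤ 3≤k)

      1<ln-k : ∃[ N ] (∀ n → N ≤ n → 1ℚ < lnAt n (ofℕ k))
      1<ln-k = eventually-> {1ᴿ} {ln (fromℕ k) 0<k} (1<ln 3≤k 0<k)

      0<ln-k : 0ᴿ <ᴿ ln (fromℕ k) 0<k
      0<ln-k = ln-pos {fromℕ k} 0<k 1<k

      0<ln-ln-k : ∃[ N ] (∀ n → N ≤ n → 0ℚ < lnAt n (lnAt n (ofℕ k)))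
      0<ln-ln-k = eventually-> {0ᴿ} {ln (ln (fromℕ k) 0<k) 0<ln-k} (ln-pos {ln (fromℕ k) 0<k} 0<ln-k (1<ln 3≤k 0<k))

      seq-latencyBound : ∀ c n → let l = lnAt n (ofℕ k) in
        seq (latencyBound (fromℕ c) k 3≤k) n ≡ ofℕ c * ofℕ k * (l * l) * inv (lnAt n l)
      seq-latencyBound c n = refl

      eventually-≤latencyBound : ∃[ N ] (∀ n → N ≤ n → ofℕ (b ℕ.* 2 ℕ.^ E) ≤ℚ seq (latencyBound (fromℕ constant) k 3≤k) n)
      eventually-≤latencyBound = combine 1<ln-k 0<ln-ln-k (lnAt-≥ ℓ)
        where
        combine : ∃[ N ] (∀ n → N ≤ n → 1ℚ < lnAt n (ofℕ k)) → ∃[ N ] (∀ n → N ≤ n → 0ℚ < lnAt n (lnAt n (ofℕ k))) →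
          ∃[ N ] (∀ n → N ≤ n → ∀ e → e ≤ ℓ → ∀ {y} → ofℕ (2 ℕ.^ e) ≤ℚ y → ½ * ½ * ofℕ e ≤ℚ lnAt n y) →
          ∃[ N ] (∀ n → N ≤ n → ofℕ (b ℕ.* 2 ℕ.^ E) ≤ℚ seq (latencyBound (fromℕ constant) k 3≤k) n)
        combine (N₁ , 1<l) (N₂ , 0<x) (N₃ , low) = N₁ ℕ.⊔ (N₂ ℕ.⊔ N₃) , bound
          where
          bound : ∀ n → N₁ ℕ.⊔ (N₂ ℕ.⊔ N₃) ≤ n → ofℕ (b ℕ.* 2 ℕ.^ E) ≤ℚ seq (latencyBound (fromℕ constant) k 3≤k) n
          bound n N≤n = subst (ofℕ (b ℕ.* 2 ℕ.^ E) ≤ℚ_) (sym (seq-latencyBound constant n)) (At.horizon-bound n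
            (low n (proj₂ (proj₂ parts))) (ℚₚ.<⇒≤ (1<l n (proj₁ parts))) (0<x n (proj₁ (proj₂ parts))))
            where parts = max³ N₁ N₂ N₃ N≤n

    -- The horizon is an integer: if it exceeded `L`, then L + 1 would be at most the horizon, hence
    -- eventually at most the latency bound, against the floor relation.
    horizon≤ : ∀ L → ⌊ latencyBound (fromℕ constant) k 3≤k ⌋≤ L → b ℕ.* 2 ℕ.^ E ≤ L
    horizon≤ L below = ℕₚ.≮⇒≥ (λ L<h →
      clash L<h eventually-≤latencyBound (eventually-> {latencyBound (fromℕ constant) k 3≤k} {fromℕ (suc L)} below))
      where
      bound : ℕ → ℚ
      bound = seq (latencyBound (fromℕ constant) k 3≤k)
      clash : L ℕ.< b ℕ.* 2 ℕ.^ E → ∃[ N ] (∀ n → N ≤ n → ofℕ (b ℕ.* 2 ℕ.^ E) ≤ℚ bound n) → ∃[ N ] (∀ n → N ≤ n → bound n < ofℕ (suc L)) → ⊥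
      clash L<h (N , h≤) (N′ , bound<) = ℚₚ.<-irrefl refl (ℚₚ.≤-<-trans (ofℕ-mono {suc L} {b ℕ.* 2 ℕ.^ E} L<h)
        (ℚₚ.≤-<-trans (h≤ (N ℕ.⊔ N′) (ℕₚ.m≤m⊔n N N′)) (bound< (N ℕ.⊔ N′) (ℕₚ.m≤n⊔m N N′))))

-- Comparison with k^(-η) and return to the reals.

module Conclusion (η : ℝ) (0<η : 0ᴿ <ᴿ η) where

  open CauchyLemmas using (max³; eventually-bounded)
  open Exponential using (expSum-neg-≥; partialSum≡Σ)
  open Logarithm
  open Parameters
  open ℚₚ.≤-Reasoning

  private
    bounded = eventually-bounded {seq η} (cauchy η)
    N₁ = proj₁ (proj₂ (proj₂ bounded))
    N₂ = proj₁ (proj₂ (proj₂ 0<η))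

  h : ℕ
  h = proj₁ (archimedean (proj₁ bounded))

  private
    η≤h : ∀ n → N₁ ≤ n → seq η n ≤ℚ ofℕ h
    η≤h n N≤n = ℚₚ.≤-trans (≤abs (seq η n)) (ℚₚ.≤-trans (proj₂ (proj₂ (proj₂ bounded)) n N≤n) (proj₂ (archimedean (proj₁ bounded))))

    0≤η : ∀ n → N₂ ≤ n → 0ℚ ≤ℚ seq η n
    0≤η n N≤n = ℚₚ.≤-trans (ℚₚ.<⇒≤ (proj₁ (proj₂ 0<η))) (subst (_≤ℚ seq η n) (ℚₚ.+-identityˡ (proj₁ 0<η)) (proj₂ (proj₂ (proj₂ 0<η)) n N≤n))

  -- For a real exponent only η ln k ≤ h ℓ is used, with `h` a natural bound for η; `expSum-neg-≥`
  -- then applies with B = h ℓ.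
  pow-≥ : ∀ {k} (3≤k : 3 ≤ k) (sc : Scale k) → let ℓ = Scale.ℓ sc in
    ∀ n → N₁ ≤ n → N₂ ≤ n → 16 ℕ.* (h ℕ.* ℓ) ℕ.+ 2 ≤ n → ½ * (½ * ½) ^ (h ℕ.* ℓ) ≤ℚ seq (powℕ k (3≤⇒1≤ 3≤k) (-ᴿ η)) n
  pow-≥ {k} 3≤k sc n N₁≤n N₂≤n N₃≤n = begin
    ½ * (½ * ½) ^ (h ℕ.* ℓ)                        ≤⟨ expSum-neg-≥ (h ℕ.* ℓ) 0≤y y≤ n N₃≤n ⟩
    Exponential.expSum n (- (seq η n * l))         ≡⟨ cong (Exponential.expSum n) (solve 2 (λ a b → :- (a :* b) := :- a :* b) refl (seq η n) l) ⟩
    Exponential.expSum n (- seq η n * l)           ≡⟨ partialSum≡Σ expTerm (- seq η n * l) n ⟨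
    partialSum expTerm (- seq η n * l) n           ∎
    where
    open Scale sc
    l = lnAt n (ofℕ k)
    1≤k : 1ℚ ≤ℚ ofℕ k
    1≤k = ofℕ-mono {1} {k} (3≤⇒1≤ 3≤k)
    0≤y : 0ℚ ≤ℚ seq η n * l
    0≤y = *-nn {seq η n} {l} (0≤η n N₂≤n) (lnAt-nn {ofℕ k} 1≤k n)
    y≤ : seq η n * l ≤ℚ ofℕ (h ℕ.* ℓ)
    y≤ = subst (seq η n * l ≤ℚ_) (sym (ofℕ-* h ℓ)) (*-mono {seq η n} {ofℕ h} {l} {ofℕ ℓ} (0≤η n N₂≤n) (0≤ofℕ ℓ) (η≤h n N₁≤n)
      (lnAt-≤ n ℓ {ofℕ k} 1≤k (ofℕ-mono {k} {2 ℕ.^ ℓ} (ℕₚ.<⇒≤ k<2^ℓ))))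

  b₀ : ℕ
  b₀ = 32 ℕ.* (2 ℕ.* h ℕ.+ 2)

  module _ (b : ℕ) .{{_ : NonZero b}} (b₀≤b : b₀ ≤ b) {k} (3≤k : 3 ≤ k) (sc : Scale k) where

    open Scale sc using (ℓ; E)

    -- The whole loss ε is inherited from the activation of all stations within `m` rounds, and the
    -- slack δ from the comparison of reals there; the success estimate itself is exact at every
    -- sufficient precision.
    all-succeed : ∀ (A : Adversary k) → ActivatesAll b A → ∀ L → b ℕ.* 2 ℕ.^ E ≤ L →
      ProbAtLeast b A (every (succeededWithin L)) (1ᴿ -ᴿ powℕ k (3≤⇒1≤ 3≤k) (-ᴿ η))
    all-succeed A activates L horizon≤L ε 0<ε = m ℕ.+ b ℕ.* 2 ℕ.^ E , λ δ 0<δ →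
      M δ 0<δ ℕ.⊔ (N₃ ℕ.⊔ N₄) , λ n N≤n → bound δ 0<δ n (ℕₚ.m⊔n≤o⇒m≤o (M δ 0<δ) (N₃ ℕ.⊔ N₄) N≤n) (ℕₚ.m⊔n≤o⇒n≤o (M δ 0<δ) (N₃ ℕ.⊔ N₄) N≤n)
      where
      m = proj₁ (activates ε 0<ε)
      N₃ = 16 ℕ.* (h ℕ.* ℓ) ℕ.+ 2
      N₄ = proj₁ (lnAt-≥ E)
      M : ∀ δ → 0ℚ < δ → ℕ
      M δ 0<δ = proj₁ (proj₂ (activates ε 0<ε) δ 0<δ) ℕ.⊔ (N₁ ℕ.⊔ N₂)
      bound : ∀ δ 0<δ n → M δ 0<δ ≤ n → N₃ ℕ.⊔ N₄ ≤ n →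
        seq (1ᴿ -ᴿ powℕ k (3≤⇒1≤ 3≤k) (-ᴿ η)) n
          ≤ℚ seq (probAfter b A (m ℕ.+ b ℕ.* 2 ℕ.^ E) (every (succeededWithin L)) +ᴿ fromℚ ε) n + δ
      bound δ 0<δ n N≤n N′≤n = begin
        1ℚ - pow                    ≤⟨ ℚₚ.+-mono-≤ act≥ (ℚₚ.neg-antimono-≤ (pow-≥ 3≤k sc n (proj₁ (proj₂ parts)) (proj₂ (proj₂ parts)) (ℕₚ.m⊔n≤o⇒m≤o N₃ N₄ N′≤n))) ⟩
        act + ε + δ - x             ≡⟨ solve 4 (λ a e d x → a :+ e :+ d :- x := a :- x :+ e :+ d) refl act ε δ x ⟩
        act - x + ε + δ             ≤⟨ ℚₚ.+-monoˡ-≤ δ (ℚₚ.+-monoˡ-≤ ε success) ⟩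
        seq (probAfter b A (m ℕ.+ b ℕ.* 2 ℕ.^ E) (every (succeededWithin L))) n + ε + δ ∎
        where
        pow = seq (powℕ k (3≤⇒1≤ 3≤k) (-ᴿ η)) n
        x = ½ * (½ * ½) ^ (h ℕ.* ℓ)
        act = seq (probAfter b A m (every activated)) n
        parts = max³ (proj₁ (proj₂ (activates ε 0<ε) δ 0<δ)) N₁ N₂ N≤n
        act≥ : 1ℚ ≤ℚ act + ε + δ
        act≥ = proj₂ (proj₂ (activates ε 0<ε) δ 0<δ) n (proj₁ parts)
        open Approximation 3≤k sc b n (proj₂ (lnAt-≥ E) n (ℕₚ.m⊔n≤o⇒n≤o N₃ N₄ N′≤n)) using (p-valid; convergence)
        open Precision b n p-valid using (seq-probFrom)
        success : act - x ≤ℚ seq (probAfter b A (m ℕ.+ b ℕ.* 2 ℕ.^ E) (every (succeededWithin L))) n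
        success = subst₂ (λ y z → y - x ≤ℚ z)
          (sym (seq-probFrom A m [] (Vec.replicate k asleep) (every activated)))
          (sym (seq-probFrom A (m ℕ.+ b ℕ.* 2 ℕ.^ E) [] (Vec.replicate k asleep) (every (succeededWithin L))))
          (convergence h b₀≤b A L horizon≤L m)

theorem5p2 : ∀ (η : ℝ) → 0ᴿ <ᴿ η →
    ∃[ b₀ ] ∀ (b : ℕ) .{{_ : NonZero b}} → b₀ ≤ b →
    ∃[ C ] ∀ (k : ℕ) (3≤k : 3 ≤ k) (A : Adversary k) → ActivatesAll b A →
    ∀ (L : ℕ) → ⌊ latencyBound C k 3≤k ⌋≤ L →
    ProbAtLeast b A (every (succeededWithin L)) (1ᴿ -ᴿ powℕ k (3≤⇒1≤ 3≤k) (-ᴿ η))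
theorem5p2 η 0<η = b₀ , λ b b₀≤b → fromℕ (Latency.constant b) , λ k 3≤k A activates L bound →
  at-scale b b₀≤b 3≤k (Parameters.scale k 3≤k) A activates L bound
  where
  open Conclusion η 0<η
  -- The scale enters as a variable, so that only the inequalities of the record are available from
  -- here on.
  at-scale : ∀ b .{{_ : NonZero b}} → b₀ ≤ b → ∀ {k} (3≤k : 3 ≤ k) → Parameters.Scale k → (A : Adversary k) → ActivatesAll b A →
    ∀ L → ⌊ latencyBound (fromℕ (Latency.constant b)) k 3≤k ⌋≤ L →
    ProbAtLeast b A (every (succeededWithin L)) (1ᴿ -ᴿ powℕ k (3≤⇒1≤ 3≤k) (-ᴿ η))
  at-scale b b₀≤b 3≤k sc A activates L bound = all-succeed b b₀≤b 3≤k sc A activates L (Latency.horizon≤ b 3≤k sc L bound)
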